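{- For every $n\geq 1$, \[\langle \mathrm{Frob}(R_n^{(0,3)};u,v,w), s_{(1^n)}\rangle = s_{(n-1)}(u,v,w)+s_{(n-2,1,1)}(u,v,w) = \binom{n+1}{2}_{u,v,w} + uvw\binom{n-1}{2}_{u,v,w}.\]
   Context: Let $\Lambda=\mathbb{Q}[\theta_1,\dots,\theta_n,\xi_1,\dots,\xi_n,\rho_1,\dots,\rho_n]$ be the exterior algebra on the $3n$ pairwise anticommuting generators $\theta_i,\xi_i,\rho_i$ (so $\theta_i^2=\xi_i^2=\rho_i^2=0$). The symmetric group $\mathfrak{S}_n$ acts diagonally by $\sigma(\theta_i)=\theta_{\sigma(i)}$, $\sigma(\xi_i)=\xi_{\sigma(i)}$, $\sigma(\rho_i)=\rho_{\sigma(i)}$. The triagonal fermionic coinvariant ring is $R_n^{(0,3)}=\Lambda/I$, where $I$ is the ideal generated by the $\mathfrak{S}_n$-invariant elements of $\Lambda$ with zero constant term. It is trigraded, $(R_n^{(0,3)})_{a,b,c}$ being spanned by images of monomials with $a$ variables $\theta$, $b$ variables $\xi$, $c$ variables $\rho$; each component is an $\mathfrak{S}_n$-module. The Frobenius series is $\mathrm{Frob}(R_n^{(0,3)};u,v,w)=\sum_{a,b,c} F\,\mathrm{char}((R_n^{(0,3)})_{a,b,c})\,u^av^bw^c$, where $F$ is the Frobenius characteristic map to symmetric functions, and $\langle\cdot,\cdot\rangle$ is the Hall inner product (extended linearly in $u,v,w$), so the left side is the trigraded multiplicity of the sign representation. Here $s_\lambda(u,v,w)$ denotes the Schur polynomial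 in three variables, and $\binom{k}{2}_{u,v,w}:=s_{(k-2)}(u,v,w)$ (the complete homogeneous symmetric polynomial of degree $k-2$ in $u,v,w$, interpreted as $0$ if $k<2$). -}

module Defs where

open import Data.Bool using (Bool; true; false; _∧_; if_then_else_; not)
open import Data.Nat as ℕ using (ℕ; zero; suc; _∸_; _≤_; _<ᵇ_; _≡ᵇ_)
open import Data.Nat.DivMod using (_%_)
open import Data.Bool.ListAction using (all; any)
open import Data.Fin using (Fin; toℕ)
open import Data.List using (List; []; _∷_; _++_; map; concatMap; foldr; filter; length; allFin; cartesianProduct; replicate)
open import Data.List.Relation.Unary.All using (All)
open import Data.Product using (_×_; _,_; Σ; proj₁; proj₂)
open import Data.Sum using (_⊎_)
open import Data.Rational as ℚ using (ℚ; 0ℚ; 1ℚ)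
open import Data.Fin.Permutation using (Permutation′; _⟨$⟩ʳ_)
open import Relation.Binary.PropositionalEquality using (_≡_)
open import Relation.Nullary.Decidable using (does)

-- A generator: its kind (0 = θ, 1 = ξ, 2 = ρ) and its index i ∈ Fin n.
Var : ℕ → Set
Var n = Fin 3 × Fin n

-- Total order on generators used to fix the standard monomial basis:
-- θ_1 < … < θ_n < ξ_1 < … < ξ_n < ρ_1 < … < ρ_n.
key : ∀ {n} → Var n → ℕ
key {n} (k , i) = toℕ k ℕ.* n ℕ.+ toℕ i

allVars : ∀ n → List (Var n)
allVars n = cartesianProduct (allFin 3) (allFin n)

-- A word (product of generators in the given order).
Word : ℕ → Set
Word n = List (Var n)

-- An element of Λ, given as a formal ℚ-linear combination of words.
Λ : ℕ → Set
Λ n = List (ℚ × Word n)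

-- A standard basis monomial of Λ is a subset S of the generators
-- (the product of its elements in increasing order).
Subset : ℕ → Set
Subset n = Var n → Bool

memb : ∀ {n} → Var n → Word n → Bool
memb v w = any (λ u → key u ≡ᵇ key v) w

noDup : ∀ {n} → Word n → Bool
noDup []       = true
noDup (v ∷ w)  = not (memb v w) ∧ noDup w

inversions : ∀ {n} → Word n → ℕ
inversions []      = 0
inversions (v ∷ w) = length (filter (λ u → key u ℕ.<? key v) w) ℕ.+ inversions w

signℕ : ℕ → ℚ
signℕ m = if (m % 2) ≡ᵇ 0 then 1ℚ else ℚ.- 1ℚ

sameSet : ∀ {n} → Word n → Subset n → Bool
sameSet {n} w S = all (λ v → eqB (S v) (memb v w)) (allVars n)
  where
  eqB : Bool → Bool → Bool
  eqB true  b = b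
  eqB false b = not b

-- Coefficient of the basis monomial S in a word (using anticommutation
-- and the relations x² = 0).
wordCoeff : ∀ {n} → Word n → Subset n → ℚ
wordCoeff w S = if noDup w ∧ sameSet w S then signℕ (inversions w) else 0ℚ

coeff : ∀ {n} → Λ n → Subset n → ℚ
coeff f S = foldr (λ t acc → proj₁ t ℚ.* wordCoeff (proj₂ t) S ℚ.+ acc) 0ℚ f

_≃_ : ∀ {n} → Λ n → Λ n → Set
f ≃ g = ∀ S → coeff f S ≡ coeff g S

_⊕_ : ∀ {n} → Λ n → Λ n → Λ n
f ⊕ g = f ++ g

_·_ : ∀ {n} → ℚ → Λ n → Λ n
q · f = map (λ t → (q ℚ.* proj₁ t , proj₂ t)) f

_⊗_ : ∀ {n} → Λ n → Λ n → Λ n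
f ⊗ g = concatMap (λ s → map (λ t → (proj₁ s ℚ.* proj₁ t , proj₂ s ++ proj₂ t)) g) f

_⊖_ : ∀ {n} → Λ n → Λ n → Λ n
f ⊖ g = f ⊕ ((ℚ.- 1ℚ) · g)

lincomb : ∀ {n d} → (Fin d → ℚ) → (Fin d → Λ n) → Λ n
lincomb {d = d} c x = concatMap (λ i → c i · x i) (allFin d)

act : ∀ {n} → Permutation′ n → Λ n → Λ n
act σ f = map (λ t → (proj₁ t , map (λ v → (proj₁ v , σ ⟨$⟩ʳ proj₂ v)) (proj₂ t))) f

sgn : ∀ {n} → Permutation′ n → ℚ
sgn {n} σ = signℕ (length (filter (λ p → (toℕ (proj₁ p) ℕ.<? toℕ (proj₂ p)) ×-dec
                                          (toℕ (σ ⟨$⟩ʳ proj₂ p) ℕ.<? toℕ (σ ⟨$⟩ʳ proj₁ p)))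
                                  (cartesianProduct (allFin n) (allFin n))))
  where open import Relation.Nullary.Decidable using (_×-dec_)

Invariant : ∀ {n} → Λ n → Set
Invariant f = ∀ σ → act σ f ≃ f

emptySet : ∀ {n} → Subset n
emptySet _ = false

InvariantNoConst : ∀ {n} → Λ n → Set
InvariantNoConst f = Invariant f × (coeff f emptySet ≡ 0ℚ)

InI : ∀ {n} → Λ n → Set
InI {n} f = Σ (List (Λ n × Λ n)) λ gh →
              All (λ p → InvariantNoConst (proj₂ p)) gh ×
              (f ≃ foldr (λ p acc → (proj₁ p ⊗ proj₂ p) ⊕ acc) [] gh)

countKind : ∀ {n} → Fin 3 → Subset n → ℕ
countKind {n} k S = length (filter (λ v → (toℕ (proj₁ v) ℕ.≟ toℕ k) ×-dec (S v Data.Bool.≟ true)) (allVars n))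
  where open import Relation.Nullary.Decidable using (_×-dec_)
        import Data.Bool

Homog : ∀ {n} → ℕ → ℕ → ℕ → Λ n → Set
Homog a b c f = ∀ S → coeff f S ≡ 0ℚ ⊎
                      (countKind Fin.zero S ≡ a × countKind (Fin.suc Fin.zero) S ≡ b ×
                       countKind (Fin.suc (Fin.suc Fin.zero)) S ≡ c)
  where import Data.Fin as Fin

-- The class of f in R_{a,b,c} lies in the sign-isotypic component:
-- σ·f̄ = sgn(σ) f̄ in Λ/I for all σ.
SignIso : ∀ {n} → ℕ → ℕ → ℕ → Λ n → Set
SignIso a b c f = Homog a b c f × (∀ σ → InI (act σ f ⊖ (sgn σ · f)))

-- The sign-isotypic component of (R_n^{(0,3)})_{a,b,c} has ℚ-dimension d,
-- i.e. the multiplicity of the sign representation in (R_n^{(0,3)})_{a,b,c}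
-- is d: there are d classes forming a basis of it.
SignMultiplicity : ℕ → ℕ → ℕ → ℕ → ℕ → Set
SignMultiplicity n a b c d =
  Σ (Fin d → Λ n) λ x →
    (∀ i → SignIso a b c (x i)) ×
    (∀ (q : Fin d → ℚ) → InI (lincomb q x) → ∀ i → q i ≡ 0ℚ) ×
    (∀ y → SignIso a b c y → Σ (Fin d → ℚ) λ q → InI (y ⊖ lincomb q x))

-- P a b c = coefficient of u^a v^b w^c
Poly3 : Set
Poly3 = ℕ → ℕ → ℕ → ℕ

_+ₚ_ : Poly3 → Poly3 → Poly3
(P +ₚ Q) a b c = P a b c ℕ.+ Q a b c

zeroₚ : Poly3
zeroₚ _ _ _ = 0

uvw* : Poly3 → Poly3
uvw* P (suc a) (suc b) (suc c) = P a b c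
uvw* P _       _       _       = 0

-- Schur polynomial s_λ(u,v,w) = Σ_{T SSYT of shape λ, entries in {1,2,3}} x^T
-- (λ given as the list of its row lengths; entry 0,1,2 ↔ u,v,w).
words3 : ℕ → List (List (Fin 3))
words3 zero    = [] ∷ []
words3 (suc ℓ) = concatMap (λ x → map (x ∷_) (words3 ℓ)) (allFin 3)

fillings : List ℕ → List (List (List (Fin 3)))
fillings []       = [] ∷ []
fillings (ℓ ∷ λs) = concatMap (λ r → map (r ∷_) (fillings λs)) (words3 ℓ)

weaklyIncr : List (Fin 3) → Bool
weaklyIncr []           = true
weaklyIncr (x ∷ [])     = true
weaklyIncr (x ∷ y ∷ xs) = (toℕ x ℕ.≤ᵇ toℕ y) ∧ weaklyIncr (y ∷ xs)

colStrict : List (Fin 3) → List (Fin 3) → Bool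
colStrict _        []       = true
colStrict []       (_ ∷ _)  = false
colStrict (x ∷ xs) (y ∷ ys) = (toℕ x <ᵇ toℕ y) ∧ colStrict xs ys

isSSYT : List (List (Fin 3)) → Bool
isSSYT []            = true
isSSYT (r ∷ [])      = weaklyIncr r
isSSYT (r ∷ s ∷ rs)  = weaklyIncr r ∧ colStrict r s ∧ isSSYT (s ∷ rs)

contentIs : ℕ → ℕ → ℕ → List (List (Fin 3)) → Bool
contentIs a b c T = (cnt 0 ≡ᵇ a) ∧ (cnt 1 ≡ᵇ b) ∧ (cnt 2 ≡ᵇ c)
  where
  cnt : ℕ → ℕ
  cnt k = length (filter (λ x → toℕ x ℕ.≟ k) (Data.List.concat T))
    where import Data.List

schur : List ℕ → Poly3
schur λs a b c = length (filter (λ T → isSSYT T ∧ contentIs a b c T Data.Bool.≟ true) (fillings λs))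
  where import Data.Bool

-- s_{(n-2,1,1)}(u,v,w), interpreted as 0 when (n-2,1,1) is not a partition (n < 3)
s-n-2-1-1 : ℕ → Poly3
s-n-2-1-1 (suc (suc (suc m))) = schur (suc m ∷ 1 ∷ 1 ∷ [])
s-n-2-1-1 _                   = zeroₚ

hcomp : ℕ → Poly3
hcomp k a b c = if (a ℕ.+ b ℕ.+ c) ≡ᵇ k then 1 else 0

-- binom(k,2)_{u,v,w} = s_{(k-2)}(u,v,w) = h_{k-2}, and 0 if k < 2
qbinom2 : ℕ → Poly3
qbinom2 (suc (suc m)) = hcomp m
qbinom2 _             = zeroₚ

{-# OPTIONS --safe #-}
-- Write Sᵢ for the product of the generators of index i with kinds S. Antisymmetrisation makes two
-- words proportional (by ±1) when they differ by reordering letters or relabelling indices, so a word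
-- missing two indices becomes 0; moreover Σᵢ Sᵢ w ∈ I for every word w.
--
-- Spanning. If g misses the indices m and m′, then in Σᵢ (Sᵢ Tₘ g + Sₘ Tᵢ g) ∈ I the terms with i = m′
-- cancel and those with i = m count twice. Applied to the splittings of {θ, ξ, ρ}, this kills every
-- word (θξρ)ₘ g missing an index, then every word with two products of two generators of equal index,
-- hence everything of degree > n. In degree n, with S and T single kinds, it leaves at most one class
-- in tridegree (a , b , c), and none unless a, b, c ≥ 1. In degree n - 1 one word remains, and in lower
-- degrees two indices are missing.
--
-- Independence. A functional that is alternating in the letters and antisymmetric under relabelling
-- vanishes on I for degree reasons if it has degree n - 1; one is ψ, which adds the missing index and
-- takes the determinant of the indices. In degree n only the power sums Σᵢ θᵢ, Σᵢ ξᵢ, Σᵢ ρᵢ matter, and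
-- they are killed by contracting a pair of generators of equal index with weight a for ξρ, b for ρθ and
-- c for θξ, and then applying ψ.
module Submission where

open import Defs
open import Data.Nat using (ℕ; suc; _∸_; _≤_)
open import Data.List using ([]; _∷_)
open import Data.Product using (_×_)
open import Relation.Binary.PropositionalEquality using (_≡_)
open import Algebra.Bundles using (AbelianGroup)
import Algebra.Properties.AbelianGroup
import Algebra.Properties.Monoid.Mult as Mult
open import Data.Bool using (Bool; true; false; not; _∧_; _xor_; T; if_then_else_)
import Data.Bool as Bool
import Data.Bool.Properties as Boolₚ
open import Data.Bool.ListAction using (all)
open import Data.Empty using (⊥; ⊥-elim)
open import Data.Fin as Fin using (Fin)
open import Data.Fin.Patterns using (0F; 1F; 2F)
import Data.Fin.Permutation as Perm
open import Data.Fin.Permutation using (Permutation′; _⟨$⟩ʳ_; _⟨$⟩ˡ_; _∘ₚ_; transpose)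
import Data.Fin.Permutation.Components as PC
open import Data.Fin.Permutation.Transposition.List using (eval; decompose; eval-decompose)
import Data.Fin.Properties as Finₚ
open import Data.List using (List; _++_; map; length; allFin; foldr; filter; concatMap; cartesianProduct; replicate; tabulate)
import Data.List.Properties as Listₚ
open import Data.List.Membership.Propositional using (_∈_; _∉_)
open import Data.List.Membership.Propositional.Properties using (∈-∃++; ∈-allFin; ∈-++⁺ʳ; ∈-++⁻; ∈-map⁺; ∈-map⁻; ∈-filter⁺; ∈-filter⁻; ∈-cartesianProduct⁺)
open import Data.List.Relation.Binary.Permutation.Propositional using (_↭_; prep; swap; trans; ↭-refl; ↭-sym; ↭-trans; ↭-reflexive)
import Data.List.Relation.Binary.Permutation.Propositional.Properties as ↭ₚ
open import Data.List.Relation.Unary.All as All using (All; []; _∷_)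
import Data.List.Relation.Unary.All.Properties as Allₚ
open import Data.List.Relation.Unary.AllPairs using (AllPairs; []; _∷_)
open import Data.List.Relation.Unary.AllPairs.Properties using (tabulate⁺-<)
open import Data.List.Relation.Unary.Any using (here; there)
open import Data.List.Relation.Unary.Unique.Propositional using (Unique)
import Data.List.Relation.Unary.Unique.Propositional.Properties as Uniqueₚ
open import Data.Nat as ℕ using (zero; _<_; z≤n; s≤s)
open import Data.Nat.DivMod using (_%_; [m+n]%n≡m%n)
import Data.Nat.Properties as ℕₚ
open import Data.Product using (_,_; ∃; proj₁; proj₂)
open import Data.Rational as ℚ using (ℚ; 0ℚ; 1ℚ)
import Data.Rational.Properties as ℚₚ
open import Data.Rational.Solver using (module +-*-Solver)
open import Data.Sum using (_⊎_; inj₁; inj₂)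
open import Function using (_∘_; id; case_of_)
open import Level using (0ℓ)
open import Relation.Binary.Definitions using (DecidableEquality; tri<; tri≈; tri>)
open import Relation.Binary.PropositionalEquality as ≡ using (_≢_; refl; cong; subst)
open import Relation.Nullary using (¬_; Dec; yes; no)
open import Relation.Nullary.Decidable using (¬?; decidable-stable; does; dec-true; dec-false; map′; _×-dec_; _⊎-dec_; toWitness)

-- Lists up to permutation

-- An element of Λ is an unreduced formal sum and membership in I is the existence of a
-- presentation, so no basis of Λ/I is at hand. The upper bound on a multiplicity is therefore
-- phrased as vanishing: a class `z` is fixed, Λ is divided by all `f` whose antisymmetrisation lies
-- in ℚz + I, and every word of the tridegree is shown to be zero there, with `z = 0` where the
-- multiplicity is 0. What remains are equations k x = 0 with k positive, which is why the spanning
-- part asks only for a torsion-free abelian group. In degree n the candidates are words with one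
-- pair of letters at a common index, and the kinds of the pair can be chosen in three ways. Let γ
-- be such a word with the pair pq. The relations give n γ = N S, where N is the number of letters
-- of the third kind r and S is the sum of γ and its two rotations. So the class of a pair is
-- proportional to the number of letters of the third kind. This dictates the weights of the
-- contraction, and it makes one class suffice for all three pairings.

∉⇒All≢ : ∀ {A : Set} {x : A} {xs} → x ∉ xs → All (x ≢_) xs
∉⇒All≢ {xs = []}     p = []
∉⇒All≢ {xs = y ∷ xs} p = (λ e → p (here e)) ∷ ∉⇒All≢ (p ∘ there)

All≢⇒∉ : ∀ {A : Set} {x : A} {xs} → All (x ≢_) xs → x ∉ xs
All≢⇒∉ (p ∷ ps) (here e)  = p e
All≢⇒∉ (p ∷ ps) (there i) = All≢⇒∉ ps i

Unique-resp-↭ : ∀ {A : Set} {xs ys : List A} → xs ↭ ys → Unique xs → Unique ys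
Unique-resp-↭ _↭_.refl u = u
Unique-resp-↭ (prep x p) (a ∷ u) = ↭ₚ.All-resp-↭ p a ∷ Unique-resp-↭ p u
Unique-resp-↭ (swap x y p) ((x≢y ∷ a) ∷ b ∷ u) =
  ((x≢y ∘ ≡.sym) ∷ ↭ₚ.All-resp-↭ p b) ∷ ↭ₚ.All-resp-↭ p a ∷ Unique-resp-↭ p u
Unique-resp-↭ (trans p q) u = Unique-resp-↭ q (Unique-resp-↭ p u)

extract : ∀ {A : Set} {x : A} {xs} → x ∈ xs → ∃ λ ys → xs ↭ x ∷ ys
extract {x = x} i with ys , zs , refl ← ∈-∃++ i = ys ++ zs , ↭ₚ.shift x ys zs

∈-tail : ∀ {A : Set} {v x : A} {xs} → v ≢ x → v ∈ x ∷ xs → v ∈ xs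
∈-tail n (here e)  = ⊥-elim (n e)
∈-tail n (there i) = i

complement : ∀ {A : Set} {xs ys : List A} → Unique xs → (∀ {v} → v ∈ xs → v ∈ ys) →
             ∃ λ zs → ys ↭ xs ++ zs
complement {xs = []}     {ys} u sub = ys , ↭-refl
complement {xs = x ∷ xs} {ys} (a ∷ u) sub
  with ys′ , p ← extract (sub (here refl))
  with zs , q ← complement {ys = ys′} u (λ i → ∈-tail (λ { refl → All≢⇒∉ a i }) (↭ₚ.∈-resp-↭ p (sub (there i))))
  = zs , ↭-trans p (prep x q)

unique∧set⇒↭ : ∀ {A : Set} {xs ys : List A} → Unique xs → Unique ys →
               (∀ {v} → v ∈ xs → v ∈ ys) → (∀ {v} → v ∈ ys → v ∈ xs) → xs ↭ ys
unique∧set⇒↭ {xs = xs} u w f g with complement u f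
... | [] , p = ↭-sym (↭-trans p (↭-reflexive (Listₚ.++-identityʳ xs)))
... | z ∷ zs , p = ⊥-elim (disj xs (Unique-resp-↭ p w) (g (↭ₚ.∈-resp-↭ (↭-sym p) (∈-++⁺ʳ xs (here refl)))))
  where
  disj : ∀ as → Unique (as ++ z ∷ zs) → z ∉ as
  disj (a ∷ as) (n ∷ u) (here refl) = All≢⇒∉ n (∈-++⁺ʳ as (here refl))
  disj (a ∷ as) (n ∷ u) (there i)   = disj as u i

module _ {A : Set} (_≟_ : DecidableEquality A) where

  open import Data.List.Membership.DecPropositional _≟_ using (_∈?_)

  repeated : ∀ l → ¬ Unique l → ∃ λ (x : A) → ∃ λ l′ → l ↭ x ∷ x ∷ l′
  repeated []      ¬u = ⊥-elim (¬u [])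
  repeated (x ∷ l) ¬u with x ∈? l
  ... | yes i with l′ , p ← extract i = x , l′ , prep x p
  ... | no  j with y , l′ , p ← repeated l (λ u → ¬u (∉⇒All≢ j ∷ u)) =
    y , x ∷ l′ , ↭-trans (prep x p) (↭-trans (swap x y ↭-refl) (prep y (swap x y ↭-refl)))

  unique? : ∀ l → Dec (Unique l)
  unique? []      = yes []
  unique? (x ∷ l) with x ∈? l | unique? l
  ... | yes i | _     = no λ { (a ∷ _) → All≢⇒∉ a i }
  ... | no  j | yes u = yes (∉⇒All≢ j ∷ u)
  ... | no  j | no ¬u = no λ { (_ ∷ u) → ¬u u }

-- Pigeonhole

module _ {n : ℕ} where

  open import Data.List.Membership.DecPropositional (Finₚ._≟_ {n}) using (_∈?_)

  complementFin : ∀ {l : List (Fin n)} → Unique l → ∃ λ zs → allFin n ↭ l ++ zs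
  complementFin u = complement u (λ {v} _ → ∈-allFin v)

  length-allFin : length (allFin n) ≡ n
  length-allFin = Listₚ.length-tabulate {n = n} id

  missing : ∀ (l : List (Fin n)) → length l < n → ∃ λ i → i ∉ l
  missing l l<n = Finₚ.¬∀⟶∃¬ n (_∈ l) (_∈? l) λ all →
    let zs , p = complement (Uniqueₚ.allFin⁺ n) (λ {v} _ → all v) in
    ℕₚ.<⇒≱ l<n (ℕₚ.≤-trans (ℕₚ.≤-reflexive (≡.sym length-allFin))
      (ℕₚ.≤-trans (ℕₚ.m≤m+n _ (length zs))
        (ℕₚ.≤-reflexive (≡.trans (≡.sym (Listₚ.length-++ (allFin n))) (≡.sym (↭ₚ.↭-length p))))))

  missing₂ : ∀ (l : List (Fin n)) → suc (length l) < n → ∃ λ i → ∃ λ j → i ≢ j × i ∉ l × j ∉ l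
  missing₂ l h with i , i∉ ← missing l (ℕₚ.<-trans (ℕₚ.n<1+n _) h)
               with j , j∉ ← missing (i ∷ l) h = i , j , (λ e → j∉ (here (≡.sym e))) , i∉ , j∉ ∘ there

  Unique⇒length≤ : ∀ {l : List (Fin n)} → Unique l → length l ≤ n
  Unique⇒length≤ {l} u with zs , p ← complementFin u =
    ℕₚ.≤-trans (ℕₚ.m≤m+n _ (length zs))
      (ℕₚ.≤-reflexive (≡.trans (≡.sym (Listₚ.length-++ l)) (≡.trans (≡.sym (↭ₚ.↭-length p)) length-allFin)))

  Unique⇒allFin↭ : ∀ {l : List (Fin n)} → Unique l → length l ≡ n → allFin n ↭ l
  Unique⇒allFin↭ {l} u e with complementFin u
  ... | [] , p = ↭-trans p (↭-reflexive (Listₚ.++-identityʳ l))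
  ... | z ∷ zs , p = ⊥-elim (ℕₚ.1+n≰n {n} (ℕₚ.≤-trans (ℕₚ.m≤m+n (suc n) (length zs)) (ℕₚ.≤-reflexive eq)))
    where
    eq : suc n ℕ.+ length zs ≡ n
    eq = ≡.trans (≡.sym (ℕₚ.+-suc n _)) (≡.trans (cong (ℕ._+ suc (length zs)) (≡.sym e))
           (≡.trans (≡.sym (Listₚ.length-++ l)) (≡.trans (≡.sym (↭ₚ.↭-length p)) length-allFin)))

-- Alternating functions on lists

-- Depends on the derivation and not only on the two lists: if letters repeat, both parities occur.
-- Alternating functions vanish there up to 2-torsion, so this does no harm.
parity : ∀ {A : Set} {xs ys : List A} → xs ↭ ys → Bool
parity _↭_.refl     = false
parity (prep x p)   = parity p
parity (swap x y p) = not (parity p)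
parity (trans p q)  = parity p xor parity q

-- Adjacent transpositions named by position. A rearrangement of leading letters becomes a list of
-- numerals, and its sign is the parity of the length of that list.
swapAt : ∀ {A : Set} → ℕ → List A → List A
swapAt zero    (x ∷ y ∷ w) = y ∷ x ∷ w
swapAt (suc k) (x ∷ w)     = x ∷ swapAt k w
swapAt _       w           = w

swaps : ∀ {A : Set} → List ℕ → List A → List A
swaps []       w = w
swaps (k ∷ ks) w = swaps ks (swapAt k w)

swappable : ∀ {A : Set} → ℕ → List A → Bool
swappable zero    (x ∷ y ∷ w) = true
swappable (suc k) (x ∷ w)     = swappable k w
swappable _       w           = false

allSwappable : ∀ {A : Set} → List ℕ → List A → Bool
allSwappable []       w = true
allSwappable (k ∷ ks) w = swappable k w ∧ allSwappable ks (swapAt k w)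

isOdd : List ℕ → Bool
isOdd []       = false
isOdd (_ ∷ ks) = not (isOdd ks)

module Signs (V : AbelianGroup 0ℓ 0ℓ) where

  open AbelianGroup V renaming (refl to ≈-refl; sym to ≈-sym; trans to ≈-trans)
  open import Algebra.Properties.AbelianGroup V

  infix 8 ±_

  ±_ : Bool → Carrier → Carrier
  (± false) x = x
  (± true)  x = x ⁻¹

  ±-cong : ∀ b {x y} → x ≈ y → (± b) x ≈ (± b) y
  ±-cong false e = e
  ±-cong true  e = ⁻¹-cong e

  ±-not : ∀ b x → (± b) x ⁻¹ ≈ (± not b) x
  ±-not false x = ≈-refl
  ±-not true  x = ⁻¹-involutive x

  ±-⁻¹ : ∀ b x → (± b) (x ⁻¹) ≈ (± b) x ⁻¹
  ±-⁻¹ false x = ≈-refl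
  ±-⁻¹ true  x = ≈-refl

  ±-xor : ∀ a b x → (± a) ((± b) x) ≈ (± (a xor b)) x
  ±-xor false b x = ≈-refl
  ±-xor true  b x = ±-not b x

  ±-ε : ∀ b {x} → x ≈ ε → (± b) x ≈ ε
  ±-ε false e = e
  ±-ε true  e = ≈-trans (⁻¹-cong e) ε⁻¹≈ε

Alt : ∀ {A : Set} (V : AbelianGroup 0ℓ 0ℓ) → (List A → AbelianGroup.Carrier V) → Set
Alt V L = ∀ u x y v → L (u ++ x ∷ y ∷ v) ≈ L (u ++ y ∷ x ∷ v) ⁻¹
  where open AbelianGroup V

module Alternating {A : Set} (V : AbelianGroup 0ℓ 0ℓ) (L : List A → AbelianGroup.Carrier V) (alt : Alt V L) where

  open AbelianGroup V renaming (refl to ≈-refl; sym to ≈-sym; trans to ≈-trans)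
  open Signs V

  perm-sign : ∀ {w w′ : List A} (p : w ↭ w′) u → L (u ++ w) ≈ (± parity p) (L (u ++ w′))
  perm-sign _↭_.refl u = ≈-refl
  perm-sign {x ∷ w} {_ ∷ w′} (prep x p) u =
    ≡.subst₂ (λ a b → L a ≈ (± parity p) (L b)) (Listₚ.++-assoc u (x ∷ []) w) (Listₚ.++-assoc u (x ∷ []) w′)
      (perm-sign p (u ++ x ∷ []))
  perm-sign {x ∷ y ∷ w} {_ ∷ _ ∷ w′} (swap x y p) u =
    ≈-trans (alt u x y w)
      (≈-trans (⁻¹-cong (≡.subst₂ (λ a b → L a ≈ (± parity p) (L b)) (Listₚ.++-assoc u (y ∷ x ∷ []) w)
         (Listₚ.++-assoc u (y ∷ x ∷ []) w′) (perm-sign p (u ++ y ∷ x ∷ []))))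
        (±-not (parity p) _))
  perm-sign (trans p q) u =
    ≈-trans (perm-sign p u) (≈-trans (±-cong (parity p) (perm-sign q u)) (±-xor (parity p) (parity q) _))

  perm₀ : ∀ {w w′ : List A} → w ↭ w′ → L w′ ≈ ε → L w ≈ ε
  perm₀ p e = ≈-trans (perm-sign p []) (±-ε (parity p) e)

  -- Rearranging the common tail costs both sides the same sign, so a letter can be pulled to the
  -- front of the tail without tracking where it stood.
  perm-≈ : ∀ {w w′ : List A} (p : w ↭ w′) u v → L (u ++ w′) ≈ L (v ++ w′) → L (u ++ w) ≈ L (v ++ w)
  perm-≈ p u v e = ≈-trans (perm-sign p u) (≈-trans (±-cong (parity p) e) (≈-sym (perm-sign p v)))

  perm-≈⁻¹ : ∀ {w w′ : List A} (p : w ↭ w′) u v → L (u ++ w′) ≈ L (v ++ w′) ⁻¹ → L (u ++ w) ≈ L (v ++ w) ⁻¹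
  perm-≈⁻¹ p u v e = ≈-trans (perm-sign p u) (≈-trans (±-cong (parity p) e)
    (≈-trans (±-⁻¹ (parity p) _) (⁻¹-cong (≈-sym (perm-sign p v)))))

  swapAt-alt : ∀ u k w → T (swappable k w) → L (u ++ w) ≈ L (u ++ swapAt k w) ⁻¹
  swapAt-alt u zero    (x ∷ y ∷ w) _ = alt u x y w
  swapAt-alt u (suc k) (x ∷ w)     t =
    ≡.subst₂ (λ a b → L a ≈ L b ⁻¹) (Listₚ.++-assoc u (x ∷ []) w) (Listₚ.++-assoc u (x ∷ []) (swapAt k w))
      (swapAt-alt (u ++ x ∷ []) k w t)
  swapAt-alt u zero    []       ()
  swapAt-alt u zero    (x ∷ []) ()
  swapAt-alt u (suc k) []       ()

  -- Whether the swaps apply is decided by evaluation, also on a word with an unknown tail.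
  swaps-alt : ∀ ks w {_ : T (allSwappable ks w)} → L w ≈ (± isOdd ks) (L (swaps ks w))
  swaps-alt []       w     = ≈-refl
  swaps-alt (k ∷ ks) w {t} with swappable k w in eq
  ... | true = ≈-trans (swapAt-alt [] k w (subst T (≡.sym eq) _))
                 (≈-trans (⁻¹-cong (swaps-alt ks (swapAt k w) {t})) (±-not (isOdd ks) _))

-- Sums over lists

module Sums (V : AbelianGroup 0ℓ 0ℓ) where

  open AbelianGroup V renaming (refl to ≈-refl; sym to ≈-sym; trans to ≈-trans)
  open import Algebra.Properties.AbelianGroup V
  open import Algebra.Properties.Monoid.Mult monoid renaming (_×_ to _∗_) hiding (×-congˡ)
  open import Algebra.Properties.CommutativeSemigroup commutativeSemigroup using (interchange; x∙yz≈y∙xz)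

  Σl : ∀ {A : Set} → List A → (A → Carrier) → Carrier
  Σl []      f = ε
  Σl (x ∷ l) f = f x ∙ Σl l f

  Σ-cong : ∀ {A : Set} (l : List A) {f g : A → Carrier} → (∀ i → i ∈ l → f i ≈ g i) → Σl l f ≈ Σl l g
  Σ-cong []      e = ≈-refl
  Σ-cong (x ∷ l) e = ∙-cong (e x (here refl)) (Σ-cong l (λ i p → e i (there p)))

  Σ-ε : ∀ {A : Set} (l : List A) {f : A → Carrier} → (∀ i → i ∈ l → f i ≈ ε) → Σl l f ≈ ε
  Σ-ε []      e = ≈-refl
  Σ-ε (x ∷ l) e = ≈-trans (∙-cong (e x (here refl)) (Σ-ε l (λ i p → e i (there p)))) (identityˡ ε)

  Σ-∙ : ∀ {A : Set} (l : List A) (f g : A → Carrier) → Σl l (λ i → f i ∙ g i) ≈ Σl l f ∙ Σl l g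
  Σ-∙ []      f g = ≈-sym (identityˡ ε)
  Σ-∙ (x ∷ l) f g = ≈-trans (∙-congˡ (Σ-∙ l f g)) (interchange _ _ _ _)

  Σ-⁻¹ : ∀ {A : Set} (l : List A) (f : A → Carrier) → Σl l (λ i → f i ⁻¹) ≈ Σl l f ⁻¹
  Σ-⁻¹ []      f = ≈-sym ε⁻¹≈ε
  Σ-⁻¹ (x ∷ l) f = ≈-trans (∙-congˡ (Σ-⁻¹ l f)) (⁻¹-∙-comm _ _)

  Σ-↭ : ∀ {A : Set} {l l′ : List A} (f : A → Carrier) → l ↭ l′ → Σl l f ≈ Σl l′ f
  Σ-↭ f _↭_.refl     = ≈-refl
  Σ-↭ f (prep x p)   = ∙-congˡ (Σ-↭ f p)
  Σ-↭ f (swap x y p) = ≈-trans (x∙yz≈y∙xz _ _ _) (∙-congˡ (∙-congˡ (Σ-↭ f p)))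
  Σ-↭ f (trans p q)  = ≈-trans (Σ-↭ f p) (Σ-↭ f q)

  Σ-map : ∀ {A B : Set} (l : List A) (h : A → B) (f : B → Carrier) → Σl (map h l) f ≡ Σl l (f ∘ h)
  Σ-map []      h f = refl
  Σ-map (x ∷ l) h f = cong (f (h x) ∙_) (Σ-map l h f)

  -- The multiplicity stays unspecified: being nonnegative, it cannot cancel a positive multiple of
  -- X that is added to it.
  Σ-01 : ∀ {A : Set} (l : List A) {f : A → Carrier} {X} → (∀ i → i ∈ l → f i ≈ ε ⊎ f i ≈ X) →
         ∃ λ k → Σl l f ≈ k ∗ X
  Σ-01 []      e = 0 , ≈-refl
  Σ-01 (x ∷ l) e with Σ-01 l (λ i p → e i (there p)) | e x (here refl)
  ... | k , s | inj₁ z = k , ≈-trans (∙-cong z s) (identityˡ _)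
  ... | k , s | inj₂ z = suc k , ∙-cong z s

-- Transpositions

tr : ∀ {n} → Fin n → Fin n → Fin n → Fin n
tr = PC.transpose

tr-l : ∀ {n} (i j : Fin n) → tr i j i ≡ j
tr-l i j with i Finₚ.≟ i
... | yes _ = refl
... | no ¬p = ⊥-elim (¬p refl)

tr-r : ∀ {n} (i j : Fin n) → tr i j j ≡ i
tr-r i j with j Finₚ.≟ i
... | yes p = p
... | no ¬p with j Finₚ.≟ j
...   | yes _ = refl
...   | no ¬q = ⊥-elim (¬q refl)

tr-≢ : ∀ {n} {i j k : Fin n} → k ≢ i → k ≢ j → tr i j k ≡ k
tr-≢ {i = i} {j} {k} p q with k Finₚ.≟ i
... | yes e = ⊥-elim (p e)
... | no _ with k Finₚ.≟ j
...   | yes e = ⊥-elim (q e)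
...   | no _ = refl

tr-involutive : ∀ {n} (i j k : Fin n) → tr i j (tr i j k) ≡ k
tr-involutive i j k with k Finₚ.≟ i
... | yes refl = tr-r i j
... | no a with k Finₚ.≟ j
...   | yes refl = tr-l i j
...   | no b = tr-≢ a b

tr-injective : ∀ {n} (i j : Fin n) {k l} → tr i j k ≡ tr i j l → k ≡ l
tr-injective i j {k} {l} e = ≡.trans (≡.sym (tr-involutive i j k)) (≡.trans (cong (tr i j) e) (tr-involutive i j l))

-- Relabelling words

Letter : ℕ → Set
Letter n = Fin 3 × Fin n

relabel : ∀ {n} → (Fin n → Fin n) → List (Letter n) → List (Letter n)
relabel f = map (λ v → proj₁ v , f (proj₂ v))

block : ∀ {n} → List (Fin 3) → Fin n → List (Letter n)
block S i = map (_, i) S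

Free : ∀ {n} → Fin n → List (Letter n) → Set
Free i = All (λ v → proj₂ v ≢ i)

_≟ᵥ_ : ∀ {n} → DecidableEquality (Letter n)
(k , i) ≟ᵥ (l , j) with k Finₚ.≟ l | i Finₚ.≟ j
... | yes refl | yes refl = yes refl
... | no k≢l   | _        = no λ { refl → k≢l refl }
... | yes _    | no i≢j   = no λ { refl → i≢j refl }

-- A certificate, written letter by letter along the word, that the transposition of i and j carries
-- one word to the other.
data Interchange {n} (i j : Fin n) : List (Letter n) → List (Letter n) → Set where
  []   : Interchange i j [] []
  ↦_   : ∀ {k w w′} → Interchange i j w w′ → Interchange i j ((k , i) ∷ w) ((k , j) ∷ w′)
  ↤_   : ∀ {k w w′} → Interchange i j w w′ → Interchange i j ((k , j) ∷ w) ((k , i) ∷ w′)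
  keep : ∀ {k l w w′} → l ≢ i → l ≢ j → Interchange i j w w′ → Interchange i j ((k , l) ∷ w) ((k , l) ∷ w′)

infixr 5 ↦_ ↤_

interchange⇒relabel : ∀ {n} {i j : Fin n} {w w′} → Interchange i j w w′ → relabel (tr i j) w ≡ w′
interchange⇒relabel [] = refl
interchange⇒relabel {i = i} {j} (↦ s) = ≡.cong₂ _∷_ (cong (_ ,_) (tr-l i j)) (interchange⇒relabel s)
interchange⇒relabel {i = i} {j} (↤ s) = ≡.cong₂ _∷_ (cong (_ ,_) (tr-r i j)) (interchange⇒relabel s)
interchange⇒relabel (keep p q s) = ≡.cong₂ _∷_ (cong (_ ,_) (tr-≢ p q)) (interchange⇒relabel s)

free⇒interchange : ∀ {n} {i j : Fin n} {w} → Free i w → Free j w → Interchange i j w w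
free⇒interchange []       []       = []
free⇒interchange (p ∷ ps) (q ∷ qs) = keep p q (free⇒interchange ps qs)

∉⇒Free : ∀ {n} {i : Fin n} {w} → i ∉ map proj₂ w → Free i w
∉⇒Free {w = []}    p = []
∉⇒Free {w = v ∷ w} p = (λ e → p (here (≡.sym e))) ∷ ∉⇒Free (p ∘ there)

Free⇒∉ : ∀ {n} {i : Fin n} {w} → Free i w → i ∉ map proj₂ w
Free⇒∉ (p ∷ ps) (here e)  = p (≡.sym e)
Free⇒∉ (p ∷ ps) (there m) = Free⇒∉ ps m

Free⇒∉ᵥ : ∀ {n} {i : Fin n} {k w} → Free i w → (k , i) ∉ w
Free⇒∉ᵥ (p ∷ ps) (here refl) = p refl
Free⇒∉ᵥ (p ∷ ps) (there m)   = Free⇒∉ᵥ ps m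

-- An arbitrary ordering of θ, ξ, ρ. Each relation is proved once and transferred to the other
-- orderings by `rotate` and `flip`.
record Kinds (p q r : Fin 3) : Set where
  constructor kinds
  field
    p≢q : p ≢ q
    q≢r : q ≢ r
    p≢r : p ≢ r
    cover : ∀ k → k ≡ p ⊎ k ≡ q ⊎ k ≡ r

rotate : ∀ {p q r} → Kinds p q r → Kinds q r p
rotate (kinds a b c d) = kinds b (c ∘ ≡.sym) (a ∘ ≡.sym) (λ k → turn (d k))
  where
  turn : ∀ {A B C : Set} → A ⊎ B ⊎ C → B ⊎ C ⊎ A
  turn (inj₁ x)        = inj₂ (inj₂ x)
  turn (inj₂ (inj₁ x)) = inj₁ x
  turn (inj₂ (inj₂ x)) = inj₂ (inj₁ x)

flip : ∀ {p q r} → Kinds p q r → Kinds p r q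
flip (kinds a b c d) = kinds c (b ∘ ≡.sym) a (λ k → turn (d k))
  where
  turn : ∀ {A B C : Set} → A ⊎ B ⊎ C → A ⊎ C ⊎ B
  turn (inj₁ x)        = inj₁ x
  turn (inj₂ (inj₁ x)) = inj₂ (inj₂ x)
  turn (inj₂ (inj₂ x)) = inj₂ (inj₁ x)

kinds? : ∀ p q r → Dec (Kinds p q r)
kinds? p q r = map′ (λ { (a , b , c , d) → kinds a b c d }) (λ { (kinds a b c d) → a , b , c , d })
  (¬? (p Finₚ.≟ q) ×-dec ¬? (q Finₚ.≟ r) ×-dec ¬? (p Finₚ.≟ r) ×-dec
   Finₚ.all? λ k → (k Finₚ.≟ p) ⊎-dec (k Finₚ.≟ q) ⊎-dec (k Finₚ.≟ r))

thirdKind : ∀ {p q} → p ≢ q → ∃ λ r → Kinds p q r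
thirdKind {p} {q} p≢q with toWitness {a? = Finₚ.all? λ p → Finₚ.all? λ q →
                             (p Finₚ.≟ q) ⊎-dec Finₚ.any? λ r → kinds? p q r} _ p q
... | inj₁ e = ⊥-elim (p≢q e)
... | inj₂ x = x

∉³⇒Free : ∀ {n p q r} {i : Fin n} {w} → Kinds p q r → (p , i) ∉ w → (q , i) ∉ w → (r , i) ∉ w → Free i w
∉³⇒Free {w = []} κ a b c = []
∉³⇒Free {i = i} {w = (k , j) ∷ w} κ a b c = here′ ∷ ∉³⇒Free κ (a ∘ there) (b ∘ there) (c ∘ there)
  where
  here′ : j ≢ i
  here′ refl with Kinds.cover κ k
  ... | inj₁ refl        = a (here refl)
  ... | inj₂ (inj₁ refl) = b (here refl)
  ... | inj₂ (inj₂ refl) = c (here refl)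

-- An index other than m and m′ may carry one, two or three letters.
Full : ∀ {n} → Fin n → Fin n → List (Letter n) → Set
Full m m′ g = ∀ i → i ≢ m → i ≢ m′ → i ∈ map proj₂ g

occurs : ∀ {n} {i : Fin n} w → i ∈ map proj₂ w → ∃ λ (k : Fin 3) → (k , i) ∈ w
occurs ((k , _) ∷ w) (here refl) = k , here refl
occurs (_ ∷ w) (there m) with k , p ← occurs w m = k , there p

occurs⁻ : ∀ {n} {i : Fin n} {k} {w : List (Letter n)} → (k , i) ∈ w → i ∈ map proj₂ w
occurs⁻ (here refl) = here refl
occurs⁻ (there m)   = there (occurs⁻ m)

splitFin₂ : ∀ {n} {m m′ : Fin n} → m ≢ m′ → ∃ λ rest → allFin n ↭ m ∷ m′ ∷ rest × (∀ i → i ∈ rest → i ≢ m × i ≢ m′)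
splitFin₂ {n} d with rest , p ← complementFin ((d ∷ []) ∷ [] ∷ [])
  with (_ ∷ a) ∷ b ∷ _ ← Unique-resp-↭ p (Uniqueₚ.allFin⁺ n) =
  rest , p , λ i i∈ → (λ e → All≢⇒∉ a (subst (_∈ rest) e i∈)) , (λ e → All≢⇒∉ b (subst (_∈ rest) e i∈))

count : ∀ {n} → Fin 3 → List (Letter n) → ℕ
count k []            = 0
count k ((l , _) ∷ w) = (if does (l Finₚ.≟ k) then 1 else 0) ℕ.+ count k w

count-≡ : ∀ {n k} {i : Fin n} w → count k ((k , i) ∷ w) ≡ suc (count k w)
count-≡ {k = k} w rewrite dec-true (k Finₚ.≟ k) refl = refl

count-≢ : ∀ {n k l} {i : Fin n} w → l ≢ k → count k ((l , i) ∷ w) ≡ count k w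
count-≢ {k = k} {l} w d rewrite dec-false (l Finₚ.≟ k) d = refl

-- Separates the shape of a word from its labels: relabelling changes the list of indices and leaves
-- the blocks alone.
place : ∀ {n} → List (List (Fin 3)) → List (Fin n) → List (Letter n)
place (S ∷ bs) (i ∷ l) = block S i ++ place bs l
place _        _       = []

relabel-place : ∀ {n} (f : Fin n → Fin n) bs l → relabel f (place bs l) ≡ place bs (map f l)
relabel-place f []       l       = refl
relabel-place f (S ∷ bs) []      = refl
relabel-place f (S ∷ bs) (i ∷ l) = go S
  where
  go : ∀ S → relabel f (block S i ++ place bs l) ≡ block S (f i) ++ place bs (map f l)
  go []      = relabel-place f bs l
  go (k ∷ S) = cong (_ ∷_) (go S)

singletons : List (Fin 3) → List (List (Fin 3))
singletons = map (_∷ [])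

place-singletons : ∀ {n} (w : List (Letter n)) → place (singletons (map proj₁ w)) (map proj₂ w) ≡ w
place-singletons []      = refl
place-singletons (v ∷ w) = cong (v ∷_) (place-singletons w)

arrange : ∀ {n ks} (w : List (Letter n)) → map proj₁ w ↭ ks → ∃ λ l → w ↭ place (singletons ks) l × map proj₂ w ↭ l
arrange w κ with w′ , refl , π ← ↭ₚ.↭-map-inv proj₁ κ =
  map proj₂ w′ , subst (w ↭_) (≡.sym (place-singletons w′)) π , ↭ₚ.map⁺ proj₂ π

-- Spanning

TorsionFree : AbelianGroup 0ℓ 0ℓ → Set
TorsionFree V = ∀ k x → suc k ∗ x ≈ ε → x ≈ ε
  where
  open AbelianGroup V
  open Mult monoid renaming (_×_ to _∗_)

Antisymmetric : ∀ {n} (V : AbelianGroup 0ℓ 0ℓ) → (List (Letter n) → AbelianGroup.Carrier V) → Set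
Antisymmetric V L = ∀ {i j} → i ≢ j → ∀ w → L (relabel (tr i j) w) ≈ L w ⁻¹
  where open AbelianGroup V

KillsPowerSums : ∀ {n} (V : AbelianGroup 0ℓ 0ℓ) → (List (Letter n) → AbelianGroup.Carrier V) → Set
KillsPowerSums {n} V L = ∀ p S w → Σl (allFin n) (λ i → L (block (p ∷ S) i ++ w)) ≈ ε
  where
  open AbelianGroup V
  open Sums V

module Spanning {n : ℕ} (V : AbelianGroup 0ℓ 0ℓ) (torsion-free : TorsionFree V)
  (L : List (Letter n) → AbelianGroup.Carrier V) (alt : Alt V L) (anti : Antisymmetric V L) (ideal : KillsPowerSums V L) where

  open AbelianGroup V renaming (refl to ≈-refl; sym to ≈-sym; trans to ≈-trans)
  open Sums V
  open Mult monoid using (×-homo-+) renaming (_×_ to _∗_)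
  open Alternating V L alt
  open Signs V
  open import Algebra.Properties.AbelianGroup V
  open import Algebra.Properties.CommutativeMonoid.Mult commutativeMonoid using (×-distrib-+)
  open import Relation.Binary.Reasoning.Setoid setoid
  open import Data.List.Membership.DecPropositional (_≟ᵥ_ {n}) using (_∈?_)
  open import Algebra.Properties.CommutativeSemigroup commutativeSemigroup using (x∙yz≈y∙xz)
  open Kinds

  private
    variable
      g h w w′ : List (Letter n)
      p q r : Fin 3
      i j m m′ : Fin n

  -- Vanishing by odd symmetries, and the basic relations

  self⁻¹⇒ε : ∀ {x} → x ≈ x ⁻¹ → x ≈ ε
  self⁻¹⇒ε {x} e = torsion-free 1 x (begin
    x ∙ (x ∙ ε)  ≈⟨ ∙-congˡ (identityʳ x) ⟩
    x ∙ x        ≈⟨ ∙-congˡ e ⟩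
    x ∙ x ⁻¹     ≈⟨ inverseʳ x ⟩
    ε            ∎)

  ⁻¹-sym : ∀ {x y} → x ≈ y ⁻¹ → y ≈ x ⁻¹
  ⁻¹-sym {x} {y} e = ≈-trans (≈-sym (⁻¹-involutive y)) (⁻¹-cong (≈-sym e))

  antisym : i ≢ j → Interchange i j w w′ → L w ≈ L w′ ⁻¹
  antisym {w = w} d s = ⁻¹-sym (≈-trans (reflexive (cong L (≡.sym (interchange⇒relabel s)))) (anti d w))

  -- The transposition of i and j fixes the word and yet negates its value.
  twoMissing : i ≢ j → Free i w → Free j w → L w ≈ ε
  twoMissing d f f′ = self⁻¹⇒ε (antisym d (free⇒interchange f f′))

  twice₀ : ∀ u v g → L (u ++ v ∷ v ∷ g) ≈ ε
  twice₀ u v g = self⁻¹⇒ε (alt u v v g)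

  dup₀ : ∀ u {v g} → v ∈ g → L (u ++ v ∷ g) ≈ ε
  dup₀ u {v} i with g′ , p ← extract i =
    ≈-trans (perm-sign (prep v p) u) (±-ε (parity p) (twice₀ u v g′))

  ¬Unique₀ : ¬ Unique w → L w ≈ ε
  ¬Unique₀ {w} ¬u with v , w″ , p ← repeated _≟ᵥ_ w ¬u = perm₀ p (twice₀ [] v w″)

  -- The sum of the ideal relations for p and for qr. Moving the letter `(p , m)` past a block of
  -- two letters costs no sign.
  relation₁₂ : ∀ p q r m g →
    Σl (allFin n) (λ i → L ((p , i) ∷ (q , m) ∷ (r , m) ∷ g) ∙ L ((p , m) ∷ (q , i) ∷ (r , i) ∷ g)) ≈ ε
  relation₁₂ p q r m g = begin
    _  ≈⟨ Σ-∙ (allFin n) _ _ ⟩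
    _  ≈⟨ ∙-cong (ideal p [] _) (≈-trans
            (Σ-cong (allFin n) (λ i _ → swaps-alt (0 ∷ 1 ∷ []) _)) (ideal q (r ∷ []) ((p , m) ∷ g))) ⟩
    _  ≈⟨ identityˡ ε ⟩
    ε  ∎

  relation₁₁ : ∀ p q m g →
    Σl (allFin n) (λ i → L ((p , i) ∷ (q , m) ∷ g) ∙ L ((p , m) ∷ (q , i) ∷ g)) ≈ ε
  relation₁₁ p q m g = begin
    _  ≈⟨ Σ-∙ (allFin n) _ _ ⟩
    _  ≈⟨ ∙-cong (ideal p [] _) (≈-trans
            (Σ-cong (allFin n) (λ i _ → swaps-alt (0 ∷ []) _))
            (≈-trans (Σ-⁻¹ (allFin n) _) (≈-trans (⁻¹-cong (ideal q [] ((p , m) ∷ g))) ε⁻¹≈ε))) ⟩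
    _  ≈⟨ identityˡ ε ⟩
    ε  ∎

  Free-resp : ∀ {i} {g g′ : List (Letter n)} → g ↭ g′ → Free i g → Free i g′
  Free-resp = ↭ₚ.All-resp-↭

  first∉ : ∀ {v : Letter n} → Unique g → g ↭ v ∷ h → v ∉ h
  first∉ u π with a ∷ _ ← Unique-resp-↭ π u = All≢⇒∉ a

  ∉-rest : ∀ {v x : Letter n} → g ↭ x ∷ h → v ∉ g → v ∉ h
  ∉-rest π v∉ v∈ = v∉ (↭ₚ.∈-resp-↭ (↭-sym π) (there v∈))

  ∈-rest : ∀ {v x : Letter n} → g ↭ x ∷ h → v ≢ x → v ∈ g → v ∈ h
  ∈-rest π d v∈ = ∈-tail d (↭ₚ.∈-resp-↭ π v∈)

  kind≢ : ∀ {i j : Fin n} → p ≢ q → (p , i) ≢ (q , j)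
  kind≢ d refl = d refl

  index≢ : ∀ {p q : Fin 3} → i ≢ j → (p , i) ≢ (q , j)
  index≢ d refl = d refl

  Unique-rest : ∀ {x : Letter n} → g ↭ x ∷ h → Unique g → Unique h
  Unique-rest π u with _ ∷ u′ ← Unique-resp-↭ π u = u′

  ∈⇒≢ : ∀ {k} → Free m g → (k , j) ∈ g → j ≢ m
  ∈⇒≢ f v∈ refl = Free⇒∉ᵥ f v∈

  third : Kinds p q r → Full m m′ g → i ≢ m → i ≢ m′ → (q , i) ∉ g → (r , i) ∉ g → (p , i) ∈ g
  third {g = g} {i = i} κ F a b q∉ r∉ with k , k∈ ← occurs g (F i a b) with cover κ k
  ... | inj₁ refl        = k∈
  ... | inj₂ (inj₁ refl) = ⊥-elim (q∉ k∈)
  ... | inj₂ (inj₂ refl) = ⊥-elim (r∉ k∈)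

  splitFin₃ : ∀ {a b c : Fin n} → a ≢ b → a ≢ c → b ≢ c →
              ∃ λ rest → allFin n ↭ a ∷ b ∷ c ∷ rest × (∀ i → i ∈ rest → i ≢ a × i ≢ b × i ≢ c)
  splitFin₃ d e f with rest , p ← complementFin ((d ∷ e ∷ []) ∷ (f ∷ []) ∷ [] ∷ [])
    with (_ ∷ _ ∷ a) ∷ (_ ∷ b) ∷ c ∷ _ ← Unique-resp-↭ p (Uniqueₚ.allFin⁺ n) =
    rest , p , λ i i∈ → (λ e → All≢⇒∉ a (subst (_∈ rest) e i∈)) , (λ e → All≢⇒∉ b (subst (_∈ rest) e i∈))
                      , (λ e → All≢⇒∉ c (subst (_∈ rest) e i∈))

  -- Three letters at one index while another index is missing

  record Context (m m′ : Fin n) (g : List (Letter n)) : Set where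
    field
      m≢m′   : m ≢ m′
      free   : Free m g
      free′  : Free m′ g
      unique : Unique g
      full   : Full m m′ g

  open Context

  -- Transposing the two missing indices exchanges the summands and negates.
  cancel-missing₁₂ : ∀ {p q r} → m ≢ m′ → Free m g → Free m′ g →
    L ((p , m′) ∷ (q , m) ∷ (r , m) ∷ g) ∙ L ((p , m) ∷ (q , m′) ∷ (r , m′) ∷ g) ≈ ε
  cancel-missing₁₂ d f f′ = ≈-trans (∙-congʳ (antisym d (↤ ↦ ↦ free⇒interchange f f′))) (inverseˡ _)

  -- Transposing m and i moves the pair qr to m; then the two letters of kind p trade places, which
  -- restores the sign.
  term-p : Kinds p q r → Context m m′ g → (p , i) ∈ g → (q , i) ∉ g → (r , i) ∉ g →
    L ((p , m) ∷ (q , i) ∷ (r , i) ∷ g) ≈ L ((p , m) ∷ (q , m) ∷ (r , m) ∷ g)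
  term-p {p} {q} {r} {m} {m′} {g} {i} κ C p∈ q∉ r∉ with h , π ← extract p∈ =
    perm-≈ π ((p , m) ∷ (q , i) ∷ (r , i) ∷ []) ((p , m) ∷ (q , m) ∷ (r , m) ∷ []) (begin
      L ((p , m) ∷ (q , i) ∷ (r , i) ∷ (p , i) ∷ h)
        ≈⟨ antisym (∈⇒≢ (free C) p∈) (↤ ↦ ↦ ↦ free⇒interchange fi fm) ⟩
      L ((p , i) ∷ (q , m) ∷ (r , m) ∷ (p , m) ∷ h) ⁻¹
        ≈⟨ ⁻¹-cong (swaps-alt (0 ∷ 1 ∷ 2 ∷ 1 ∷ 0 ∷ []) _) ⟩
      (L ((p , m) ∷ (q , m) ∷ (r , m) ∷ (p , i) ∷ h) ⁻¹) ⁻¹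
        ≈⟨ ⁻¹-involutive _ ⟩
      L ((p , m) ∷ (q , m) ∷ (r , m) ∷ (p , i) ∷ h) ∎)
    where
    fi = ∉³⇒Free κ (first∉ (unique C) π) (∉-rest π q∉) (∉-rest π r∉)
    fm = All.tail (Free-resp π (free C))

  -- In Σᵢ (pᵢ (qr)ₘ g + pₘ (qr)ᵢ g) the index j contributes - (pqr)ₘ g and every other i ∉ {m , m′}
  -- contributes 0 or (pqr)ₘ g.
  triple-even : Kinds p q r → Context m m′ g → (q , j) ∈ g → (r , j) ∈ g → (p , j) ∉ g →
    L ((p , m) ∷ (q , m) ∷ (r , m) ∷ g) ≈ ε
  triple-even {p} {q} {r} {m} {m′} {g} {j} κ C q∈ r∈ p∉
    with g₁ , π₁ ← extract q∈
    with h , π₂ ← extract (∈-rest π₁ (kind≢ (q≢r κ ∘ ≡.sym)) r∈)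
    with j≢m ← ∈⇒≢ (free C) q∈ | j≢m′ ← ∈⇒≢ (free′ C) q∈
    with rest , ρ , out ← splitFin₃ (m≢m′ C) (j≢m ∘ ≡.sym) (j≢m′ ∘ ≡.sym) =
    torsion-free k X (begin
      X ∙ k ∗ X                                ≈⟨ ∙-congʳ (identityʳ X) ⟨
      (X ∙ ε) ∙ k ∗ X                          ≈⟨ ∙-congʳ (∙-congˡ (inverseʳ X)) ⟨
      (X ∙ (X ∙ X ⁻¹)) ∙ k ∗ X                 ≈⟨ ∙-congʳ (assoc X X (X ⁻¹)) ⟨
      ((X ∙ X) ∙ X ⁻¹) ∙ k ∗ X                 ≈⟨ assoc _ _ _ ⟩
      (X ∙ X) ∙ (X ⁻¹ ∙ k ∗ X)                 ≈⟨ ∙-congˡ (identityˡ _) ⟨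
      (X ∙ X) ∙ (ε ∙ (X ⁻¹ ∙ k ∗ X))           ≈⟨ ∙-congˡ (∙-cong (cancel-missing₁₂ (m≢m′ C) (free C) (free′ C)) (∙-cong E-j sum)) ⟨
      E m ∙ (E m′ ∙ (E j ∙ Σl rest E))         ≈⟨ Σ-↭ E ρ ⟨
      Σl (allFin n) E                          ≈⟨ relation₁₂ p q r m g ⟩
      ε                                        ∎)
    where
    π : g ↭ (q , j) ∷ (r , j) ∷ h
    π = ↭-trans π₁ (prep _ π₂)
    X = L ((p , m) ∷ (q , m) ∷ (r , m) ∷ g)
    E : Fin n → Carrier
    E i = L ((p , i) ∷ (q , m) ∷ (r , m) ∷ g) ∙ L ((p , m) ∷ (q , i) ∷ (r , i) ∷ g)
    fj : Free j h
    fj = ∉³⇒Free κ (∉-rest π₂ (∉-rest π₁ p∉)) (∉-rest π₂ (first∉ (unique C) π₁))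
           (first∉ (Unique-rest π₁ (unique C)) π₂)
    fm : Free m h
    fm = All.tail (All.tail (Free-resp π (free C)))
    E-j : E j ≈ X ⁻¹
    E-j = ≈-trans (∙-cong (perm-≈⁻¹ π ((p , j) ∷ (q , m) ∷ (r , m) ∷ []) ((p , m) ∷ (q , m) ∷ (r , m) ∷ []) (≈-trans
             (antisym j≢m (↦ ↤ ↤ ↦ ↦ free⇒interchange fj fm))
             (⁻¹-cong (swaps-alt (2 ∷ 1 ∷ 3 ∷ 2 ∷ []) _))))
            (≈-trans (swaps-alt (1 ∷ []) _) (⁻¹-cong (dup₀ ((p , m) ∷ (r , j) ∷ []) q∈))))
          (≈-trans (∙-congˡ ε⁻¹≈ε) (identityʳ _))
    -- (qr)ₘ and (qr)ⱼ are equal even blocks.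
    even-twice : ∀ i → i ≢ m → i ≢ j → L ((p , i) ∷ (q , m) ∷ (r , m) ∷ g) ≈ ε
    even-twice i a b = ≈-trans (perm-sign π ((p , i) ∷ (q , m) ∷ (r , m) ∷ [])) (±-ε (parity π)
      (self⁻¹⇒ε (≈-trans (antisym j≢m (keep b a (↤ ↤ ↦ ↦ free⇒interchange fj fm)))
        (⁻¹-cong (swaps-alt (2 ∷ 1 ∷ 3 ∷ 2 ∷ []) _)))))
    term : ∀ i → i ∈ rest → E i ≈ ε ⊎ E i ≈ X
    term i i∈ with a , b , c ← out i i∈ with (q , i) ∈? g | (r , i) ∈? g
    ... | yes q∈ | _ = inj₁ (≈-trans (∙-cong (even-twice i a c) (≈-trans (swaps-alt (1 ∷ []) _)
                         (⁻¹-cong (dup₀ ((p , m) ∷ (r , i) ∷ []) q∈)))) (≈-trans (identityˡ _) ε⁻¹≈ε))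
    ... | no _   | yes r∈ = inj₁ (≈-trans (∙-cong (even-twice i a c) (dup₀ ((p , m) ∷ (q , i) ∷ []) r∈)) (identityˡ _))
    ... | no q∉  | no r∉  = inj₂ (≈-trans (∙-cong (even-twice i a c)
                              (term-p κ C (third κ (full C) a b q∉ r∉) q∉ r∉)) (identityˡ _))
    k = proj₁ (Σ-01 rest term)
    sum = proj₂ (Σ-01 rest term)

  E₁₂ : (p q r : Fin 3) (m : Fin n) (g : List (Letter n)) → Fin n → Carrier
  E₁₂ p q r m g i = L ((p , i) ∷ (q , m) ∷ (r , m) ∷ g) ∙ L ((p , m) ∷ (q , i) ∷ (r , i) ∷ g)

  εε : ∀ {x y} → x ≈ ε → y ≈ ε → x ∙ y ≈ ε
  εε a b = ≈-trans (∙-cong a b) (identityˡ ε)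

  dup₁ : ∀ u {v x g} → v ∈ g → L (u ++ v ∷ x ∷ g) ≈ ε
  dup₁ u {v} {x} {g} v∈ = ≈-trans (alt u v x g)
    (≈-trans (⁻¹-cong (≈-trans (reflexive (cong L (≡.sym (Listₚ.++-assoc u (x ∷ []) (v ∷ g))))) (dup₀ (u ++ x ∷ []) v∈))) ε⁻¹≈ε)

  dup₂ : ∀ u {v x y g} → v ∈ g → L (u ++ v ∷ x ∷ y ∷ g) ≈ ε
  dup₂ u {v} {x} {y} {g} v∈ = ≈-trans (alt u v x (y ∷ g))
    (≈-trans (⁻¹-cong (≈-trans (reflexive (cong L (≡.sym (Listₚ.++-assoc u (x ∷ []) (v ∷ y ∷ g))))) (dup₁ (u ++ x ∷ []) v∈))) ε⁻¹≈ε)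

  -- Trades the pair pr at i for the pair qr at m. Now i plays the missing index and m the index
  -- with exactly the kinds q and r that `triple-even` asks for.
  context-even : Kinds p q r → Context m m′ g → g ↭ (p , i) ∷ (r , i) ∷ h → (q , i) ∉ g →
                 Context i m′ ((q , m) ∷ (r , m) ∷ h)
  context-even {p} {q} {r} {m} {m′} {g} {i} {h} κ C π q∉ = record
    { m≢m′   = ∈⇒≢ (free′ C) pi∈
    ; free   = (i≢m ∘ ≡.sym) ∷ (i≢m ∘ ≡.sym) ∷ fi
    ; free′  = m≢m′ C ∷ m≢m′ C ∷ All.tail (All.tail (Free-resp π (free′ C)))
    ; unique = (kind≢ (q≢r κ) ∷ ∉⇒All≢ (Free⇒∉ᵥ fm)) ∷ ∉⇒All≢ (Free⇒∉ᵥ fm) ∷ uh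
    ; full   = full′
    }
    where
    pi∈ : (p , i) ∈ g
    pi∈ = ↭ₚ.∈-resp-↭ (↭-sym π) (here refl)
    i≢m = ∈⇒≢ (free C) pi∈
    u² = Unique-resp-↭ π (unique C)
    uh : Unique h
    uh with _ ∷ _ ∷ u ← u² = u
    fm : Free m h
    fm = All.tail (All.tail (Free-resp π (free C)))
    fi : Free i h
    fi with (_ ∷ a) ∷ b ∷ _ ← u² =
      ∉³⇒Free κ (All≢⇒∉ a) (λ q∈ → q∉ (↭ₚ.∈-resp-↭ (↭-sym π) (there (there q∈)))) (All≢⇒∉ b)
    full′ : Full i m′ ((q , m) ∷ (r , m) ∷ h)
    full′ k k≢i k≢m′ with k Finₚ.≟ m
    ... | yes refl = here refl
    ... | no k≢m = there (there (∈-tail k≢i (∈-tail k≢i (↭ₚ.∈-resp-↭ (↭ₚ.map⁺ proj₂ π) (full C k k≢m k≢m′)))))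

  -- In Σᵢ (qᵢ (qr)ₘ g + qₘ (qr)ᵢ g) only the indices whose sole kind in g is p contribute, and all equally.
  exchange : Kinds p q r → Context m m′ g → (p , i) ∈ g → (q , i) ∉ g → (r , i) ∉ g →
             E₁₂ q q r m g i ≈ ε
  exchange {p} {q} {r} {m} {m′} {g} {i₀} κ C p∈₀ q∉₀ r∉₀
    with i₀≢m ← ∈⇒≢ (free C) p∈₀ | i₀≢m′ ← ∈⇒≢ (free′ C) p∈₀
    with rest , ρ , out ← splitFin₃ (m≢m′ C) (i₀≢m ∘ ≡.sym) (i₀≢m′ ∘ ≡.sym) =
    torsion-free k Y (begin
      Y ∙ k ∗ Y                            ≈⟨ ∙-congˡ sum ⟨
      Y ∙ Σl rest E                        ≈⟨ identityˡ _ ⟨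
      ε ∙ (Y ∙ Σl rest E)                  ≈⟨ identityˡ _ ⟨
      ε ∙ (ε ∙ (Y ∙ Σl rest E))            ≈⟨ ∙-cong (εε sq₀ sq₀) (∙-congʳ (cancel-missing₁₂ (m≢m′ C) (free C) (free′ C))) ⟨
      E m ∙ (E m′ ∙ (Y ∙ Σl rest E))       ≈⟨ Σ-↭ E ρ ⟨
      Σl (allFin n) E                      ≈⟨ relation₁₂ q q r m g ⟩
      ε                                    ∎)
    where
    E = E₁₂ q q r m g
    Y = E i₀
    sq₀ : L ((q , m) ∷ (q , m) ∷ (r , m) ∷ g) ≈ ε
    sq₀ = twice₀ [] _ _
    κ′ = rotate (rotate κ)
    term : ∀ i → i ∈ rest → E i ≈ ε ⊎ E i ≈ Y
    term i i∈ with i≢m , i≢m′ , i≢i₀ ← out i i∈ with (q , i) ∈? g | (r , i) ∈? g | (p , i) ∈? g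
    ... | yes q∈ | _ | _ = inj₁ (εε (dup₂ [] q∈) (dup₁ ((q , m) ∷ []) q∈))
    ... | no q∉ | yes r∈ | no p∉ with h , π ← extract r∈ = inj₁ (εε
            (≈-trans (perm-sign π ((q , i) ∷ (q , m) ∷ (r , m) ∷ [])) (±-ε (parity π) (self⁻¹⇒ε (≈-trans
              (antisym i≢m (↦ ↤ ↤ ↦ free⇒interchange
                 (∉³⇒Free κ (∉-rest π p∉) (∉-rest π q∉) (first∉ (unique C) π)) (All.tail (Free-resp π (free C)))))
              (⁻¹-cong (swaps-alt (0 ∷ 2 ∷ []) _))))))
            (dup₀ ((q , m) ∷ (q , i) ∷ []) r∈))
    ... | no q∉ | yes r∈ | yes p∈
      with g₁ , π₁ ← extract p∈
      with h , π₂ ← extract (∈-rest π₁ (kind≢ (p≢r κ ∘ ≡.sym)) r∈) =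
      let π = ↭-trans π₁ (prep _ π₂) in
      inj₁ (εε
            (≈-trans (perm-sign π ((q , i) ∷ (q , m) ∷ (r , m) ∷ [])) (±-ε (parity π)
              (≈-trans (swaps-alt (2 ∷ 1 ∷ 0 ∷ 3 ∷ 2 ∷ []) _)
                (±-ε true (triple-even κ (context-even κ C π q∉) (here refl) (there (here refl))
                  λ { (there (there a)) → Free⇒∉ᵥ (All.tail (All.tail (Free-resp π (free C)))) a
                    ; (here e) → p≢q κ (cong proj₁ e) ; (there (here e)) → p≢r κ (cong proj₁ e) })))))
            (dup₀ ((q , m) ∷ (q , i) ∷ []) r∈))
    ... | no q∉ | no r∉ | _
      with g₁ , π₁ ← extract (third κ (full C) i≢m i≢m′ q∉ r∉)
      with h , π₂ ← extract (∈-rest π₁ (index≢ (i≢i₀ ∘ ≡.sym)) p∈₀) =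
      let π   = ↭-trans π₁ (prep _ π₂)
          fi  = ∉³⇒Free κ (∉-rest π₂ (first∉ (unique C) π₁)) (∉-rest π₂ (∉-rest π₁ q∉)) (∉-rest π₂ (∉-rest π₁ r∉))
          fi₀ = ∉³⇒Free κ (first∉ (Unique-rest π₁ (unique C)) π₂) (∉-rest π₂ (∉-rest π₁ q∉₀)) (∉-rest π₂ (∉-rest π₁ r∉₀))
          s   = free⇒interchange fi fi₀
          m≢i = i≢m ∘ ≡.sym ; m≢i₀ = i₀≢m ∘ ≡.sym
      in inj₂ (∙-cong
        (perm-≈ π ((q , i) ∷ (q , m) ∷ (r , m) ∷ []) ((q , i₀) ∷ (q , m) ∷ (r , m) ∷ []) (≈-trans
          (antisym i≢i₀ (↦ keep m≢i m≢i₀ (keep m≢i m≢i₀ (↦ ↤ s))))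
          (≈-trans (⁻¹-cong (swaps-alt (3 ∷ []) _)) (⁻¹-involutive _))))
        (perm-≈ π ((q , m) ∷ (q , i) ∷ (r , i) ∷ []) ((q , m) ∷ (q , i₀) ∷ (r , i₀) ∷ []) (≈-trans
          (antisym i≢i₀ (keep m≢i m≢i₀ (↦ ↦ ↦ ↤ s)))
          (≈-trans (⁻¹-cong (swaps-alt (3 ∷ []) _)) (⁻¹-involutive _)))))
    k = proj₁ (Σ-01 rest term)
    sum = proj₂ (Σ-01 rest term)

  replace-context : Context m m′ g → g ↭ (q , i) ∷ h → Free i h → Context m m′ ((p , i) ∷ h)
  replace-context {m} {m′} {g} {q} {i} {h} {p} C π fi = record
    { m≢m′   = m≢m′ C
    ; free   = All.head fm ∷ All.tail fm
    ; free′  = All.head fm′ ∷ All.tail fm′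
    ; unique = ∉⇒All≢ (Free⇒∉ᵥ fi) ∷ Unique-rest π (unique C)
    ; full   = λ k a b → ↭ₚ.∈-resp-↭ (↭ₚ.map⁺ proj₂ π) (full C k a b)
    }
    where
    fm  = Free-resp π (free C)
    fm′ = Free-resp π (free′ C)

  -- The letters p and q at i trade places, after which p is the sole kind at i in the tail. Then
  -- `exchange` carries the pair qr from m to i, and the transposition of m and i brings it back to
  -- m, together with p.
  term-q : Kinds p q r → Context m m′ g → (q , i) ∈ g → (p , i) ∉ g → (r , i) ∉ g →
    L ((p , i) ∷ (q , m) ∷ (r , m) ∷ g) ≈ L ((p , m) ∷ (q , m) ∷ (r , m) ∷ g)
  term-q {p} {q} {r} {m} {m′} {g} {i} κ C q∈ p∉ r∉ with h , π ← extract q∈ =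
    perm-≈ π ((p , i) ∷ (q , m) ∷ (r , m) ∷ []) ((p , m) ∷ (q , m) ∷ (r , m) ∷ []) (begin
      L ((p , i) ∷ (q , m) ∷ (r , m) ∷ (q , i) ∷ h)
        ≈⟨ swaps-alt (0 ∷ 1 ∷ 2 ∷ 1 ∷ 0 ∷ []) _ ⟩
      L ((q , i) ∷ (q , m) ∷ (r , m) ∷ (p , i) ∷ h) ⁻¹
        ≈⟨ inverseʳ-unique _ _ (exchange κ (replace-context C π fi) (here refl)
             (λ { (here e) → p≢q κ (≡.sym (cong proj₁ e)) ; (there a) → first∉ (unique C) π a })
             (λ { (here e) → p≢r κ (≡.sym (cong proj₁ e)) ; (there a) → ∉-rest π r∉ a })) ⟨
      L ((q , m) ∷ (q , i) ∷ (r , i) ∷ (p , i) ∷ h)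
        ≈⟨ antisym (∈⇒≢ (free C) q∈) (↤ ↦ ↦ ↦ free⇒interchange fi (All.tail (Free-resp π (free C)))) ⟩
      L ((q , i) ∷ (q , m) ∷ (r , m) ∷ (p , m) ∷ h) ⁻¹
        ≈⟨ ⁻¹-cong (swaps-alt (0 ∷ 1 ∷ 2 ∷ 1 ∷ 0 ∷ []) _) ⟩
      (L ((p , m) ∷ (q , m) ∷ (r , m) ∷ (q , i) ∷ h) ⁻¹) ⁻¹
        ≈⟨ ⁻¹-involutive _ ⟩
      L ((p , m) ∷ (q , m) ∷ (r , m) ∷ (q , i) ∷ h) ∎)
    where
    fi : Free i h
    fi = ∉³⇒Free κ (∉-rest π p∉) (first∉ (unique C) π) (∉-rest π r∉)

  term-r : Kinds p q r → Context m m′ g → (r , i) ∈ g → (p , i) ∉ g → (q , i) ∉ g →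
    L ((p , i) ∷ (q , m) ∷ (r , m) ∷ g) ≈ L ((p , m) ∷ (q , m) ∷ (r , m) ∷ g)
  term-r κ C r∈ p∉ q∉ = ≈-trans (swaps-alt (1 ∷ []) _)
    (≈-trans (⁻¹-cong (≈-trans (term-q (flip κ) C r∈ p∉ q∉) (swaps-alt (1 ∷ []) _))) (⁻¹-involutive _))

  -- Unless `triple-even` applies, every index outside m and m′ contributes 0 or X to the relation;
  -- m′ contributes 0 and m contributes X twice.
  triple-full : Kinds p q r → Context m m′ g → L ((p , m) ∷ (q , m) ∷ (r , m) ∷ g) ≈ ε
  triple-full {p} {q} {r} {m} {m′} {g} κ C
    with Finₚ.any? (λ j → (q , j) ∈? g ×-dec (r , j) ∈? g ×-dec ¬? ((p , j) ∈? g))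
  ... | yes (j , q∈ , r∈ , p∉) = triple-even κ C q∈ r∈ p∉
  ... | no no-even with rest , ρ , out ← splitFin₂ (m≢m′ C) =
    torsion-free (suc k) X (begin
      X ∙ (X ∙ k ∗ X)                     ≈⟨ assoc _ _ _ ⟨
      (X ∙ X) ∙ k ∗ X                     ≈⟨ ∙-congˡ (identityˡ _) ⟨
      (X ∙ X) ∙ (ε ∙ k ∗ X)               ≈⟨ ∙-congˡ (∙-cong (cancel-missing₁₂ (m≢m′ C) (free C) (free′ C)) sum) ⟨
      E m ∙ (E m′ ∙ Σl rest E)            ≈⟨ Σ-↭ E ρ ⟨
      Σl (allFin n) E                     ≈⟨ relation₁₂ p q r m g ⟩
      ε                                   ∎)
    where
    X = L ((p , m) ∷ (q , m) ∷ (r , m) ∷ g)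
    E = E₁₂ p q r m g
    term : ∀ i → i ∈ rest → E i ≈ ε ⊎ E i ≈ X
    term i i∈ with a , b ← out i i∈ with (p , i) ∈? g | (q , i) ∈? g | (r , i) ∈? g
    ... | yes p∈ | yes q∈ | _      = inj₁ (εε (dup₂ [] p∈) (dup₁ ((p , m) ∷ []) q∈))
    ... | yes p∈ | no _   | yes r∈ = inj₁ (εε (dup₂ [] p∈) (dup₀ ((p , m) ∷ (q , i) ∷ []) r∈))
    ... | yes p∈ | no q∉  | no r∉  = inj₂ (≈-trans (∙-cong (dup₂ [] p∈) (term-p κ C p∈ q∉ r∉)) (identityˡ _))
    ... | no p∉  | yes q∈ | yes r∈ = ⊥-elim (no-even (i , q∈ , r∈ , p∉))
    ... | no p∉  | yes q∈ | no r∉  = inj₂ (≈-trans (∙-cong (term-q κ C q∈ p∉ r∉) (dup₁ ((p , m) ∷ []) q∈)) (identityʳ _))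
    ... | no p∉  | no q∉  | yes r∈ = inj₂ (≈-trans (∙-cong (term-r κ C r∈ p∉ q∉) (dup₀ ((p , m) ∷ (q , i) ∷ []) r∈)) (identityʳ _))
    ... | no p∉  | no q∉  | no r∉  = ⊥-elim (p∉ (third κ (full C) a b q∉ r∉))
    k = proj₁ (Σ-01 rest term)
    sum = proj₂ (Σ-01 rest term)

  index∈? : ∀ i (g : List (Letter n)) → Dec (i ∈ map proj₂ g)
  index∈? i g = i ∈?′ map proj₂ g
    where open import Data.List.Membership.DecPropositional (Finₚ._≟_ {n}) renaming (_∈?_ to _∈?′_)

  full-or-missing : ∀ m m′ g → Full m m′ g ⊎ ∃ λ i → i ≢ m × i ≢ m′ × Free i g
  full-or-missing m m′ g with Finₚ.any? (λ i → ¬? (i Finₚ.≟ m) ×-dec ¬? (i Finₚ.≟ m′) ×-dec ¬? (index∈? i g))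
  ... | yes (i , a , b , c) = inj₂ (i , a , b , ∉⇒Free c)
  ... | no none = inj₁ λ i a b → decidable-stable (index∈? i g) λ c → none (i , a , b , c)

  -- If `Context` fails, then a letter is repeated or a second index is missing, and the word
  -- vanishes for that reason.
  triple₀ : Kinds p q r → m ≢ m′ → Free m′ g → L ((p , m) ∷ (q , m) ∷ (r , m) ∷ g) ≈ ε
  triple₀ {p} {q} {r} {m} {m′} {g} κ d f′ with (p , m) ∈? g | (q , m) ∈? g | (r , m) ∈? g | unique? _≟ᵥ_ g | full-or-missing m m′ g
  ... | yes p∈ | _ | _ | _ | _ = dup₂ [] p∈
  ... | _ | yes q∈ | _ | _ | _ = dup₁ (_ ∷ []) q∈
  ... | _ | _ | yes r∈ | _ | _ = dup₀ (_ ∷ _ ∷ []) r∈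
  ... | _ | _ | _ | no ¬u | _ = ¬Unique₀ λ { (_ ∷ _ ∷ _ ∷ u) → ¬u u }
  ... | _ | _ | _ | _ | inj₂ (i , a , b , f) =
    twoMissing b ((a ∘ ≡.sym) ∷ (a ∘ ≡.sym) ∷ (a ∘ ≡.sym) ∷ f) (d ∷ d ∷ d ∷ f′)
  ... | no p∉ | no q∉ | no r∉ | yes u | inj₁ F = triple-full κ
    record { m≢m′ = d ; free = ∉³⇒Free κ p∉ q∉ r∉ ; free′ = f′ ; unique = u ; full = F }

  -- The word consists, up to order, of the pairs pq at i and qr at m. It is one summand of
  -- `exchange`; the other one has all three kinds at i and falls to `triple₀`.
  even-pair₀ : Kinds p q r → i ≢ m → i ≢ m′ → m ≢ m′ → Free i h → Free m h → Free m′ h →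
    L ((q , i) ∷ (q , m) ∷ (r , m) ∷ (p , i) ∷ h) ≈ ε
  even-pair₀ {p} {q} {r} {i} {m} {m′} {h} κ a b d fi fm fm′ with unique? _≟ᵥ_ h | full-or-missing m m′ ((p , i) ∷ h)
  ... | no ¬u | _ = ¬Unique₀ λ { (_ ∷ _ ∷ _ ∷ _ ∷ u) → ¬u u }
  ... | _ | inj₂ (j , x , y , f) =
    twoMissing y (All.head f ∷ (x ∘ ≡.sym) ∷ (x ∘ ≡.sym) ∷ f) (b ∷ d ∷ d ∷ b ∷ fm′)
  ... | yes u | inj₁ F = begin
    A          ≈⟨ identityʳ _ ⟨
    A ∙ ε      ≈⟨ ∙-congˡ (≈-trans (swaps-alt (2 ∷ 1 ∷ 0 ∷ 1 ∷ 2 ∷ []) _) (±-ε true (triple₀ κ b (d ∷ fm′)))) ⟨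
    A ∙ B      ≈⟨ exchange κ C (here refl)
                    (λ { (here e) → p≢q κ (≡.sym (cong proj₁ e)) ; (there x) → Free⇒∉ᵥ fi x })
                    (λ { (here e) → p≢r κ (≡.sym (cong proj₁ e)) ; (there x) → Free⇒∉ᵥ fi x }) ⟩
    ε          ∎
    where
    A = L ((q , i) ∷ (q , m) ∷ (r , m) ∷ (p , i) ∷ h)
    B = L ((q , m) ∷ (q , i) ∷ (r , i) ∷ (p , i) ∷ h)
    C : Context m m′ ((p , i) ∷ h)
    C = record { m≢m′ = d ; free = a ∷ fm ; free′ = b ∷ fm′ ; unique = ∉⇒All≢ (Free⇒∉ᵥ fi) ∷ u ; full = F }

  -- Two pairs of letters with equal indices, and degrees above n

  pair : ∀ w → ¬ Unique (map proj₂ w) → ∃ λ p → ∃ λ q → ∃ λ i → ∃ λ (w′ : List (Letter n)) → w ↭ (p , i) ∷ (q , i) ∷ w′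
  pair w ¬u with x , l , π ← repeated Finₚ._≟_ (map proj₂ w) ¬u with ↭ₚ.↭-map-inv proj₂ π
  ... | (p , _) ∷ (q , _) ∷ w′ , refl , π′ = p , q , x , w′ , π′

  -- Pairs are even and commute, while the transposition of their indices negates.
  same-even₀ : i ≢ j → Free i h → Free j h → L ((p , i) ∷ (q , i) ∷ (p , j) ∷ (q , j) ∷ h) ≈ ε
  same-even₀ d fi fj = self⁻¹⇒ε (≈-trans (antisym d (↦ ↦ ↤ ↤ free⇒interchange fi fj))
    (⁻¹-cong (swaps-alt (1 ∷ 0 ∷ 2 ∷ 1 ∷ []) _)))

  -- There are only three kinds, so two pairs of distinct kinds have the same kinds or share exactly
  -- one: `same-even₀` or `even-pair₀`.
  evens₀ : ∀ {p′ q′} → Kinds p q r → p′ ≢ q′ → i ≢ j → i ≢ m′ → j ≢ m′ → Free i h → Free j h → Free m′ h →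
    L ((p , i) ∷ (q , i) ∷ (p′ , j) ∷ (q′ , j) ∷ h) ≈ ε
  evens₀ {p′ = p′} {q′} κ d ij im jm fi fj fm with cover κ p′ | cover κ q′
  ... | inj₁ refl        | inj₁ refl        = ⊥-elim (d refl)
  ... | inj₁ refl        | inj₂ (inj₁ refl) = same-even₀ ij fi fj
  ... | inj₁ refl        | inj₂ (inj₂ refl) =
    ≈-trans (swaps-alt (1 ∷ 2 ∷ []) _) (even-pair₀ (rotate (flip κ′)) ij im jm fi fj fm)
    where κ′ = rotate (rotate κ)
  ... | inj₂ (inj₁ refl) | inj₁ refl        = ≈-trans (swaps-alt (2 ∷ []) _) (±-ε true (same-even₀ ij fi fj))
  ... | inj₂ (inj₁ refl) | inj₂ (inj₁ refl) = ⊥-elim (d refl)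
  ... | inj₂ (inj₁ refl) | inj₂ (inj₂ refl) =
    ≈-trans (swaps-alt (0 ∷ 1 ∷ 2 ∷ []) _) (±-ε true (even-pair₀ κ ij im jm fi fj fm))
  ... | inj₂ (inj₂ refl) | inj₁ refl        =
    ≈-trans (swaps-alt (2 ∷ 1 ∷ 2 ∷ []) _) (±-ε true (even-pair₀ (rotate (flip κ′)) ij im jm fi fj fm))
    where κ′ = rotate (rotate κ)
  ... | inj₂ (inj₂ refl) | inj₂ (inj₁ refl) =
    ≈-trans (swaps-alt (2 ∷ 0 ∷ 1 ∷ 2 ∷ []) _) (even-pair₀ κ ij im jm fi fj fm)
  ... | inj₂ (inj₂ refl) | inj₂ (inj₂ refl) = ⊥-elim (d refl)

  bloc0F : Kinds p q r → i ≢ m′ → Free m′ g → i ∈ map proj₂ g → L ((p , i) ∷ (q , i) ∷ g) ≈ ε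
  bloc0F {p} {q} {r} {i} {m′} {g} κ d f i∈ with k , k∈ ← occurs g i∈ with cover κ k
  ... | inj₁ refl        = dup₁ [] k∈
  ... | inj₂ (inj₁ refl) = dup₀ (_ ∷ []) k∈
  ... | inj₂ (inj₂ refl) with h , π ← extract k∈ = perm₀ (prep _ (prep _ π)) (triple₀ κ d (All.tail (Free-resp π f)))

  length-indices : ∀ (w : List (Letter n)) → length (map proj₂ w) ≡ length w
  length-indices = Listₚ.length-map proj₂

  -- Pigeonhole twice. More than n letters contain a pair at some index i. If i does not occur
  -- again, more than n - 2 letters are left for the n - 2 indices other than i and m′, which gives
  -- a second pair.
  high-missing₀ : ∀ w → Free m′ w → n < length w → L w ≈ ε
  high-missing₀ {m′} w f n<w
    with p , q , i , w₁ , π ← pair w (λ u → ℕₚ.<⇒≱ n<w (subst (_≤ n) (length-indices w) (Unique⇒length≤ u)))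
    with p Finₚ.≟ q
  ... | yes refl = perm₀ π (twice₀ [] _ _)
  ... | no p≢q with r , κ ← thirdKind p≢q with fi ∷ _ ∷ f₁ ← Free-resp π f with index∈? i w₁
  ...   | yes i∈ = perm₀ π (bloc0F κ fi f₁ i∈)
  ...   | no i∉
    with p′ , q′ , j , w₂ , π′ ← pair w₁ (λ u → ℕₚ.<⇒≱ n<w
           (subst (_≤ n) (≡.trans (cong (2 ℕ.+_) (length-indices w₁)) (≡.sym (↭ₚ.↭-length π)))
             (Unique⇒length≤ {l = m′ ∷ i ∷ map proj₂ w₁} (((fi ∘ ≡.sym) ∷ ∉⇒All≢ (Free⇒∉ f₁)) ∷ ∉⇒All≢ i∉ ∷ u))))
    with p′ Finₚ.≟ q′
  ...     | yes refl = perm₀ (↭-trans π (prep _ (prep _ π′))) (twice₀ (_ ∷ _ ∷ []) _ _)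
  ...     | no p≢q′ with r′ , κ′ ← thirdKind p≢q′ with fj ∷ _ ∷ f₂ ← Free-resp π′ f₁
    with ij ∷ _ ∷ fi₂ ← Free-resp π′ (∉⇒Free i∉) with index∈? j w₂
  ...       | yes j∈ = perm₀ (↭-trans (↭-trans π (prep _ (prep _ π′))) (↭ₚ.shifts (_ ∷ _ ∷ []) (_ ∷ _ ∷ [])))
                         (bloc0F κ′ fj (fi ∷ fi ∷ f₂) (there (there j∈)))
  ...       | no j∉ = perm₀ (↭-trans π (prep _ (prep _ π′)))
                        (evens₀ κ p≢q′ (ij ∘ ≡.sym) fi fj fi₂ (∉⇒Free j∉) f₂)

  gather : ∀ (i : Fin n) w → ∃ λ S → ∃ λ (w′ : List (Letter n)) → w ↭ block S i ++ w′ × Free i w′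
  gather i [] = [] , [] , ↭-refl , []
  gather i ((k , j) ∷ w) with S , w′ , π , f ← gather i w with j Finₚ.≟ i
  ... | yes refl = k ∷ S , w′ , prep _ π , f
  ... | no  j≢i  = S , (k , j) ∷ w′ , ↭-trans (prep _ π) (↭-sym (↭ₚ.shift (k , j) (block S i) w′)) , j≢i ∷ f

  kinds-block : ∀ S (i : Fin n) w → map proj₁ (block S i ++ w) ≡ S ++ map proj₁ w
  kinds-block []      i w = refl
  kinds-block (k ∷ S) i w = cong (k ∷_) (kinds-block S i w)

  Free-block : ∀ S → j ≢ i → Free i w → Free i (block S j ++ w)
  Free-block []      d f = f
  Free-block (k ∷ S) d f = d ∷ Free-block S d f

  -- Σⱼ Sⱼ w ≈ ε trades a word in which every index occurs for words in which i is missing.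
  reduce : ∀ i ks → (∀ w → Free i w → map proj₁ w ↭ ks → L w ≈ ε) → ∀ w → map proj₁ w ↭ ks → L w ≈ ε
  reduce i ks P w κ with gather i w
  ... | [] , w′ , π , f = perm₀ π (P w′ f (↭-trans (↭ₚ.map⁺ proj₁ (↭-sym π)) κ))
  ... | p ∷ S , w′ , π , f with rest , ρ ← complementFin {l = i ∷ []} ([] ∷ []) = perm₀ π (begin
    L (block (p ∷ S) i ++ w′)         ≈⟨ identityʳ _ ⟨
    L (block (p ∷ S) i ++ w′) ∙ ε     ≈⟨ ∙-congˡ (Σ-ε rest others) ⟨
    _                                 ≈⟨ Σ-↭ _ ρ ⟨
    _                                 ≈⟨ ideal p S w′ ⟩
    ε                                 ∎)
    where
    others : ∀ j → j ∈ rest → L (block (p ∷ S) j ++ w′) ≈ ε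
    others j j∈ with a ∷ _ ← Unique-resp-↭ ρ (Uniqueₚ.allFin⁺ n) =
      P _ (Free-block (p ∷ S) (λ { refl → All≢⇒∉ a j∈ }) f)
        (↭-trans (↭-reflexive (≡.trans (kinds-block (p ∷ S) j w′) (≡.sym (kinds-block (p ∷ S) i w′))))
          (↭-trans (↭ₚ.map⁺ proj₁ (↭-sym π)) κ))

  high₀ : Fin n → ∀ ks → n < length ks → ∀ w → map proj₁ w ↭ ks → L w ≈ ε
  high₀ i ks l = reduce i ks λ w f κ → high-missing₀ w f
    (subst (n <_) (≡.trans (≡.sym (↭ₚ.↭-length κ)) (Listₚ.length-map proj₁ w)) l)

  -- Degree n with one missing index

  ·-cong₁ : ∀ {a b} → a ≡ b → ∀ x → a ∗ x ≈ b ∗ x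
  ·-cong₁ refl x = ≈-refl

  Σ-kinds : ∀ (κ : Kinds p q r) (f : Letter n → Carrier) x y l →
    (∀ i → (p , i) ∈ l → f (p , i) ≈ x) → (∀ i → (q , i) ∈ l → f (q , i) ≈ x) →
    (∀ i → (r , i) ∈ l → f (r , i) ≈ y) →
    Σl l f ≈ (count p l ℕ.+ count q l) ∗ x ∙ count r l ∗ y
  Σ-kinds κ f x y [] P Q R = ≈-sym (identityˡ ε)
  Σ-kinds {p} {q} {r} κ f x y ((k , i) ∷ l) P Q R
    with s ← Σ-kinds κ f x y l (λ i m → P i (there m)) (λ i m → Q i (there m)) (λ i m → R i (there m))
    with cover κ k
  ... | inj₁ refl = begin
    f (p , i) ∙ Σl l f                                          ≈⟨ ∙-cong (P i (here refl)) s ⟩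
    x ∙ ((count p l ℕ.+ count q l) ∗ x ∙ count r l ∗ y)          ≈⟨ assoc _ _ _ ⟨
    (suc (count p l) ℕ.+ count q l) ∗ x ∙ count r l ∗ y
      ≈⟨ ∙-cong (·-cong₁ (≡.cong₂ ℕ._+_ (count-≡ {i = i} l) (count-≢ {i = i} l (p≢q κ))) x) (·-cong₁ (count-≢ {i = i} l (p≢r κ)) y) ⟨
    _ ∎
  ... | inj₂ (inj₁ refl) = begin
    f (q , i) ∙ Σl l f                                          ≈⟨ ∙-cong (Q i (here refl)) s ⟩
    x ∙ ((count p l ℕ.+ count q l) ∗ x ∙ count r l ∗ y)          ≈⟨ assoc _ _ _ ⟨
    suc (count p l ℕ.+ count q l) ∗ x ∙ count r l ∗ y            ≈⟨ ∙-congʳ (·-cong₁ (ℕₚ.+-suc (count p l) (count q l)) x) ⟨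
    (count p l ℕ.+ suc (count q l)) ∗ x ∙ count r l ∗ y
      ≈⟨ ∙-cong (·-cong₁ (≡.cong₂ ℕ._+_ (count-≢ {i = i} l (p≢q κ ∘ ≡.sym)) (count-≡ {i = i} l)) x) (·-cong₁ (count-≢ {i = i} l (q≢r κ)) y) ⟨
    _ ∎
  ... | inj₂ (inj₂ refl) = begin
    f (r , i) ∙ Σl l f                                          ≈⟨ ∙-cong (R i (here refl)) s ⟩
    y ∙ ((count p l ℕ.+ count q l) ∗ x ∙ count r l ∗ y)          ≈⟨ x∙yz≈y∙xz _ _ _ ⟩
    (count p l ℕ.+ count q l) ∗ x ∙ suc (count r l) ∗ y
      ≈⟨ ∙-cong (·-cong₁ (≡.cong₂ ℕ._+_ (count-≢ {i = i} l (p≢r κ ∘ ≡.sym)) (count-≢ {i = i} l (q≢r κ ∘ ≡.sym))) x) (·-cong₁ (count-≡ {i = i} l) y) ⟨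
    _ ∎

  E₁₁ : (p q : Fin 3) (m : Fin n) (g : List (Letter n)) → Fin n → Carrier
  E₁₁ p q m g i = L ((p , i) ∷ (q , m) ∷ g) ∙ L ((p , m) ∷ (q , i) ∷ g)

  -- Each index besides m and m′ carries exactly one letter of g. With a pair put at m, this is the
  -- shape of a word of degree n whose only missing index is m′.
  Simple : Fin n → Fin n → List (Letter n) → Set
  Simple m m′ g = allFin n ↭ m ∷ m′ ∷ map proj₂ g

  simple-extract : Simple m m′ g → ∀ {k} → (k , i) ∈ g →
    ∃ λ h → g ↭ (k , i) ∷ h × Free i h × Free m h × i ≢ m
  simple-extract {m} {m′} {g} {i} σ k∈ with h , π ← extract k∈
    with (_ ∷ mi ∷ mh) ∷ _ ∷ ih ∷ _ ← Unique-resp-↭ (↭-trans σ (prep _ (prep _ (↭ₚ.map⁺ proj₂ π)))) (Uniqueₚ.allFin⁺ n) =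
    h , π , ∉⇒Free (All≢⇒∉ ih) , ∉⇒Free (All≢⇒∉ mh) , (mi ∘ ≡.sym)

  simple-free : Simple m m′ g → m ≢ m′ × Free m g × Free m′ g
  simple-free σ with (d ∷ a) ∷ b ∷ _ ← Unique-resp-↭ σ (Uniqueₚ.allFin⁺ n) =
    d , ∉⇒Free (All≢⇒∉ a) , ∉⇒Free (All≢⇒∉ b)

  cancel-missing₁₁ : Simple m m′ g → E₁₁ p q m g m′ ≈ ε
  cancel-missing₁₁ σ with d , f , f′ ← simple-free σ =
    ≈-trans (∙-congʳ (antisym d (↤ ↦ free⇒interchange f f′))) (inverseˡ _)

  -- The first summand repeats the letter `(p , i)`; in the second, the transposition of m and i
  -- collects p and q at m.
  E₁₁-p : Simple m m′ g → (p , i) ∈ g → E₁₁ p q m g i ≈ L ((p , m) ∷ (q , m) ∷ g)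
  E₁₁-p {m} {m′} {g} {p} {i} {q} σ p∈ with h , π , fi , fm , d ← simple-extract σ p∈ =
    ≈-trans (∙-cong (dup₁ [] p∈) (perm-≈ π ((p , m) ∷ (q , i) ∷ []) ((p , m) ∷ (q , m) ∷ []) (begin
      L ((p , m) ∷ (q , i) ∷ (p , i) ∷ h)       ≈⟨ antisym d (↤ ↦ ↦ free⇒interchange fi fm) ⟩
      L ((p , i) ∷ (q , m) ∷ (p , m) ∷ h) ⁻¹    ≈⟨ ⁻¹-cong (swaps-alt (0 ∷ 1 ∷ 0 ∷ []) _) ⟩
      _                                         ≈⟨ ⁻¹-involutive _ ⟩
      L ((p , m) ∷ (q , m) ∷ (p , i) ∷ h)       ∎))) (identityˡ _)

  E₁₁-q : Simple m m′ g → (q , i) ∈ g → E₁₁ p q m g i ≈ L ((p , m) ∷ (q , m) ∷ g)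
  E₁₁-q {m} {m′} {g} {q} {i} {p} σ q∈ with h , π , fi , fm , d ← simple-extract σ q∈ =
    ≈-trans (∙-cong (perm-≈ π ((p , i) ∷ (q , m) ∷ []) ((p , m) ∷ (q , m) ∷ []) (begin
      L ((p , i) ∷ (q , m) ∷ (q , i) ∷ h)       ≈⟨ antisym d (↦ ↤ ↦ free⇒interchange fi fm) ⟩
      L ((p , m) ∷ (q , i) ∷ (q , m) ∷ h) ⁻¹    ≈⟨ ⁻¹-cong (swaps-alt (1 ∷ []) _) ⟩
      _                                         ≈⟨ ⁻¹-involutive _ ⟩
      L ((p , m) ∷ (q , m) ∷ (q , i) ∷ h)       ∎)) (dup₀ ((p , m) ∷ []) q∈)) (identityʳ _)

  -- Transposing the indices of two letters of the same kind negates, and so does swapping back the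
  -- letters in the tail.
  E₁₁-≡ : ∀ {r} → Simple m m′ g → (r , i) ∈ g → (r , j) ∈ g → E₁₁ p q m g i ≈ E₁₁ p q m g j
  E₁₁-≡ {m} {m′} {g} {i} {j} {p} {q} {r} σ i∈ j∈ with i Finₚ.≟ j
  ... | yes refl = ≈-refl
  ... | no i≢j with h₁ , π₁ , fi , fm , im ← simple-extract σ i∈
    with h , π₂ ← extract (∈-rest π₁ (index≢ (i≢j ∘ ≡.sym)) j∈)
    with _ , _ , _ , _ , jm ← simple-extract σ j∈
    with _ ∷ _ ∷ _ ∷ jh ∷ _ ← Unique-resp-↭ (↭-trans σ (prep _ (prep _ (↭ₚ.map⁺ proj₂ (↭-trans π₁ (prep _ π₂)))))) (Uniqueₚ.allFin⁺ n) =
    let π = ↭-trans π₁ (prep _ π₂)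
        s = free⇒interchange (All.tail (Free-resp π₂ fi)) (∉⇒Free (All≢⇒∉ jh))
    in ∙-cong
      (perm-≈ π ((p , i) ∷ (q , m) ∷ []) ((p , j) ∷ (q , m) ∷ [])
        (≈-trans (antisym i≢j (↦ keep (im ∘ ≡.sym) (jm ∘ ≡.sym) (↦ ↤ s)))
          (≈-trans (⁻¹-cong (swaps-alt (2 ∷ []) _)) (⁻¹-involutive _))))
      (perm-≈ π ((p , m) ∷ (q , i) ∷ []) ((p , m) ∷ (q , j) ∷ [])
        (≈-trans (antisym i≢j (keep (im ∘ ≡.sym) (jm ∘ ≡.sym) (↦ ↦ ↤ s)))
          (≈-trans (⁻¹-cong (swaps-alt (2 ∷ []) _)) (⁻¹-involutive _))))

  Σ-simple : ∀ p q → Simple m m′ g →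
    (L ((p , m) ∷ (q , m) ∷ g) ∙ L ((p , m) ∷ (q , m) ∷ g)) ∙ Σl g (E₁₁ p q m g ∘ proj₂) ≈ ε
  Σ-simple {m} {m′} {g} p q σ = begin
    _ ∙ Σl g (E₁₁ p q m g ∘ proj₂)                        ≡⟨ cong (_ ∙_) (Σ-map g proj₂ (E₁₁ p q m g)) ⟨
    _ ∙ Σl (map proj₂ g) (E₁₁ p q m g)                    ≈⟨ ∙-congˡ (identityˡ _) ⟨
    _ ∙ (ε ∙ Σl (map proj₂ g) (E₁₁ p q m g))              ≈⟨ ∙-congˡ (∙-congʳ (cancel-missing₁₁ σ)) ⟨
    _                                                     ≈⟨ Σ-↭ (E₁₁ p q m g) σ ⟨
    Σl (allFin n) (E₁₁ p q m g)                           ≈⟨ relation₁₁ p q m g ⟩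
    ε                                                     ∎

  -- Without the kind r every letter of g contributes X to the relation, in addition to the two X
  -- from the index m.
  no-third₀ : Kinds p q r → Simple m m′ g → r ∉ map proj₁ g → L ((p , m) ∷ (q , m) ∷ g) ≈ ε
  no-third₀ {p} {q} {r} {m} {m′} {g} κ σ r∉ = torsion-free (suc k) X (begin
      X ∙ (X ∙ k ∗ X)                                     ≈⟨ assoc _ _ _ ⟨
      (X ∙ X) ∙ k ∗ X                                     ≈⟨ ∙-congˡ sum ⟨
      (X ∙ X) ∙ Σl g (E₁₁ p q m g ∘ proj₂)                ≈⟨ Σ-simple p q σ ⟩
      ε                                                   ∎)
    where
    X = L ((p , m) ∷ (q , m) ∷ g)
    kind∈ : ∀ {k i} {l : List (Letter n)} → (k , i) ∈ l → k ∈ map proj₁ l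
    kind∈ (here refl) = here refl
    kind∈ (there x)   = there (kind∈ x)
    term : ∀ v → v ∈ g → E₁₁ p q m g (proj₂ v) ≈ ε ⊎ E₁₁ p q m g (proj₂ v) ≈ X
    term (l , i) v∈ with cover κ l
    ... | inj₁ refl        = inj₂ (E₁₁-p σ v∈)
    ... | inj₂ (inj₁ refl) = inj₂ (E₁₁-q σ v∈)
    ... | inj₂ (inj₂ refl) = ⊥-elim (r∉ (kind∈ v∈))
    k = proj₁ (Σ-01 g term)
    sum = proj₂ (Σ-01 g term)

  module Cyclic {m m′ i : Fin n} {G : List (Letter n)} (σ : allFin n ↭ m ∷ m′ ∷ i ∷ map proj₂ G) where

    -- The pair sits at m and the third kind at i; everything else is held fixed while the kinds
    -- rotate.
    γ : Fin 3 → Fin 3 → Fin 3 → Carrier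
    γ p q r = L ((p , m) ∷ (q , m) ∷ (r , i) ∷ G)

    -- Transposing m and i collects the letters at i into a pair at m, one with r and q, the other
    -- with p and r. This is what couples the three pairings.
    E₁₁-r : ∀ p q r → E₁₁ p q m ((r , i) ∷ G) i ≈ (γ q r p ∙ γ r p q) ⁻¹
    E₁₁-r p q r with _ , π , _ , _ , d ← simple-extract {g = (r , i) ∷ G} σ (here refl)
      with (_ ∷ _ ∷ a) ∷ _ ∷ b ∷ _ ← Unique-resp-↭ σ (Uniqueₚ.allFin⁺ n) =
      let s = free⇒interchange (∉⇒Free (All≢⇒∉ b)) (∉⇒Free (All≢⇒∉ a)) in begin
      _  ≈⟨ ∙-cong (≈-trans (antisym d (↦ ↤ ↦ s)) (⁻¹-cong (swaps-alt (1 ∷ 0 ∷ []) _)))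
                   (≈-trans (antisym d (↤ ↦ ↦ s)) (⁻¹-cong (swaps-alt (0 ∷ 1 ∷ []) _))) ⟩
      γ r p q ⁻¹ ∙ γ q r p ⁻¹  ≈⟨ comm _ _ ⟩
      γ q r p ⁻¹ ∙ γ r p q ⁻¹  ≈⟨ ⁻¹-∙-comm _ _ ⟩
      _ ∎

    -- The relation at m reads (2 + a) X = (1 + c) Y, with Y the sum of the two other rotations.
    -- Adding (1 + c) X to both sides makes the right side cyclic, so the three rotations are all
    -- controlled by one element.
    balance : Kinds p q r →
      (3 ℕ.+ (count p G ℕ.+ count q G ℕ.+ count r G)) ∗ γ p q r ≈ suc (count r G) ∗ (γ p q r ∙ (γ q r p ∙ γ r p q))
    balance {p} {q} {r} κ = begin
      (3 ℕ.+ (a ℕ.+ c)) ∗ X                        ≈⟨ ·-cong₁ (cong suc (ℕₚ.+-comm (suc (suc a)) c)) X ⟩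
      (suc c ℕ.+ suc (suc a)) ∗ X                  ≈⟨ ×-homo-+ X (suc c) (suc (suc a)) ⟩
      suc c ∗ X ∙ suc (suc a) ∗ X                  ≈⟨ ∙-congˡ (x∙y⁻¹≈ε⇒x≈y _ _ rel) ⟩
      suc c ∗ X ∙ suc c ∗ Y                        ≈⟨ ×-distrib-+ X Y (suc c) ⟨
      suc c ∗ (X ∙ Y)                              ∎
      where
      X = γ p q r
      Y = γ q r p ∙ γ r p q
      a = count p G ℕ.+ count q G
      c = count r G
      gᵣ = (r , i) ∷ G
      ·-⁻¹ : ∀ k x → k ∗ (x ⁻¹) ≈ (k ∗ x) ⁻¹
      ·-⁻¹ zero    x = ≈-sym ε⁻¹≈ε
      ·-⁻¹ (suc k) x = ≈-trans (∙-congˡ (·-⁻¹ k x)) (⁻¹-∙-comm _ _)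
      rel : suc (suc a) ∗ X ∙ (suc c ∗ Y) ⁻¹ ≈ ε
      rel = begin
        (X ∙ (X ∙ a ∗ X)) ∙ (suc c ∗ Y) ⁻¹               ≈⟨ ∙-cong (≈-sym (assoc _ _ _)) (≈-sym (·-⁻¹ (suc c) Y)) ⟩
        ((X ∙ X) ∙ a ∗ X) ∙ suc c ∗ (Y ⁻¹)               ≈⟨ assoc _ _ _ ⟩
        (X ∙ X) ∙ (a ∗ X ∙ suc c ∗ (Y ⁻¹))               ≈⟨ ∙-congˡ (∙-cong
             (·-cong₁ (≡.cong₂ ℕ._+_ (count-≢ {i = i} G (p≢r κ ∘ ≡.sym)) (count-≢ {i = i} G (q≢r κ ∘ ≡.sym))) X) (·-cong₁ (count-≡ {i = i} G) (Y ⁻¹))) ⟨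
        (X ∙ X) ∙ ((count p gᵣ ℕ.+ count q gᵣ) ∗ X ∙ count r gᵣ ∗ (Y ⁻¹))
          ≈⟨ ∙-congˡ (Σ-kinds κ (E₁₁ p q m gᵣ ∘ proj₂) X (Y ⁻¹) gᵣ
                (λ j x → E₁₁-p σ x) (λ j x → E₁₁-q σ x)
                (λ j x → ≈-trans (E₁₁-≡ σ x (here refl)) (E₁₁-r p q r))) ⟨
        (X ∙ X) ∙ Σl gᵣ (E₁₁ p q m gᵣ ∘ proj₂)             ≈⟨ Σ-simple p q σ ⟩
        ε                                                ∎

    -- If one rotation vanishes, its `balance` kills the cyclic sum, because the factor in front of
    -- it is positive; the `balance` of the next rotation then kills that one.
    next₀ : Kinds p q r → γ p q r ≈ ε → γ q r p ≈ ε
    next₀ {p} {q} {r} κ z = torsion-free (2 ℕ.+ (count q G ℕ.+ count r G ℕ.+ count p G)) _ (≈-trans (balance (rotate κ)) (·-ε (suc (count p G)) (begin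
      γ q r p ∙ (γ r p q ∙ γ p q r)  ≈⟨ assoc _ _ _ ⟨
      (γ q r p ∙ γ r p q) ∙ γ p q r  ≈⟨ comm _ _ ⟩
      γ p q r ∙ (γ q r p ∙ γ r p q)  ≈⟨ torsion-free (count r G) _ (≈-trans (≈-sym (balance κ)) (·-ε (3 ℕ.+ (count p G ℕ.+ count q G ℕ.+ count r G)) z)) ⟩
      ε ∎)))
      where
      ·-ε : ∀ k {x} → x ≈ ε → k ∗ x ≈ ε
      ·-ε zero    e = ≈-refl
      ·-ε (suc k) e = εε e (·-ε k e)

  -- Aligns the two lists of labels from the left. A transposition corrects the first label that
  -- differs, and it fixes the prefix because neither list has repetitions.
  transport₀ : ∀ bs pre l l₀ → Unique (pre ++ l) → Unique (pre ++ l₀) → length l ≡ length l₀ →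
    L (place bs (pre ++ l₀)) ≈ ε → L (place bs (pre ++ l)) ≈ ε
  transport₀ bs pre []      []        u u₀ e z = z
  transport₀ bs pre (i ∷ l) (j ∷ l₀) u u₀ e z with i Finₚ.≟ j
  ... | yes refl = subst (λ x → L (place bs x) ≈ ε) (Listₚ.++-assoc pre (i ∷ []) l)
    (transport₀ bs (pre ++ i ∷ []) l l₀ (subst Unique (≡.sym (Listₚ.++-assoc pre (i ∷ []) l)) u)
      (subst Unique (≡.sym (Listₚ.++-assoc pre (i ∷ []) l₀)) u₀) (ℕₚ.suc-injective e)
      (subst (λ x → L (place bs x) ≈ ε) (≡.sym (Listₚ.++-assoc pre (i ∷ []) l₀)) z))
  ... | no i≢j = ≈-trans (≈-sym (⁻¹-involutive _)) (≈-trans (⁻¹-cong (≈-trans (≈-sym (anti i≢j _))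
      (≈-trans (reflexive (cong L (≡.trans (relabel-place (tr i j) bs (pre ++ i ∷ l)) (cong (place bs) (≡.trans map≡ (≡.sym (Listₚ.++-assoc pre (j ∷ []) _)))))))
        (transport₀ bs (pre ++ j ∷ []) (map (tr i j) l) l₀
          (subst Unique (≡.trans map≡ (≡.sym (Listₚ.++-assoc pre (j ∷ []) _))) (Uniqueₚ.map⁺ (tr-injective i j) u))
          (subst Unique (≡.sym (Listₚ.++-assoc pre (j ∷ []) l₀)) u₀)
          (≡.trans (Listₚ.length-map (tr i j) l) (ℕₚ.suc-injective e))
          (subst (λ x → L (place bs x) ≈ ε) (≡.sym (Listₚ.++-assoc pre (j ∷ []) l₀)) z))))) ε⁻¹≈ε)
    where
    fixes : ∀ xs → Unique (xs ++ i ∷ l) → Unique (xs ++ j ∷ l₀) → map (tr i j) xs ≡ xs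
    fixes []       _ _ = refl
    fixes (x ∷ xs) (a ∷ u) (b ∷ v) = ≡.cong₂ _∷_
      (tr-≢ (λ { refl → All≢⇒∉ a (∈-++⁺ʳ xs (here refl)) }) (λ { refl → All≢⇒∉ b (∈-++⁺ʳ xs (here refl)) }))
      (fixes xs u v)
    map≡ : map (tr i j) (pre ++ i ∷ l) ≡ pre ++ j ∷ map (tr i j) l
    map≡ = ≡.trans (Listₚ.map-++ (tr i j) pre (i ∷ l)) (≡.cong₂ _++_ (fixes pre u u₀) (cong (_∷ map (tr i j) l) (tr-l i j)))

  -- Degrees below n

  low₀ : ∀ ks → suc (length ks) < n → ∀ w → map proj₁ w ↭ ks → L w ≈ ε
  low₀ ks h w κ with i , j , d , i∉ , j∉ ← missing₂ (map proj₂ w) (subst (λ x → suc x < n)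
      (≡.trans (≡.sym (↭ₚ.↭-length κ)) (≡.trans (Listₚ.length-map proj₁ w) (≡.sym (length-indices w)))) h) =
    twoMissing d (∉⇒Free i∉) (∉⇒Free j∉)

  first₀ : ∀ ks → suc (length ks) ≡ n → ∀ l₀ → Unique l₀ → length l₀ ≡ length ks →
           L (place (singletons ks) l₀) ≈ ε → ∀ w → map proj₁ w ↭ ks → L w ≈ ε
  first₀ ks h l₀ u₀ e z w κ with unique? Finₚ._≟_ (map proj₂ w)
  ... | yes u with l , π , ρ ← arrange w κ = perm₀ π (transport₀ (singletons ks) [] l l₀ (Unique-resp-↭ ρ u) u₀
          (≡.trans (≡.sym (↭ₚ.↭-length ρ)) (≡.trans (length-indices w) (≡.trans (≡.sym (Listₚ.length-map proj₁ w))
            (≡.trans (↭ₚ.↭-length κ) (≡.sym e))))) z)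
  ... | no ¬u with p , q , x , w′ , π ← pair w ¬u
    with i , j , d , i∉ , j∉ ← missing₂ (x ∷ map proj₂ w′) (ℕₚ.≤-reflexive
      (≡.trans (cong suc (≡.trans (cong (2 ℕ.+_) (length-indices w′)) (≡.trans (≡.sym (↭ₚ.↭-length π))
        (≡.trans (≡.sym (Listₚ.length-map proj₁ w)) (↭ₚ.↭-length κ))))) h)) =
    perm₀ π (twoMissing d (∉⇒Free λ { (here a) → i∉ (here a) ; (there a) → i∉ a })
                          (∉⇒Free λ { (here a) → j∉ (here a) ; (there a) → j∉ a }))

  -- Reduction to one reference word in degree n

  kind-occurs : ∀ {k : Fin 3} w → k ∈ map proj₁ w → ∃ λ (i : Fin n) → (k , i) ∈ w
  kind-occurs ((_ , i) ∷ w) (here refl) = i , here refl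
  kind-occurs (_ ∷ w) (there m) with i , p ← kind-occurs w m = i , there p

  kind∈? : ∀ k (w : List (Letter n)) → Dec (k ∈ map proj₁ w)
  kind∈? k w = k ∈?′ map proj₁ w
    where open import Data.List.Membership.DecPropositional (Finₚ._≟_ {3}) renaming (_∈?_ to _∈?′_)

  kinds₀₁₂ : Kinds 0F 1F 2F
  kinds₀₁₂ = toWitness {a? = kinds? 0F 1F 2F} _

  module _ (ks : List (Fin 3)) (length-ks : length ks ≡ n)
    (base : ∀ {m m′ i : Fin n} {G} → allFin n ↭ m ∷ m′ ∷ i ∷ map proj₂ G → 0F ∷ 1F ∷ 2F ∷ map proj₁ G ↭ ks →
            L ((0F , m) ∷ (1F , m) ∷ (2F , i) ∷ G) ≈ ε) where

    -- All six orders arise from θ, ξ, ρ by rotation, through `next₀`, and by swapping the two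
    -- letters at m.
    orient : ∀ {m m′ i : Fin n} {G} p q r → Kinds p q r → allFin n ↭ m ∷ m′ ∷ i ∷ map proj₂ G →
             p ∷ q ∷ r ∷ map proj₁ G ↭ ks → L ((p , m) ∷ (q , m) ∷ (r , i) ∷ G) ≈ ε
    orient {m} {m′} {i} {G} p q r κ σ τ = cases p q r κ τ
      where
      open Cyclic {m} {m′} {i} {G} σ
      odd : ∀ {p q r} → γ p q r ≈ ε → γ q p r ≈ ε
      odd z = ≈-trans (swaps-alt (0 ∷ []) _) (±-ε true z)
      rot : ∀ {a b c : Fin 3} {l} → c ∷ a ∷ b ∷ l ↭ a ∷ b ∷ c ∷ l
      rot = ↭-trans (swap _ _ ↭-refl) (prep _ (swap _ _ ↭-refl))
      z₀₁₂ : 0F ∷ 1F ∷ 2F ∷ map proj₁ G ↭ ks → γ 0F 1F 2F ≈ ε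
      z₀₁₂ = base σ
      z₁₂₀ : 0F ∷ 1F ∷ 2F ∷ map proj₁ G ↭ ks → γ 1F 2F 0F ≈ ε
      z₁₂₀ τ = next₀ kinds₀₁₂ (z₀₁₂ τ)
      z₂₀₁ : 0F ∷ 1F ∷ 2F ∷ map proj₁ G ↭ ks → γ 2F 0F 1F ≈ ε
      z₂₀₁ τ = next₀ (rotate kinds₀₁₂) (z₁₂₀ τ)
      cases : ∀ p q r → Kinds p q r → p ∷ q ∷ r ∷ map proj₁ G ↭ ks → γ p q r ≈ ε
      cases 0F 1F 2F κ τ = z₀₁₂ τ
      cases 1F 2F 0F κ τ = z₁₂₀ (↭-trans rot τ)
      cases 2F 0F 1F κ τ = z₂₀₁ (↭-trans rot (↭-trans rot τ))
      cases 1F 0F 2F κ τ = odd (z₀₁₂ (↭-trans (swap _ _ ↭-refl) τ))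
      cases 2F 1F 0F κ τ = odd (z₁₂₀ (↭-trans rot (↭-trans (swap _ _ ↭-refl) τ)))
      cases 0F 2F 1F κ τ = odd (z₂₀₁ (↭-trans (prep _ (swap _ _ ↭-refl)) τ))
      cases 0F 0F _ κ τ = ⊥-elim (p≢q κ refl)
      cases 1F 1F _ κ τ = ⊥-elim (p≢q κ refl)
      cases 2F 2F _ κ τ = ⊥-elim (p≢q κ refl)
      cases 0F 1F 0F κ τ = ⊥-elim (p≢r κ refl)
      cases 0F 1F 1F κ τ = ⊥-elim (q≢r κ refl)
      cases 0F 2F 0F κ τ = ⊥-elim (p≢r κ refl)
      cases 0F 2F 2F κ τ = ⊥-elim (q≢r κ refl)
      cases 1F 0F 0F κ τ = ⊥-elim (q≢r κ refl)
      cases 1F 0F 1F κ τ = ⊥-elim (p≢r κ refl)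
      cases 1F 2F 1F κ τ = ⊥-elim (p≢r κ refl)
      cases 1F 2F 2F κ τ = ⊥-elim (q≢r κ refl)
      cases 2F 0F 0F κ τ = ⊥-elim (q≢r κ refl)
      cases 2F 0F 2F κ τ = ⊥-elim (p≢r κ refl)
      cases 2F 1F 1F κ τ = ⊥-elim (q≢r κ refl)
      cases 2F 1F 2F κ τ = ⊥-elim (p≢r κ refl)

    -- Since m′ is missing, n letters contain a pair, at i say. If the other letters do not use each
    -- remaining index once, a second index is missing. Otherwise the presence of the third kind
    -- decides between `no-third₀` and `orient`.
    second-missing₀ : ∀ w → Free m′ w → map proj₁ w ↭ ks → L w ≈ ε
    second-missing₀ {m′} w f κ
      with length-w ← ≡.trans (≡.sym (Listₚ.length-map proj₁ w)) (≡.trans (↭ₚ.↭-length κ) length-ks)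
      with p , q , i , w₁ , π ← pair w (λ u → ℕₚ.1+n≰n (subst (λ x → suc x ≤ n) (≡.trans (length-indices w) length-w)
             (Unique⇒length≤ {l = m′ ∷ map proj₂ w} (∉⇒All≢ (Free⇒∉ f) ∷ u))))
      with p Finₚ.≟ q
    ... | yes refl = perm₀ π (twice₀ [] _ _)
    ... | no p≢q with r , κ′ ← thirdKind p≢q with fi ∷ _ ∷ f₁ ← Free-resp π f
      with length-l ← ≡.trans (cong (2 ℕ.+_) (length-indices w₁)) (≡.trans (≡.sym (↭ₚ.↭-length π)) length-w)
      with unique? Finₚ._≟_ (i ∷ m′ ∷ map proj₂ w₁)
    ...   | no ¬u with x , l , ρ ← repeated Finₚ._≟_ _ ¬u
      with j , j∉ ← missing (x ∷ l) (ℕₚ.≤-reflexive (≡.trans (≡.sym (↭ₚ.↭-length ρ)) length-l)) =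
      let j∉′ : j ∉ i ∷ m′ ∷ map proj₂ w₁
          j∉′ a = j∉ (∈-head (↭ₚ.∈-resp-↭ ρ a))
      in perm₀ π (twoMissing (λ e → j∉′ (there (here e))) (∉⇒Free λ { (here e) → j∉′ (here e)
           ; (there (here e)) → j∉′ (here e) ; (there (there a)) → j∉′ (there (there a)) }) (fi ∷ fi ∷ f₁))
      where
      ∈-head : ∀ {A : Set} {v x : A} {l} → v ∈ x ∷ x ∷ l → v ∈ x ∷ l
      ∈-head (here e)  = here e
      ∈-head (there a) = a
    ...   | yes u with σ ← Unique⇒allFin↭ u length-l with kind∈? r w₁
    ...     | no r∉ = perm₀ π (no-third₀ κ′ σ r∉)
    ...     | yes r∈ with j , j∈ ← kind-occurs w₁ r∈ with G , π′ ← extract j∈ =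
      let π″ = ↭-trans π (prep _ (prep _ π′)) in
      perm₀ π″ (orient p q r κ′ (↭-trans σ (prep _ (prep _ (↭ₚ.map⁺ proj₂ π′)))) (↭-trans (↭ₚ.map⁺ proj₁ (↭-sym π″)) κ))

    second₀ : Fin n → ∀ w → map proj₁ w ↭ ks → L w ≈ ε
    second₀ i = reduce i ks λ w → second-missing₀ w

  second-base : ∀ ks l₀ → 3 ℕ.+ length ks ≡ n → Unique l₀ → length l₀ ≡ 2 ℕ.+ length ks →
    L (place ((0F ∷ 1F ∷ []) ∷ (2F ∷ []) ∷ singletons ks) l₀) ≈ ε →
    ∀ {m m′ i : Fin n} {G} → allFin n ↭ m ∷ m′ ∷ i ∷ map proj₂ G → map proj₁ G ↭ ks →
    L ((0F , m) ∷ (1F , m) ∷ (2F , i) ∷ G) ≈ ε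
  second-base ks l₀ h u₀ e z {m} {m′} {i} {G} σ κ with l , π , ρ ← arrange G κ
    with (_ ∷ mi ∷ ml) ∷ _ ∷ ul ← Unique-resp-↭ (↭-trans σ (prep _ (prep _ (prep _ ρ)))) (Uniqueₚ.allFin⁺ n) =
    perm₀ (prep _ (prep _ (prep _ π))) (transport₀ _ [] (m ∷ i ∷ l) l₀ ((mi ∷ ml) ∷ ul) u₀
      (≡.trans (cong (2 ℕ.+_) (≡.trans (≡.sym (↭ₚ.↭-length ρ)) (≡.trans (length-indices G)
        (≡.trans (≡.sym (Listₚ.length-map proj₁ G)) (↭ₚ.↭-length κ))))) (≡.sym e)) z)

-- Coefficients of words

ℚ⁺ : AbelianGroup 0ℓ 0ℓ
ℚ⁺ = ℚₚ.+-0-abelianGroup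

module ℚ⁺ₚ = Algebra.Properties.AbelianGroup ℚ⁺

-- Up to commuting the product, `key` is the numbering of pairs by `Fin.combine`.
key-injective : ∀ {n} {u v : Var n} → key u ≡ key v → u ≡ v
key-injective {n} {k , i} {l , j} e =
  ≡.cong₂ _,_ (proj₁ (Finₚ.combine-injective k i l j eq)) (proj₂ (Finₚ.combine-injective k i l j eq))
  where
  eq : Fin.combine k i ≡ Fin.combine l j
  eq = Finₚ.toℕ-injective (≡.trans (Finₚ.toℕ-combine k i) (≡.trans
        (cong (ℕ._+ Fin.toℕ i) (ℕₚ.*-comm n (Fin.toℕ k))) (≡.trans e
        (≡.trans (cong (ℕ._+ Fin.toℕ j) (ℕₚ.*-comm (Fin.toℕ l) n)) (≡.sym (Finₚ.toℕ-combine l j))))))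

≡ᵇ-refl : ∀ m → (m ℕ.≡ᵇ m) ≡ true
≡ᵇ-refl zero    = refl
≡ᵇ-refl (suc m) = ≡ᵇ-refl m

≡ᵇ⇒≡ : ∀ {m k} → (m ℕ.≡ᵇ k) ≡ true → m ≡ k
≡ᵇ⇒≡ {m} {k} e = ℕₚ.≡ᵇ⇒≡ m k (subst T (≡.sym e) _)

memb⇒∈ : ∀ {n} {v : Var n} w → memb v w ≡ true → v ∈ w
memb⇒∈ {v = v} (u ∷ w) e with key u ℕ.≡ᵇ key v in eq
... | true  = here (key-injective (≡.sym (≡ᵇ⇒≡ {key u} eq)))
... | false = there (memb⇒∈ w e)

∈⇒memb : ∀ {n} {v : Var n} {w} → v ∈ w → memb v w ≡ true
∈⇒memb {v = v} (here refl) rewrite ≡ᵇ-refl (key v) = refl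
∈⇒memb {v = v} {u ∷ w} (there i) rewrite ∈⇒memb i = Boolₚ.∨-zeroʳ _

iff⇒≡ : ∀ {a b : Bool} → (a ≡ true → b ≡ true) → (b ≡ true → a ≡ true) → a ≡ b
iff⇒≡ {true}  {true}  f g = refl
iff⇒≡ {false} {false} f g = refl
iff⇒≡ {true}  {false} f g = ≡.sym (f refl)
iff⇒≡ {false} {true}  f g = g refl

memb-↭ : ∀ {n} {w w′ : Word n} (v : Var n) → w ↭ w′ → memb v w ≡ memb v w′
memb-↭ {w = w} {w′} v p = iff⇒≡ (λ e → ∈⇒memb {v = v} (↭ₚ.∈-resp-↭ p (memb⇒∈ w e)))
                                (λ e → ∈⇒memb {v = v} (↭ₚ.∈-resp-↭ (↭-sym p) (memb⇒∈ w′ e)))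

∧-true : ∀ {a b} → a ∧ b ≡ true → a ≡ true × b ≡ true
∧-true {true} {true} refl = refl , refl

noDup⇒Unique : ∀ {n} (w : Word n) → noDup w ≡ true → Unique w
noDup⇒Unique []      e = []
noDup⇒Unique (v ∷ w) e with a , b ← ∧-true {not (memb v w)} e =
  ∉⇒All≢ (λ i → contra (∈⇒memb i) a) ∷ noDup⇒Unique w b
  where
  contra : ∀ {b} → b ≡ true → not b ≡ true → ⊥
  contra refl ()

Unique⇒noDup : ∀ {n} {w : Word n} → Unique w → noDup w ≡ true
Unique⇒noDup []               = refl
Unique⇒noDup {w = v ∷ w} (a ∷ u) with memb v w in eq
... | true  = ⊥-elim (All≢⇒∉ a (memb⇒∈ w eq))
... | false = Unique⇒noDup u

all-true : ∀ {A : Set} (f : A → Bool) l → all f l ≡ true → ∀ {v} → v ∈ l → f v ≡ true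
all-true f (x ∷ l) e (here refl) = proj₁ (∧-true e)
all-true f (x ∷ l) e (there i)   = all-true f l (proj₂ (∧-true {f x} e)) i

all-false : ∀ {A : Set} (f : A → Bool) l → all f l ≡ false → ∃ λ v → f v ≡ false
all-false f (x ∷ l) e with f x in eq
... | false = x , eq
... | true  = all-false f l e

∈-allVars : ∀ {n} (v : Var n) → v ∈ allVars n
∈-allVars (k , i) = ∈-cartesianProduct⁺ (∈-allFin k) (∈-allFin i)

-- The comparison local to sameSet cannot be named, so it is evaluated by abstracting its arguments.
sameSet⇒ : ∀ {n} (w : Word n) S → sameSet w S ≡ true → ∀ v → S v ≡ memb v w
sameSet⇒ {n} w S e v with S v | memb v w | all-true _ (allVars n) e (∈-allVars v)
... | true  | true  | _ = refl
... | false | false | _ = refl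

⇒sameSet : ∀ {n} (w : Word n) S → (∀ v → S v ≡ memb v w) → sameSet w S ≡ true
⇒sameSet {n} w S h with sameSet w S in e
... | true = refl
... | false with all-false _ (allVars n) e
...   | v , x with S v | memb v w | x | h v
...     | true  | _ | () | refl
...     | false | _ | () | refl

Good : ∀ {n} → Word n → Subset n → Set
Good w S = Unique w × (∀ v → S v ≡ memb v w)

good? : ∀ {n} (w : Word n) S → Dec (Good w S)
good? w S with noDup w in e | sameSet w S in f
... | true  | true  = yes (noDup⇒Unique w e , sameSet⇒ w S f)
... | false | _     = no λ { (u , _) → Boolₚ.not-¬ e (Unique⇒noDup u) }
... | true  | false = no λ { (_ , h) → Boolₚ.not-¬ f (⇒sameSet w S h) }

wordCoeff-good : ∀ {n} {w : Word n} {S} → Good w S → wordCoeff w S ≡ signℕ (inversions w)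
wordCoeff-good {w = w} {S} (u , h) rewrite Unique⇒noDup u | ⇒sameSet w S h = refl

wordCoeff-bad : ∀ {n} {w : Word n} {S} → ¬ Good w S → wordCoeff w S ≡ 0ℚ
wordCoeff-bad {w = w} {S} ¬g with noDup w in e | sameSet w S in f
... | true  | true  = ⊥-elim (¬g (noDup⇒Unique w e , sameSet⇒ w S f))
... | false | _     = refl
... | true  | false = refl

good-↭ : ∀ {n} {w w′ : Word n} {S} → w ↭ w′ → Good w S → Good w′ S
good-↭ p (u , h) = Unique-resp-↭ p u , λ v → ≡.trans (h v) (memb-↭ v p)

signℕ-suc : ∀ m → signℕ (suc m) ≡ ℚ.- signℕ m
signℕ-suc zero          = refl
signℕ-suc (suc zero)    = refl
signℕ-suc (suc (suc m)) = ≡.trans (step (suc m)) (≡.trans (signℕ-suc m) (cong ℚ.-_ (≡.sym (step m))))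
  where
  step : ∀ m → signℕ (suc (suc m)) ≡ signℕ m
  step m = cong (λ x → if x ℕ.≡ᵇ 0 then 1ℚ else ℚ.- 1ℚ)
    (≡.trans (cong (_% 2) (ℕₚ.+-comm 2 m)) ([m+n]%n≡m%n m 2))

below : ∀ {n} → Var n → Word n → ℕ
below v w = length (filter (λ u → key u ℕ.<? key v) w)

below-↭ : ∀ {n} (v : Var n) {w w′} → w ↭ w′ → below v w ≡ below v w′
below-↭ v p = ↭ₚ.↭-length (↭ₚ.filter-↭ (λ u → key u ℕ.<? key v) p)

below-< : ∀ {n} {x y : Var n} w → key y < key x → below x (y ∷ w) ≡ suc (below x w)
below-< {x = x} {y} w h = cong length (Listₚ.filter-accept (λ u → key u ℕ.<? key x) h)

below-≮ : ∀ {n} {x y : Var n} w → ¬ key y < key x → below x (y ∷ w) ≡ below x w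
below-≮ {x = x} {y} w h = cong length (Listₚ.filter-reject (λ u → key u ℕ.<? key x) h)

-- The inversion counts differ only in the comparison of the two leading letters; as these are
-- distinct, exactly one of the two orders counts it.
sign-head : ∀ {n} (x y : Var n) w → x ≢ y → signℕ (inversions (x ∷ y ∷ w)) ≡ ℚ.- signℕ (inversions (y ∷ x ∷ w))
sign-head x y w d with ℕₚ.<-cmp (key x) (key y)
... | tri< a _ ¬c = ≡.sym (≡.trans (cong ℚ.-_ (≡.trans (cong signℕ eq) (signℕ-suc (inversions (x ∷ y ∷ w))))) (ℚ⁺ₚ.⁻¹-involutive (signℕ (inversions (x ∷ y ∷ w)))))
  where
  eq : inversions (y ∷ x ∷ w) ≡ suc (inversions (x ∷ y ∷ w))
  eq rewrite below-< {x = y} {x} w a | below-≮ {x = x} {y} w ¬c = cong suc (x∙yz≈y∙xz (below y w) (below x w) _)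
    where open import Algebra.Properties.CommutativeSemigroup ℕₚ.+-commutativeSemigroup
... | tri≈ _ b _ = ⊥-elim (d (key-injective b))
... | tri> ¬a _ c = ≡.trans (cong signℕ eq) (signℕ-suc (inversions (y ∷ x ∷ w)))
  where
  eq : inversions (x ∷ y ∷ w) ≡ suc (inversions (y ∷ x ∷ w))
  eq rewrite below-< {x = x} {y} w c | below-≮ {x = y} {x} w ¬a = cong suc (x∙yz≈y∙xz (below x w) (below y w) _)
    where open import Algebra.Properties.CommutativeSemigroup ℕₚ.+-commutativeSemigroup

signℕ-+ : ∀ a {b c} → signℕ b ≡ ℚ.- signℕ c → signℕ (a ℕ.+ b) ≡ ℚ.- signℕ (a ℕ.+ c)
signℕ-+ zero    e = e
signℕ-+ (suc a) e = ≡.trans (signℕ-suc (a ℕ.+ _)) (cong ℚ.-_ (≡.trans (signℕ-+ a e) (≡.sym (signℕ-suc (a ℕ.+ _)))))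

sign-swap : ∀ {n} u (x y : Var n) w → x ≢ y → signℕ (inversions (u ++ x ∷ y ∷ w)) ≡ ℚ.- signℕ (inversions (u ++ y ∷ x ∷ w))
sign-swap []      x y w d = sign-head x y w d
sign-swap (z ∷ u) x y w d = ≡.trans (cong (λ t → signℕ (t ℕ.+ inversions (u ++ x ∷ y ∷ w)))
    (below-↭ z (↭ₚ.++⁺ˡ u (swap x y ↭-refl))))
  (signℕ-+ (below z (u ++ y ∷ x ∷ w)) (sign-swap u x y w d))

-- Outside `Good` both coefficients are zero, and `Good` supplies the distinct letters that
-- `sign-swap` demands.
wordCoeff-alt : ∀ {n} (S : Subset n) → Alt ℚ⁺ (λ w → wordCoeff w S)
wordCoeff-alt S u x y w with good? (u ++ x ∷ y ∷ w) S
... | yes g = ≡.trans (wordCoeff-good g) (≡.trans (sign-swap u x y w (distinct u (proj₁ g)))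
                (cong ℚ.-_ (≡.sym (wordCoeff-good (good-↭ (↭ₚ.++⁺ˡ u (swap x y ↭-refl)) g)))))
  where
  distinct : ∀ u → Unique (u ++ x ∷ y ∷ w) → x ≢ y
  distinct []      ((d ∷ _) ∷ _) = d
  distinct (_ ∷ u) (_ ∷ v)       = distinct u v
... | no ¬g = ≡.trans (wordCoeff-bad ¬g) (cong ℚ.-_ (≡.sym (wordCoeff-bad
                (λ g → ¬g (good-↭ (↭ₚ.++⁺ˡ u (swap y x ↭-refl)) g)))))

-- Alternating functions on words descend to Λ

extend : ∀ {n} → (Word n → ℚ) → Λ n → ℚ
extend L f = foldr (λ t acc → proj₁ t ℚ.* L (proj₂ t) ℚ.+ acc) 0ℚ f

extend-++ : ∀ {n} (L : Word n → ℚ) f g → extend L (f ++ g) ≡ extend L f ℚ.+ extend L g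
extend-++ L []            g = ≡.sym (ℚₚ.+-identityˡ _)
extend-++ L ((q , w) ∷ f) g = ≡.trans (cong (q ℚ.* L w ℚ.+_) (extend-++ L f g)) (≡.sym (ℚₚ.+-assoc (q ℚ.* L w) (extend L f) (extend L g)))

extend-· : ∀ {n} (L : Word n → ℚ) q f → extend L (q · f) ≡ q ℚ.* extend L f
extend-· L q []            = ≡.sym (ℚₚ.*-zeroʳ q)
extend-· L q ((p , w) ∷ f) = ≡.trans (≡.cong₂ ℚ._+_ (ℚₚ.*-assoc q p (L w)) (extend-· L q f)) (≡.sym (ℚₚ.*-distribˡ-+ q _ _))

sgnℚ : Bool → ℚ
sgnℚ false = 1ℚ
sgnℚ true  = ℚ.- 1ℚ

±-sgnℚ : ∀ b x → Signs.±_ ℚ⁺ b x ≡ sgnℚ b ℚ.* x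
±-sgnℚ false x = ≡.sym (ℚₚ.*-identityˡ x)
±-sgnℚ true  x = ≡.trans (cong ℚ.-_ (≡.sym (ℚₚ.*-identityˡ x))) (ℚₚ.neg-distribˡ-* 1ℚ x)

setOf : ∀ {n} → Word n → Subset n
setOf w v = memb v w

cancel₀ : ∀ {p q} → p ≢ 0ℚ → p ℚ.* q ≡ 0ℚ → q ≡ 0ℚ
cancel₀ {p} {q} p≢0 e = begin
  q                        ≡⟨ ℚₚ.*-identityˡ q ⟨
  1ℚ ℚ.* q                 ≡⟨ cong (ℚ._* q) (ℚₚ.*-inverseˡ p) ⟨
  (ℚ.1/ p ℚ.* p) ℚ.* q     ≡⟨ ℚₚ.*-assoc (ℚ.1/ p) p q ⟩
  ℚ.1/ p ℚ.* (p ℚ.* q)     ≡⟨ cong (ℚ.1/ p ℚ.*_) e ⟩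
  ℚ.1/ p ℚ.* 0ℚ            ≡⟨ ℚₚ.*-zeroʳ (ℚ.1/ p) ⟩
  0ℚ                       ∎
  where
  open ≡.≡-Reasoning
  instance _ = ℚ.≢-nonZero p≢0

self-neg⇒0 : ∀ {q} → q ≡ ℚ.- q → q ≡ 0ℚ
self-neg⇒0 {q} e = cancel₀ {1ℚ ℚ.+ 1ℚ} (λ ()) (begin
  (1ℚ ℚ.+ 1ℚ) ℚ.* q            ≡⟨ ℚₚ.*-distribʳ-+ q 1ℚ 1ℚ ⟩
  1ℚ ℚ.* q ℚ.+ 1ℚ ℚ.* q        ≡⟨ ≡.cong₂ ℚ._+_ (ℚₚ.*-identityˡ q) (ℚₚ.*-identityˡ q) ⟩
  q ℚ.+ q                      ≡⟨ cong (q ℚ.+_) e ⟩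
  q ℚ.+ ℚ.- q                  ≡⟨ ℚₚ.+-inverseʳ q ⟩
  0ℚ                           ∎)
  where open ≡.≡-Reasoning

signℕ≢0 : ∀ m → signℕ m ≢ 0ℚ
signℕ≢0 m with (m % 2) ℕ.≡ᵇ 0
... | true  = λ ()
... | false = λ ()

repeated-zero : ∀ {n} {L : Word n → ℚ} → Alt ℚ⁺ L → ∀ {w} → ¬ Unique w → L w ≡ 0ℚ
repeated-zero {L = L} alt {w} ¬u with v , w′ , p ← repeated _≟ᵥ_ w ¬u =
  Alternating.perm₀ ℚ⁺ L alt p (self-neg⇒0 (alt [] v v w′))

good-setOf : ∀ {n} {w : Word n} → Unique w → Good w (setOf w)
good-setOf u = u , λ _ → refl

-- Splits off the terms of f whose words rearrange w. The weight is the same for all alternating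
-- functionals, so it can be read off from a coefficient functional and then used for any other.
record Collected {n} (w : Word n) (f : Λ n) : Set where
  field
    weight    : ℚ
    remainder     : Λ n
    shorter  : length remainder ≤ length f
    avoids   : coeff remainder (setOf w) ≡ 0ℚ
    collects : ∀ {L} → Alt ℚ⁺ L → extend L f ≡ weight ℚ.* L w ℚ.+ extend L remainder

open Collected

collect : ∀ {n} {w : Word n} → Unique w → ∀ f → Collected w f
collect {w = w} u [] = record
  { weight = 0ℚ ; remainder = [] ; shorter = z≤n ; avoids = refl
  ; collects = λ {L} _ → ≡.sym (≡.trans (ℚₚ.+-identityʳ _) (ℚₚ.*-zeroˡ (L w))) }
collect {w = w} u ((q , w′) ∷ f) with C ← collect u f with good? w′ (setOf w)
... | no ¬g = record
  { weight = weight C ; remainder = (q , w′) ∷ remainder C ; shorter = s≤s (shorter C)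
  ; avoids = ≡.trans (≡.cong₂ ℚ._+_ (≡.trans (cong (q ℚ.*_) (wordCoeff-bad ¬g)) (ℚₚ.*-zeroʳ q)) (avoids C)) (ℚₚ.+-identityˡ 0ℚ)
  ; collects = λ {L} alt → ≡.trans (cong (q ℚ.* L w′ ℚ.+_) (collects C alt))
      (x∙yz≈y∙xz (q ℚ.* L w′) (weight C ℚ.* L w) (extend L (remainder C))) }
  where open import Algebra.Properties.CommutativeSemigroup (AbelianGroup.commutativeSemigroup ℚ⁺)
... | yes (u′ , h) = record
  { weight = q ℚ.* sgnℚ (parity p) ℚ.+ weight C ; remainder = remainder C ; shorter = ℕₚ.m≤n⇒m≤1+n (shorter C)
  ; avoids = avoids C
  ; collects = λ {L} alt → begin
      q ℚ.* L w′ ℚ.+ extend L f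
        ≡⟨ ≡.cong₂ ℚ._+_ (cong (q ℚ.*_) (≡.trans (Alternating.perm-sign ℚ⁺ L alt p []) (±-sgnℚ (parity p) (L w)))) (collects C alt) ⟩
      q ℚ.* (sgnℚ (parity p) ℚ.* L w) ℚ.+ (weight C ℚ.* L w ℚ.+ extend L (remainder C))
        ≡⟨ ℚₚ.+-assoc (q ℚ.* (sgnℚ (parity p) ℚ.* L w)) (weight C ℚ.* L w) (extend L (remainder C)) ⟨
      (q ℚ.* (sgnℚ (parity p) ℚ.* L w) ℚ.+ weight C ℚ.* L w) ℚ.+ extend L (remainder C)
        ≡⟨ cong (λ x → (x ℚ.+ weight C ℚ.* L w) ℚ.+ extend L (remainder C)) (ℚₚ.*-assoc q (sgnℚ (parity p)) (L w)) ⟨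
      ((q ℚ.* sgnℚ (parity p)) ℚ.* L w ℚ.+ weight C ℚ.* L w) ℚ.+ extend L (remainder C)
        ≡⟨ cong (ℚ._+ extend L (remainder C)) (ℚₚ.*-distribʳ-+ (L w) (q ℚ.* sgnℚ (parity p)) (weight C)) ⟨
      (q ℚ.* sgnℚ (parity p) ℚ.+ weight C) ℚ.* L w ℚ.+ extend L (remainder C) ∎ }
  where
  open ≡.≡-Reasoning
  p : w′ ↭ w
  p = unique∧set⇒↭ u′ u (λ {v} i → memb⇒∈ w (≡.trans (h v) (∈⇒memb i)))
                        (λ {v} i → memb⇒∈ w′ (≡.trans (≡.sym (h v)) (∈⇒memb i)))

-- Induction on the number of terms. The coefficient at the set of the leading word is its collected
-- weight up to sign; it is zero by hypothesis, so all rearrangements of that word drop out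
-- together. Hence alternating functionals respect `≃`.
extend-zero : ∀ {n} {L : Word n → ℚ} → Alt ℚ⁺ L → ∀ {f} → (∀ S → coeff f S ≡ 0ℚ) → extend L f ≡ 0ℚ
extend-zero {L = L} alt {f} z = go (length f) f ℕₚ.≤-refl z
  where
  open ≡.≡-Reasoning
  go : ∀ k f → length f ≤ k → (∀ S → coeff f S ≡ 0ℚ) → extend L f ≡ 0ℚ
  go k       []            _       z = refl
  go (suc k) ((q , w) ∷ f) (s≤s h) z with unique? _≟ᵥ_ w
  ... | no ¬u = ≡.trans (drop-head L (repeated-zero alt ¬u)) (go k f h λ S →
          ≡.trans (≡.sym (drop-head (λ w → wordCoeff w S) (repeated-zero (wordCoeff-alt S) ¬u))) (z S))
    where
    drop-head : ∀ (M : Word _ → ℚ) → M w ≡ 0ℚ → q ℚ.* M w ℚ.+ extend M f ≡ extend M f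
    drop-head M e = ≡.trans (cong (λ x → q ℚ.* x ℚ.+ extend M f) e)
      (≡.trans (cong (ℚ._+ extend M f) (ℚₚ.*-zeroʳ q)) (ℚₚ.+-identityˡ (extend M f)))
  ... | yes u = ≡.trans (reduced alt) (go k (remainder C) (ℕₚ.≤-trans (shorter C) h) λ S →
          ≡.trans (≡.sym (reduced (wordCoeff-alt S))) (z S))
    where
    C = collect u f
    gathered : ∀ {M} → Alt ℚ⁺ M → extend M ((q , w) ∷ f) ≡ (q ℚ.+ weight C) ℚ.* M w ℚ.+ extend M (remainder C)
    gathered {M} a = begin
      q ℚ.* M w ℚ.+ extend M f                                     ≡⟨ cong (q ℚ.* M w ℚ.+_) (collects C a) ⟩
      q ℚ.* M w ℚ.+ (weight C ℚ.* M w ℚ.+ extend M (remainder C))        ≡⟨ ℚₚ.+-assoc (q ℚ.* M w) (weight C ℚ.* M w) (extend M (remainder C)) ⟨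
      (q ℚ.* M w ℚ.+ weight C ℚ.* M w) ℚ.+ extend M (remainder C)        ≡⟨ cong (ℚ._+ extend M (remainder C)) (ℚₚ.*-distribʳ-+ (M w) q (weight C)) ⟨
      (q ℚ.+ weight C) ℚ.* M w ℚ.+ extend M (remainder C)                ∎
    weight₀ : q ℚ.+ weight C ≡ 0ℚ
    weight₀ = cancel₀ (signℕ≢0 (inversions w)) (begin
      signℕ (inversions w) ℚ.* (q ℚ.+ weight C)                                    ≡⟨ ℚₚ.*-comm (signℕ (inversions w)) _ ⟩
      (q ℚ.+ weight C) ℚ.* signℕ (inversions w)                                    ≡⟨ cong ((q ℚ.+ weight C) ℚ.*_) (wordCoeff-good (good-setOf u)) ⟨
      (q ℚ.+ weight C) ℚ.* wordCoeff w (setOf w)                                   ≡⟨ ℚₚ.+-identityʳ _ ⟨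
      (q ℚ.+ weight C) ℚ.* wordCoeff w (setOf w) ℚ.+ 0ℚ                            ≡⟨ cong ((q ℚ.+ weight C) ℚ.* wordCoeff w (setOf w) ℚ.+_) (avoids C) ⟨
      (q ℚ.+ weight C) ℚ.* wordCoeff w (setOf w) ℚ.+ coeff (remainder C) (setOf w)      ≡⟨ gathered (wordCoeff-alt (setOf w)) ⟨
      coeff ((q , w) ∷ f) (setOf w)                                               ≡⟨ z (setOf w) ⟩
      0ℚ                                                                          ∎)
    reduced : ∀ {M} → Alt ℚ⁺ M → extend M ((q , w) ∷ f) ≡ extend M (remainder C)
    reduced {M} a = ≡.trans (gathered a) (≡.trans (cong (λ x → x ℚ.* M w ℚ.+ extend M (remainder C)) weight₀)
      (≡.trans (cong (ℚ._+ extend M (remainder C)) (ℚₚ.*-zeroˡ (M w))) (ℚₚ.+-identityˡ _)))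

extend-⊖ : ∀ {n} (L : Word n → ℚ) f g → extend L (f ⊖ g) ≡ extend L f ℚ.+ ℚ.- extend L g
extend-⊖ L f g = ≡.trans (extend-++ L f _) (cong (extend L f ℚ.+_)
  (≡.trans (extend-· L (ℚ.- 1ℚ) g) (≡.sym (±-sgnℚ true (extend L g)))))

extend-cong : ∀ {n} {L : Word n → ℚ} → Alt ℚ⁺ L → ∀ {f g} → f ≃ g → extend L f ≡ extend L g
extend-cong {L = L} alt {f} {g} e = ℚ⁺ₚ.x∙y⁻¹≈ε⇒x≈y (extend L f) (extend L g) (≡.trans (≡.sym (extend-⊖ L f g)) (extend-zero alt {f ⊖ g} (λ S →
  ≡.trans (extend-⊖ (λ w → wordCoeff w S) f g) (≡.trans (cong (ℚ._+ ℚ.- coeff g S) (e S)) (ℚₚ.+-inverseʳ (coeff g S))))))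

-- Subgroups and quotients

module _ (V : AbelianGroup 0ℓ 0ℓ) where

  open AbelianGroup V renaming (refl to ≈-refl; sym to ≈-sym; trans to ≈-trans)
  open import Algebra.Properties.AbelianGroup V
  open import Algebra.Properties.CommutativeSemigroup commutativeSemigroup using (interchange)

  record Subgroup (P : Carrier → Set) : Set where
    field
      resp : ∀ {x y} → x ≈ y → P x → P y
      P-ε  : P ε
      P-∙  : ∀ {x y} → P x → P y → P (x ∙ y)
      P-⁻¹ : ∀ {x} → P x → P (x ⁻¹)

  quotient : ∀ {P} → Subgroup P → AbelianGroup 0ℓ 0ℓ
  quotient {P} sub = record
    { Carrier = Carrier ; _≈_ = _~_ ; _∙_ = _∙_ ; ε = ε ; _⁻¹ = _⁻¹
    ; isAbelianGroup = record
      { isGroup = record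
        { isMonoid = record
          { isSemigroup = record
            { isMagma = record
              { isEquivalence = record { refl = ≈⇒~ ≈-refl ; sym = ~-sym ; trans = ~-trans }
              ; ∙-cong = λ {x} {y} {u} {v} a b → resp (≈-trans (interchange x (y ⁻¹) u (v ⁻¹)) (∙-congˡ (⁻¹-∙-comm y v))) (P-∙ a b) }
            ; assoc = λ x y z → ≈⇒~ (assoc x y z) }
          ; identity = (λ x → ≈⇒~ (identityˡ x)) , (λ x → ≈⇒~ (identityʳ x)) }
        ; inverse = (λ x → ≈⇒~ (inverseˡ x)) , (λ x → ≈⇒~ (inverseʳ x))
        ; ⁻¹-cong = λ {x} {y} a → resp (≈-sym (⁻¹-∙-comm x (y ⁻¹))) (P-⁻¹ a) }
      ; comm = λ x y → ≈⇒~ (comm x y) } }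
    where
    open Subgroup sub
    _~_ : Carrier → Carrier → Set
    x ~ y = P (x ∙ y ⁻¹)
    ≈⇒~ : ∀ {x y} → x ≈ y → x ~ y
    ≈⇒~ e = resp (≈-sym (x≈y⇒x∙y⁻¹≈ε e)) P-ε
    ~-sym : ∀ {x y} → x ~ y → y ~ x
    ~-sym {x} {y} a = resp (⁻¹-anti-homo‿- x y) (P-⁻¹ a)
    ~-trans : ∀ {x y z} → x ~ y → y ~ z → x ~ z
    ~-trans {x} {y} {z} a b = resp (≈-trans (assoc x (y ⁻¹) _) (∙-congˡ (≈-trans (≈-sym (assoc _ y _))
      (≈-trans (∙-congʳ (inverseˡ y)) (identityˡ _))))) (P-∙ a b)

record Additive (V W : AbelianGroup 0ℓ 0ℓ) (H : AbelianGroup.Carrier V → AbelianGroup.Carrier W) : Set where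
  private
    module V = AbelianGroup V
    module W = AbelianGroup W
    module Wₚ = Algebra.Properties.AbelianGroup W
    module ΣV = Sums V
    module ΣW = Sums W
  field
    H-cong : ∀ {x y} → x V.≈ y → H x W.≈ H y
    H-∙    : ∀ x y → H (x V.∙ y) W.≈ H x W.∙ H y

  H-ε : H V.ε W.≈ W.ε
  H-ε = Wₚ.∙-cancelˡ (H V.ε) (H V.ε) W.ε (W.trans (W.sym (H-∙ V.ε V.ε)) (W.trans (H-cong (V.identityˡ V.ε)) (W.sym (W.identityʳ _))))

  H-⁻¹ : ∀ x → H (x V.⁻¹) W.≈ H x W.⁻¹
  H-⁻¹ x = Wₚ.inverseˡ-unique _ _ (W.trans (W.sym (H-∙ _ _)) (W.trans (H-cong (V.inverseˡ x)) H-ε))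

  H-Σ : ∀ {A : Set} (l : List A) f → H (ΣV.Σl l f) W.≈ ΣW.Σl l (H ∘ f)
  H-Σ []      f = H-ε
  H-Σ (x ∷ l) f = W.trans (H-∙ _ _) (W.∙-congˡ (H-Σ l f))

  H-× : ∀ k x → H (Mult._×_ V.monoid k x) W.≈ Mult._×_ W.monoid k (H x)
  H-× zero    x = H-ε
  H-× (suc k) x = W.trans (H-∙ _ _) (W.∙-congˡ (H-× k x))

-- Antisymmetrisers

tr-conj : ∀ {n} (i j k l x : Fin n) → tr i j (tr k l x) ≡ tr (tr i j k) (tr i j l) (tr i j x)
tr-conj i j k l x with x Finₚ.≟ k
... | yes refl = ≡.sym (tr-l (tr i j x) (tr i j l))
... | no a with x Finₚ.≟ l
...   | yes refl = ≡.sym (tr-r (tr i j k) (tr i j x))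
...   | no b = ≡.sym (tr-≢ (a ∘ tr-injective i j) (b ∘ tr-injective i j))

tr-sym : ∀ {n} (i j x : Fin n) → tr i j x ≡ tr j i x
tr-sym i j x = cases (x Finₚ.≟ i) (x Finₚ.≟ j)
  where
  cases : Dec (x ≡ i) → Dec (x ≡ j) → tr i j x ≡ tr j i x
  cases (yes refl) _          = ≡.trans (tr-l i j) (≡.sym (tr-r j i))
  cases (no _)     (yes refl) = ≡.trans (tr-r i j) (≡.sym (tr-l j i))
  cases (no a)     (no b)     = ≡.trans (tr-≢ a b) (≡.sym (tr-≢ b a))

-- The factorial of the length, in the shape in which the factors `X` scale antisymmetric values.
factor : ∀ {A : Set} → List A → ℕ
factor []       = 1
factor (k ∷ ks) = suc (length ks) ℕ.* factor ks

-- The antisymmetriser is a product of factors X k ks = 1 - Σᵢ (i k), which avoids enumerating the symmetric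
-- group. In the order of A it is antisymmetric on the right, in the order of B on the left.
record TranspositionAction {n} (V : AbelianGroup 0ℓ 0ℓ) : Set where
  open AbelianGroup V using (Carrier; _≈_)
  field
    t        : Fin n → Fin n → Carrier → Carrier
    additive : ∀ i j → Additive V V (t i j)
    t-sym    : ∀ i j x → t i j x ≈ t j i x
    t-inv    : ∀ i j x → t i j (t i j x) ≈ x
    t-conj   : ∀ i j k l x → t i j (t k l x) ≈ t (tr i j k) (tr i j l) (t i j x)

module Antisymmetriser {n : ℕ} (V : AbelianGroup 0ℓ 0ℓ) (action : TranspositionAction {n} V) where

  open AbelianGroup V renaming (refl to ≈-refl; sym to ≈-sym; trans to ≈-trans)
  open TranspositionAction action
  open Sums V
  open import Algebra.Properties.AbelianGroup V
  open import Relation.Binary.Reasoning.Setoid setoid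
  open Additive

  X : Fin n → List (Fin n) → Carrier → Carrier
  X k ks x = x ∙ Σl ks (λ i → t i k x) ⁻¹

  A : List (Fin n) → Carrier → Carrier
  A []       x = x
  A (k ∷ ks) x = A ks (X k ks x)

  B : List (Fin n) → Carrier → Carrier
  B []       x = x
  B (k ∷ ks) x = X k ks (B ks x)

  X-additive : ∀ k ks → Additive V V (X k ks)
  X-additive k ks = record
    { H-cong = λ e → ∙-cong e (⁻¹-cong (Σ-cong ks (λ i _ → H-cong (additive i k) e)))
    ; H-∙ = λ x y → ≈-trans (∙-congˡ (≈-trans (⁻¹-cong (≈-trans (Σ-cong ks (λ i _ → H-∙ (additive i k) x y)) (Σ-∙ ks _ _)))
        (≈-sym (⁻¹-∙-comm _ _)))) (interchange _ _ _ _) }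
    where open import Algebra.Properties.CommutativeSemigroup commutativeSemigroup using (interchange)

  A-additive : ∀ ks → Additive V V (A ks)
  A-additive []       = record { H-cong = λ e → e ; H-∙ = λ _ _ → ≈-refl }
  A-additive (k ∷ ks) = record
    { H-cong = λ e → H-cong (A-additive ks) (H-cong (X-additive k ks) e)
    ; H-∙ = λ x y → ≈-trans (H-cong (A-additive ks) (H-∙ (X-additive k ks) x y)) (H-∙ (A-additive ks) _ _) }

  private
    shuffle : ∀ a b s → b ∙ (a ∙ s ⁻¹) ⁻¹ ≈ (a ∙ (b ∙ s) ⁻¹) ⁻¹
    shuffle a b s = begin
      b ∙ (a ∙ s ⁻¹) ⁻¹        ≈⟨ ∙-congˡ (⁻¹-∙-comm a (s ⁻¹)) ⟨
      b ∙ (a ⁻¹ ∙ (s ⁻¹) ⁻¹)   ≈⟨ ∙-congˡ (∙-congˡ (⁻¹-involutive s)) ⟩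
      b ∙ (a ⁻¹ ∙ s)           ≈⟨ assoc _ _ _ ⟨
      (b ∙ a ⁻¹) ∙ s           ≈⟨ ∙-congʳ (comm b (a ⁻¹)) ⟩
      (a ⁻¹ ∙ b) ∙ s           ≈⟨ assoc _ _ _ ⟩
      a ⁻¹ ∙ (b ∙ s)           ≈⟨ ∙-congˡ (⁻¹-involutive (b ∙ s)) ⟨
      a ⁻¹ ∙ ((b ∙ s) ⁻¹) ⁻¹   ≈⟨ ⁻¹-∙-comm _ _ ⟩
      _                        ∎

    t-≡ : ∀ {i j i′ j′} x → i ≡ i′ → j ≡ j′ → t i j x ≈ t i′ j′ x
    t-≡ x refl refl = ≈-refl

  -- Conjugation by the transposition of i and j fixes k and permutes `ks`, hence it permutes the
  -- summands of `X k ks`.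
  X-commute : ∀ {k ks i j} → Unique (k ∷ ks) → i ∈ ks → j ∈ ks → ∀ x → t i j (X k ks x) ≈ X k ks (t i j x)
  X-commute {k} {ks} {i} {j} (a ∷ u) i∈ j∈ x = begin
    t i j (X k ks x)                                          ≈⟨ H-∙ 𝒯 _ _ ⟩
    t i j x ∙ t i j (Σl ks (λ l → t l k x) ⁻¹)                ≈⟨ ∙-congˡ (≈-trans (H-⁻¹ 𝒯 _) (⁻¹-cong (H-Σ 𝒯 ks _))) ⟩
    t i j x ∙ Σl ks (λ l → t i j (t l k x)) ⁻¹                ≈⟨ ∙-congˡ (⁻¹-cong (Σ-cong ks (λ l _ →
        ≈-trans (t-conj i j l k x) (t-≡ _ refl (tr-≢ (λ { refl → All≢⇒∉ a i∈ }) (λ { refl → All≢⇒∉ a j∈ })))))) ⟩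
    t i j x ∙ Σl ks (λ l → t (tr i j l) k (t i j x)) ⁻¹       ≡⟨ cong (λ s → t i j x ∙ s ⁻¹) (Σ-map ks (tr i j) (λ l → t l k (t i j x))) ⟨
    t i j x ∙ Σl (map (tr i j) ks) (λ l → t l k (t i j x)) ⁻¹ ≈⟨ ∙-congˡ (⁻¹-cong (Σ-↭ _ permuted)) ⟩
    X k ks (t i j x)                                          ∎
    where
    𝒯 = additive i j
    stays : ∀ {v} → v ∈ ks → tr i j v ∈ ks
    stays {v} v∈ with v Finₚ.≟ i
    ... | yes _ = j∈
    ... | no _ with v Finₚ.≟ j
    ...   | yes _ = i∈
    ...   | no _ = v∈
    permuted : map (tr i j) ks ↭ ks
    permuted = unique∧set⇒↭ (Uniqueₚ.map⁺ (tr-injective i j) u) u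
      (λ v∈ → let w , w∈ , e = ∈-map⁻ (tr i j) v∈ in subst (_∈ ks) (≡.sym e) (stays w∈))
      (λ {v} v∈ → subst (_∈ map (tr i j) ks) (tr-involutive i j v) (∈-map⁺ (tr i j) (stays v∈)))
      where open import Data.List.Membership.Propositional.Properties using (∈-map⁺; ∈-map⁻)

  -- Transpositions within the tail pass through `X` to the inner antisymmetriser; those that
  -- involve the head are left to `A-anti₀`.
  A-anti : ∀ {ks} → Unique ks → ∀ {i j} → i ≢ j → i ∈ ks → j ∈ ks → ∀ x → A ks (t i j x) ≈ A ks x ⁻¹
  private
    -- Composing with the transposition of i and k exchanges the identity with the summand i of `X`.
    -- Every other summand l acquires by conjugation a transposition of i and l on its left, which
    -- `A ks` turns into a sign.
    A-anti₀ : ∀ {k ks i} → Unique (k ∷ ks) → i ∈ ks → ∀ x → A (k ∷ ks) (t i k x) ≈ A (k ∷ ks) x ⁻¹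
  A-anti (a ∷ u) d (here refl) (here refl) x = ⊥-elim (d refl)
  A-anti {k ∷ ks} (a ∷ u) {i} d (there i∈) (here refl) x = A-anti₀ (a ∷ u) i∈ x
  A-anti {k ∷ ks} (a ∷ u) {_} {j} d (here refl) (there j∈) x =
    ≈-trans (H-cong (A-additive (k ∷ ks)) (t-sym k j x)) (A-anti₀ (a ∷ u) j∈ x)
  A-anti {k ∷ ks} (a ∷ u) d (there i∈) (there j∈) x =
    ≈-trans (H-cong (A-additive ks) (≈-sym (X-commute (a ∷ u) i∈ j∈ x))) (A-anti u d i∈ j∈ _)

  A-anti₀ {k} {ks} {i} (k∉ ∷ u) i∈ x with rest , π ← extract i∈
    with i∉ ∷ _ ← Unique-resp-↭ π u = begin
    A ks (X k ks (t i k x))                                            ≈⟨ H-∙ 𝒜 _ _ ⟩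
    A ks (t i k x) ∙ A ks (Σl ks (λ l → t l k (t i k x)) ⁻¹)           ≈⟨ ∙-congˡ (sumOf (t i k x)) ⟩
    A ks (t i k x) ∙ (A ks (t i k (t i k x)) ∙ Σl rest (λ l → A ks (t l k (t i k x)))) ⁻¹
      ≈⟨ ∙-congˡ (⁻¹-cong (∙-cong (H-cong 𝒜 (t-inv i k x)) (≈-trans (Σ-cong rest term) (Σ-⁻¹ rest _)))) ⟩
    A ks (t i k x) ∙ (A ks x ∙ Σl rest (λ l → A ks (t l k x)) ⁻¹) ⁻¹   ≈⟨ shuffle _ _ _ ⟩
    (A ks x ∙ (A ks (t i k x) ∙ Σl rest (λ l → A ks (t l k x))) ⁻¹) ⁻¹ ≈⟨ ⁻¹-cong (∙-congˡ (sumOf x)) ⟨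
    (A ks x ∙ A ks (Σl ks (λ l → t l k x) ⁻¹)) ⁻¹                      ≈⟨ ⁻¹-cong (H-∙ 𝒜 _ _) ⟨
    A ks (X k ks x) ⁻¹                                                 ∎
    where
    𝒜 = A-additive ks
    sumOf : ∀ y → A ks (Σl ks (λ l → t l k y) ⁻¹) ≈ (A ks (t i k y) ∙ Σl rest (λ l → A ks (t l k y))) ⁻¹
    sumOf y = ≈-trans (H-⁻¹ 𝒜 _) (⁻¹-cong (≈-trans (H-Σ 𝒜 ks _) (Σ-↭ _ π)))
    term : ∀ l → l ∈ rest → A ks (t l k (t i k x)) ≈ A ks (t l k x) ⁻¹
    term l l∈ = ≈-trans (H-cong 𝒜 (≈-trans (t-conj l k i k x)
        (t-≡ _ (tr-≢ (λ { refl → All≢⇒∉ i∉ l∈ }) (λ { refl → All≢⇒∉ k∉ i∈ })) (tr-r l k))))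
      (A-anti u (λ { refl → All≢⇒∉ i∉ l∈ }) i∈ (↭ₚ.∈-resp-↭ (↭-sym π) (there l∈)) _)

  B-anti : ∀ {ks} → Unique ks → ∀ {i j} → i ≢ j → i ∈ ks → j ∈ ks → ∀ x → t i j (B ks x) ≈ B ks x ⁻¹
  private
    -- Mirror image of `A-anti₀`: conjugation puts the transposition of i and l directly in front of
    -- `B ks x`, which it negates.
    B-anti₀ : ∀ {k ks i} → Unique (k ∷ ks) → i ∈ ks → ∀ x → t i k (B (k ∷ ks) x) ≈ B (k ∷ ks) x ⁻¹
  B-anti (a ∷ u) d (here refl) (here refl) x = ⊥-elim (d refl)
  B-anti {k ∷ ks} (a ∷ u) {i} d (there i∈) (here refl) x = B-anti₀ (a ∷ u) i∈ x
  B-anti {k ∷ ks} (a ∷ u) {_} {j} d (here refl) (there j∈) x = ≈-trans (t-sym k j _) (B-anti₀ (a ∷ u) j∈ x)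
  B-anti {k ∷ ks} (a ∷ u) d (there i∈) (there j∈) x =
    ≈-trans (X-commute (a ∷ u) i∈ j∈ _) (≈-trans (H-cong (X-additive k ks) (B-anti u d i∈ j∈ x)) (H-⁻¹ (X-additive k ks) _))

  B-anti₀ {k} {ks} {i} (k∉ ∷ u) i∈ x with rest , π ← extract i∈
    with i∉ ∷ _ ← Unique-resp-↭ π u = begin
    t i k (X k ks y)                                                     ≈⟨ H-∙ 𝒯 _ _ ⟩
    t i k y ∙ t i k (Σl ks (λ l → t l k y) ⁻¹)                           ≈⟨ ∙-congˡ (≈-trans (H-⁻¹ 𝒯 _) (⁻¹-cong (≈-trans (H-Σ 𝒯 ks _) (Σ-↭ _ π)))) ⟩
    t i k y ∙ (t i k (t i k y) ∙ Σl rest (λ l → t i k (t l k y))) ⁻¹     ≈⟨ ∙-congˡ (⁻¹-cong (∙-cong (t-inv i k y) (≈-trans (Σ-cong rest term) (Σ-⁻¹ rest _)))) ⟩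
    t i k y ∙ (y ∙ Σl rest (λ l → t l k y) ⁻¹) ⁻¹                        ≈⟨ shuffle _ _ _ ⟩
    (y ∙ (t i k y ∙ Σl rest (λ l → t l k y)) ⁻¹) ⁻¹                      ≈⟨ ⁻¹-cong (∙-congˡ (⁻¹-cong (Σ-↭ _ π))) ⟨
    X k ks y ⁻¹                                                          ∎
    where
    𝒯 = additive i k
    y = B ks x
    term : ∀ l → l ∈ rest → t i k (t l k y) ≈ t l k y ⁻¹
    term l l∈ = begin
      t i k (t l k y)  ≈⟨ t-≡ _ (tr-≢ (λ { refl → All≢⇒∉ i∉ l∈ }) (λ { refl → All≢⇒∉ k∉ i∈ })) (tr-l l k) ⟨
      _                ≈⟨ t-conj l k i l y ⟨
      t l k (t i l y)  ≈⟨ H-cong (additive l k) (B-anti u (λ { refl → All≢⇒∉ i∉ l∈ }) i∈ (↭ₚ.∈-resp-↭ (↭-sym π) (there l∈)) x) ⟩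
      t l k (y ⁻¹)     ≈⟨ H-⁻¹ (additive l k) y ⟩
      t l k y ⁻¹       ∎

  module _ (W : AbelianGroup 0ℓ 0ℓ) {H : Carrier → AbelianGroup.Carrier W} (hom : Additive V W H) where

    private
      module W = AbelianGroup W
      module ΣW = Sums W
      module Wₚ = Algebra.Properties.AbelianGroup W

    open Mult W.monoid renaming (_×_ to _·ʷ_)

    -- Each transposition in `X` is subtracted and has the value - H x, so it adds one more H x.
    X-scales : ∀ k ks x → (∀ i → i ∈ ks → H (t i k x) W.≈ H x W.⁻¹) → H (X k ks x) W.≈ suc (length ks) ·ʷ H x
    X-scales k ks x h = W.trans (H-∙ hom _ _) (W.∙-congˡ (W.trans (H-⁻¹ hom _) (W.trans (W.⁻¹-cong (H-Σ hom ks _)) (go ks h))))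
      where
      go : ∀ ks → (∀ i → i ∈ ks → H (t i k x) W.≈ H x W.⁻¹) → ΣW.Σl ks (λ i → H (t i k x)) W.⁻¹ W.≈ length ks ·ʷ H x
      go []       h = Wₚ.ε⁻¹≈ε
      go (l ∷ ks) h = W.trans (W.sym (Wₚ.⁻¹-∙-comm _ _)) (W.∙-cong
        (W.trans (W.⁻¹-cong (h l (here refl))) (Wₚ.⁻¹-involutive _)) (go ks (λ i p → h i (there p))))

    B-scales : (∀ i j → i ≢ j → ∀ x → H (t i j x) W.≈ H x W.⁻¹) → ∀ {ks} → Unique ks → ∀ x → H (B ks x) W.≈ factor ks ·ʷ H x
    B-scales h []                  x = W.sym (×-homo-1 (H x))
    B-scales h {k ∷ ks} (a ∷ u) x = W.trans (X-scales k ks (B ks x) (λ i i∈ → h i k (λ { refl → All≢⇒∉ a i∈ }) _))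
      (W.trans (×-congʳ (suc (length ks)) (B-scales h u x)) (×-assocˡ (H x) (suc (length ks)) (factor ks)))

  open Mult monoid renaming (_×_ to _·ᵥ_)

  idAdditive : Additive V V id
  idAdditive = record { H-cong = id ; H-∙ = λ _ _ → ≈-refl }

  -- Meant for Λ/I: there a sign class is antisymmetric, although its representative in Λ need not
  -- be.
  A-scales : ∀ {y} → (∀ i j → i ≢ j → t i j y ≈ y ⁻¹) → ∀ {ks} → Unique ks → A ks y ≈ factor ks ·ᵥ y
  A-scales {y} h []                = ≈-sym (×-homo-1 y)
  A-scales {y} h {k ∷ ks} (a ∷ u) = begin
    A ks (X k ks y)                       ≈⟨ H-cong (A-additive ks) (X-scales V idAdditive k ks y (λ i i∈ → h i k (λ { refl → All≢⇒∉ a i∈ }))) ⟩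
    A ks (suc (length ks) ·ᵥ y)           ≈⟨ H-× (A-additive ks) (suc (length ks)) y ⟩
    suc (length ks) ·ᵥ A ks y             ≈⟨ ×-congʳ (suc (length ks)) (A-scales h u) ⟩
    suc (length ks) ·ᵥ (factor ks ·ᵥ y)   ≈⟨ ×-assocˡ y (suc (length ks)) (factor ks) ⟩
    _                                     ∎

-- The vector space Λ modulo ≃ and the ideal I

ΛGroup : ℕ → AbelianGroup 0ℓ 0ℓ
ΛGroup n = record
  { Carrier = Λ n ; _≈_ = _≃_ ; _∙_ = _⊕_ ; ε = [] ; _⁻¹ = (ℚ.- 1ℚ) ·_
  ; isAbelianGroup = record
    { isGroup = record
      { isMonoid = record
        { isSemigroup = record
          { isMagma = record
            { isEquivalence = record { refl = λ S → refl ; sym = λ e S → ≡.sym (e S) ; trans = λ e f S → ≡.trans (e S) (f S) }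
            ; ∙-cong = λ {f} {f′} {g} {g′} a b S → ≡.trans (extend-++ (W S) f g)
                (≡.trans (≡.cong₂ ℚ._+_ (a S) (b S)) (≡.sym (extend-++ (W S) f′ g′))) }
          ; assoc = λ f g h S → cong (λ x → coeff x S) (Listₚ.++-assoc f g h) }
        ; identity = (λ f S → refl) , (λ f S → cong (λ x → coeff x S) (Listₚ.++-identityʳ f)) }
      ; inverse = (λ f S → ≡.trans (extend-++ (W S) ((ℚ.- 1ℚ) · f) f) (≡.trans (cong (ℚ._+ coeff f S) (neg f S)) (ℚₚ.+-inverseˡ (coeff f S))))
                , (λ f S → ≡.trans (extend-⊖ (W S) f f) (ℚₚ.+-inverseʳ (coeff f S)))
      ; ⁻¹-cong = λ {f} {g} e S → ≡.trans (neg f S) (≡.trans (cong ℚ.-_ (e S)) (≡.sym (neg g S))) }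
    ; comm = λ f g S → ≡.trans (extend-++ (W S) f g) (≡.trans (ℚₚ.+-comm (coeff f S) (coeff g S)) (≡.sym (extend-++ (W S) g f))) } }
  where
  W : Subset n → Word n → ℚ
  W S w = wordCoeff w S
  neg : ∀ f S → coeff ((ℚ.- 1ℚ) · f) S ≡ ℚ.- coeff f S
  neg f S = ≡.trans (extend-· (W S) (ℚ.- 1ℚ) f) (≡.sym (±-sgnℚ true (coeff f S)))

map-alt : ∀ {A B : Set} {L : List B → ℚ} (h : A → B) → Alt ℚ⁺ L → Alt ℚ⁺ (L ∘ map h)
map-alt {L = L} h alt u x y v = ≡.trans (cong L (Listₚ.map-++ h u (x ∷ y ∷ v)))
  (≡.trans (alt (map h u) (h x) (h y) (map h v)) (cong (ℚ.-_ ∘ L) (≡.sym (Listₚ.map-++ h u (y ∷ x ∷ v)))))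

module _ {n : ℕ} where

  ≡⇒≃ : ∀ {f g : Λ n} → f ≡ g → f ≃ g
  ≡⇒≃ refl S = refl

  ·-cong : ∀ q {f g : Λ n} → f ≃ g → (q · f) ≃ (q · g)
  ·-cong q {f} {g} e S = ≡.trans (extend-· (λ w → wordCoeff w S) q f)
    (≡.trans (cong (q ℚ.*_) (e S)) (≡.sym (extend-· (λ w → wordCoeff w S) q g)))

  ·-⊕ : ∀ q (f g : Λ n) → q · (f ⊕ g) ≡ (q · f) ⊕ (q · g)
  ·-⊕ q f g = Listₚ.map-++ _ f g

  ·-· : ∀ p q (f : Λ n) → p · (q · f) ≡ (p ℚ.* q) · f
  ·-· p q []            = refl
  ·-· p q ((r , w) ∷ f) = ≡.cong₂ _∷_ (cong (_, w) (≡.sym (ℚₚ.*-assoc p q r))) (·-· p q f)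

  1· : ∀ (f : Λ n) → 1ℚ · f ≡ f
  1· []            = refl
  1· ((r , w) ∷ f) = ≡.cong₂ _∷_ (cong (_, w) (ℚₚ.*-identityˡ r)) (1· f)

  +· : ∀ p q (f : Λ n) → ((p ℚ.+ q) · f) ≃ ((p · f) ⊕ (q · f))
  +· p q f S = ≡.trans (extend-· W (p ℚ.+ q) f) (≡.trans (ℚₚ.*-distribʳ-+ (coeff f S) p q)
    (≡.trans (≡.cong₂ ℚ._+_ (≡.sym (extend-· W p f)) (≡.sym (extend-· W q f))) (≡.sym (extend-++ W (p · f) (q · f)))))
    where W = λ w → wordCoeff w S

  0·≃[] : ∀ (f : Λ n) → (0ℚ · f) ≃ []
  0·≃[] f S = ≡.trans (extend-· (λ w → wordCoeff w S) 0ℚ f) (ℚₚ.*-zeroˡ (coeff f S))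

  ⊗-act : ∀ (σ : Permutation′ n) f g → act σ (f ⊗ g) ≡ act σ f ⊗ act σ g
  ⊗-act σ []            g = refl
  ⊗-act σ ((q , w) ∷ f) g = ≡.trans (Listₚ.map-++ _ (map _ g) (f ⊗ g)) (≡.cong₂ _++_ (row g) (⊗-act σ f g))
    where
    row : ∀ g → act σ (map (λ t → q ℚ.* proj₁ t , w ++ proj₂ t) g) ≡
                map (λ t → q ℚ.* proj₁ t , relabel (σ ⟨$⟩ʳ_) w ++ proj₂ t) (act σ g)
    row []            = refl
    row ((p , v) ∷ g) = ≡.cong₂ _∷_ (cong (_ ,_) (Listₚ.map-++ _ w v)) (row g)

  ⊗-· : ∀ r f (g : Λ n) → r · (f ⊗ g) ≡ (r · f) ⊗ g
  ⊗-· r []            g = refl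
  ⊗-· r ((q , w) ∷ f) g = ≡.trans (Listₚ.map-++ _ (map _ g) (f ⊗ g)) (≡.cong₂ _++_ (row g) (⊗-· r f g))
    where
    row : ∀ g → r · map (λ t → q ℚ.* proj₁ t , w ++ proj₂ t) g ≡
                map (λ t → (r ℚ.* q) ℚ.* proj₁ t , w ++ proj₂ t) g
    row []            = refl
    row ((p , v) ∷ g) = ≡.cong₂ _∷_ (cong (_, (w ++ v)) (≡.sym (ℚₚ.*-assoc r q p))) (row g)

  extend-act : ∀ (L : Word n → ℚ) σ f → extend L (act σ f) ≡ extend (L ∘ relabel (σ ⟨$⟩ʳ_)) f
  extend-act L σ []            = refl
  extend-act L σ ((q , w) ∷ f) = cong (q ℚ.* L (relabel (σ ⟨$⟩ʳ_) w) ℚ.+_) (extend-act L σ f)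

  -- A coefficient of the relabelled element is an alternating functional of the original one.
  act-cong : ∀ (σ : Permutation′ n) {f g} → f ≃ g → act σ f ≃ act σ g
  act-cong σ {f} {g} e S = ≡.trans (extend-act W σ f) (≡.trans
    (extend-cong (map-alt {L = W} _ (wordCoeff-alt S)) {f} {g} e) (≡.sym (extend-act W σ g)))
    where W = λ w → wordCoeff w S

  act-⊕ : ∀ (σ : Permutation′ n) f g → act σ (f ⊕ g) ≡ act σ f ⊕ act σ g
  act-⊕ σ f g = Listₚ.map-++ _ f g

  act-· : ∀ (σ : Permutation′ n) q f → act σ (q · f) ≡ q · act σ f
  act-· σ q []      = refl
  act-· σ q (t ∷ f) = cong (_ ∷_) (act-· σ q f)

  relabel-ext : ∀ {φ ψ : Fin n → Fin n} → (∀ i → φ i ≡ ψ i) → ∀ w → relabel φ w ≡ relabel ψ w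
  relabel-ext e = Listₚ.map-cong (λ v → cong (proj₁ v ,_) (e (proj₂ v)))

  act-ext : ∀ {σ τ : Permutation′ n} → (∀ i → σ ⟨$⟩ʳ i ≡ τ ⟨$⟩ʳ i) → ∀ f → act σ f ≡ act τ f
  act-ext e = Listₚ.map-cong (λ t → cong (proj₁ t ,_) (relabel-ext e (proj₂ t)))

  act-∘ : ∀ (σ τ : Permutation′ n) f → act σ (act τ f) ≡ act (τ ∘ₚ σ) f
  act-∘ σ τ []            = refl
  act-∘ σ τ ((q , w) ∷ f) = ≡.cong₂ _∷_ (cong (q ,_) (≡.sym (Listₚ.map-∘ w))) (act-∘ σ τ f)

  combination : List (Λ n × Λ n) → Λ n
  combination = foldr (λ p acc → (proj₁ p ⊗ proj₂ p) ⊕ acc) []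

  combination-++ : ∀ gh gh′ → combination (gh ++ gh′) ≡ combination gh ⊕ combination gh′
  combination-++ []             gh′ = refl
  combination-++ ((g , h) ∷ gh) gh′ = ≡.trans (cong ((g ⊗ h) ⊕_) (combination-++ gh gh′)) (≡.sym (Listₚ.++-assoc (g ⊗ h) _ _))

  InI-resp : ∀ {f g : Λ n} → f ≃ g → InI f → InI g
  InI-resp e (gh , inv , c) = gh , inv , λ S → ≡.trans (≡.sym (e S)) (c S)

  InI-[] : InI {n} []
  InI-[] = [] , [] , λ S → refl

  InI-⊕ : ∀ {f g : Λ n} → InI f → InI g → InI (f ⊕ g)
  InI-⊕ {f} {g} (gh , inv , c) (gh′ , inv′ , c′) = gh ++ gh′ , Allₚ.++⁺ inv inv′ ,
    λ S → ≡.trans (AbelianGroup.∙-cong (ΛGroup n) {f} {combination gh} {g} {combination gh′} c c′ S)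
            (≡⇒≃ (≡.sym (combination-++ gh gh′)) S)

  InI-· : ∀ q {f : Λ n} → InI f → InI (q · f)
  InI-· q {f} (gh , inv , c) = map (λ p → (q · proj₁ p) , proj₂ p) gh , Allₚ.map⁺ inv ,
    λ S → ≡.trans (·-cong q {f} {combination gh} c S) (≡⇒≃ (scaled gh) S)
    where
    scaled : ∀ gh → q · combination gh ≡ combination (map (λ p → (q · proj₁ p) , proj₂ p) gh)
    scaled []             = refl
    scaled ((g , h) ∷ gh) = ≡.trans (·-⊕ q (g ⊗ h) _) (≡.cong₂ _⊕_ (⊗-· q g h) (scaled gh))

  act-invariant : ∀ (σ : Permutation′ n) {h} → InvariantNoConst h → InvariantNoConst (act σ h)
  act-invariant σ {h} (inv , c) =
    (λ τ S → ≡.trans (≡⇒≃ (act-∘ τ σ h) S) (≡.trans (inv (σ ∘ₚ τ) S) (≡.sym (inv σ S)))) ,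
    ≡.trans (inv σ emptySet) c

  InI-act : ∀ (σ : Permutation′ n) {f} → InI f → InI (act σ f)
  InI-act σ {f} (gh , inv , c) = map acts gh , Allₚ.map⁺ (All.map (λ {p} → act-invariant σ {proj₂ p}) inv) ,
    λ S → ≡.trans (act-cong σ {f} {combination gh} c S) (≡⇒≃ (moved gh) S)
    where
    acts : Λ n × Λ n → Λ n × Λ n
    acts p = act σ (proj₁ p) , act σ (proj₂ p)
    moved : ∀ gh → act σ (combination gh) ≡ combination (map acts gh)
    moved []             = refl
    moved ((g , h) ∷ gh) = ≡.trans (act-⊕ σ (g ⊗ h) _) (≡.cong₂ _⊕_ (⊗-act σ g h) (moved gh))

  ideal-subgroup : Subgroup (ΛGroup n) InI
  ideal-subgroup = record { resp = λ {f} {g} → InI-resp {f} {g} ; P-ε = InI-[]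
                          ; P-∙ = λ {f} {g} → InI-⊕ {f} {g} ; P-⁻¹ = λ {f} → InI-· (ℚ.- 1ℚ) {f} }

  word : Word n → Λ n
  word w = (1ℚ , w) ∷ []

  powerSum : List (Fin 3) → Λ n
  powerSum S = map (λ i → 1ℚ , block S i) (allFin n)

  extend-↭ : ∀ (L : Word n → ℚ) {f g} → f ↭ g → extend L f ≡ extend L g
  extend-↭ L _↭_.refl = refl
  extend-↭ L (prep (q , w) p) = cong (q ℚ.* L w ℚ.+_) (extend-↭ L p)
  extend-↭ L (swap (q , w) (r , v) p) = ≡.trans (x∙yz≈y∙xz (q ℚ.* L w) (r ℚ.* L v) _)
      (cong (λ x → r ℚ.* L v ℚ.+ (q ℚ.* L w ℚ.+ x)) (extend-↭ L p))
    where open import Algebra.Properties.CommutativeSemigroup (AbelianGroup.commutativeSemigroup ℚ⁺)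
  extend-↭ L (trans p q) = ≡.trans (extend-↭ L p) (extend-↭ L q)

  σ-injective : ∀ (σ : Permutation′ n) {i j} → σ ⟨$⟩ʳ i ≡ σ ⟨$⟩ʳ j → i ≡ j
  σ-injective σ e = ≡.trans (≡.sym (Perm.inverseˡ σ)) (≡.trans (cong (σ ⟨$⟩ˡ_) e) (Perm.inverseˡ σ))

  permute-allFin : ∀ (σ : Permutation′ n) → map (σ ⟨$⟩ʳ_) (allFin n) ↭ allFin n
  permute-allFin σ = ↭-sym (Unique⇒allFin↭ (Uniqueₚ.map⁺ (σ-injective σ) (Uniqueₚ.allFin⁺ n))
    (≡.trans (Listₚ.length-map (σ ⟨$⟩ʳ_) (allFin n)) length-allFin))

  relabel-block : ∀ (φ : Fin n → Fin n) S i → relabel φ (block S i) ≡ block S (φ i)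
  relabel-block φ []      i = refl
  relabel-block φ (k ∷ S) i = cong (_ ∷_) (relabel-block φ S i)

  powerSum-invariant : ∀ p S → InvariantNoConst (powerSum (p ∷ S))
  powerSum-invariant p S = inv , const (allFin n)
    where
    inv : Invariant (powerSum (p ∷ S))
    inv σ T = ≡.trans (cong (λ x → coeff x T) eq) (extend-↭ (λ w → wordCoeff w T) (↭ₚ.map⁺ _ (permute-allFin σ)))
      where
      eq : act σ (powerSum (p ∷ S)) ≡ map (λ i → 1ℚ , block (p ∷ S) i) (map (σ ⟨$⟩ʳ_) (allFin n))
      eq = ≡.trans (≡.sym (Listₚ.map-∘ (allFin n))) (≡.trans
        (Listₚ.map-cong (λ i → cong (1ℚ ,_) (relabel-block (σ ⟨$⟩ʳ_) (p ∷ S) i)) (allFin n)) (Listₚ.map-∘ (allFin n)))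
    const : ∀ l → coeff (map (λ i → 1ℚ , block (p ∷ S) i) l) emptySet ≡ 0ℚ
    const []      = refl
    const (i ∷ l) = ≡.trans (≡.cong₂ ℚ._+_ (cong (1ℚ ℚ.*_) (wordCoeff-bad {w = block (p ∷ S) i} {emptySet}
      λ (_ , h) → case ≡.trans (h (p , i)) (∈⇒memb {v = p , i} {block (p ∷ S) i} (here refl)) of λ ())) (const l)) refl

  powerSum-ideal : ∀ p S w → InI (word w ⊗ powerSum (p ∷ S))
  powerSum-ideal p S w = (word w , powerSum (p ∷ S)) ∷ [] , powerSum-invariant p S ∷ [] ,
    ≡⇒≃ (≡.sym (Listₚ.++-identityʳ (word w ⊗ powerSum (p ∷ S))))

-- Signs of permutations

parity-map⁺ : ∀ {A B : Set} (f : A → B) {xs ys : List A} (p : xs ↭ ys) → parity (↭ₚ.map⁺ f p) ≡ parity p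
parity-map⁺ f _↭_.refl     = refl
parity-map⁺ f (prep x p)   = parity-map⁺ f p
parity-map⁺ f (swap x y p) = cong not (parity-map⁺ f p)
parity-map⁺ f (trans p q)  = ≡.cong₂ _xor_ (parity-map⁺ f p) (parity-map⁺ f q)

module _ {n : ℕ} where

  -- With i and j moved to the front, relabelling is one adjacent swap; the move costs the same sign
  -- before and after relabelling.
  transpose-alt : ∀ {L : List (Fin n) → ℚ} → Alt ℚ⁺ L → ∀ {i j} → i ≢ j → ∀ {l rest} → l ↭ i ∷ j ∷ rest →
                  i ∉ rest → j ∉ rest → L (map (tr i j) l) ≡ ℚ.- L l
  transpose-alt {L} alt {i} {j} d {l} {rest} p i∉ j∉ = begin
    L (map (tr i j) l)                                     ≡⟨ perm-sign (↭ₚ.map⁺ (tr i j) p) [] ⟩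
    (± parity (↭ₚ.map⁺ (tr i j) p)) (L (map (tr i j) (i ∷ j ∷ rest)))
      ≡⟨ ≡.cong₂ (λ b x → (± b) (L x)) (parity-map⁺ (tr i j) p)
           (≡.cong₂ _∷_ (tr-l i j) (≡.cong₂ _∷_ (tr-r i j) (fixed rest i∉ j∉))) ⟩
    (± parity p) (L (j ∷ i ∷ rest))                        ≡⟨ cong (± parity p) (alt [] j i rest) ⟩
    (± parity p) (ℚ.- L (i ∷ j ∷ rest))                    ≡⟨ ±-⁻¹ (parity p) _ ⟩
    ℚ.- (± parity p) (L (i ∷ j ∷ rest))                    ≡⟨ cong ℚ.-_ (perm-sign p []) ⟨
    ℚ.- L l                                                ∎
    where
    open ≡.≡-Reasoning
    open Alternating ℚ⁺ L alt
    open Signs ℚ⁺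
    fixed : ∀ rest → i ∉ rest → j ∉ rest → map (tr i j) rest ≡ rest
    fixed []      _ _ = refl
    fixed (x ∷ l) a b = ≡.cong₂ _∷_ (tr-≢ (λ e → a (here (≡.sym e))) (λ e → b (here (≡.sym e)))) (fixed l (a ∘ there) (b ∘ there))

  inverted? : (φ : Fin n → Fin n) → (p : Fin n × Fin n) →
              Dec (Fin.toℕ (proj₁ p) < Fin.toℕ (proj₂ p) × Fin.toℕ (φ (proj₂ p)) < Fin.toℕ (φ (proj₁ p)))
  inverted? φ p = (Fin.toℕ (proj₁ p) ℕ.<? Fin.toℕ (proj₂ p)) ×-dec (Fin.toℕ (φ (proj₂ p)) ℕ.<? Fin.toℕ (φ (proj₁ p)))

  θ : Fin n → Var n
  θ i = 0F , i

  count-inversions : ∀ φ l → AllPairs (λ i j → Fin.toℕ i < Fin.toℕ j) l →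
    length (filter (inverted? φ) (cartesianProduct l l)) ≡ inversions (map θ (map φ l))
  count-inversions φ l sorted = go [] l sorted (λ _ _ ())
    where
    row : ∀ x ys → length (filter (inverted? φ) (map (x ,_) ys)) ≡ length (filter (λ y → inverted? φ (x , y)) ys)
    row x []       = refl
    row x (y ∷ ys) with does (inverted? φ (x , y))
    ... | true  = cong suc (row x ys)
    ... | false = row x ys

    above : ∀ x ys → All (λ y → Fin.toℕ x < Fin.toℕ y) ys →
            length (filter (λ y → inverted? φ (x , y)) ys) ≡ below (θ (φ x)) (map θ (map φ ys))
    above x []       []       = refl
    above x (y ∷ ys) (p ∷ ps) with Fin.toℕ (φ y) ℕ.<? Fin.toℕ (φ x)
    ... | yes q = ≡.trans (cong length (Listₚ.filter-accept (λ y → inverted? φ (x , y)) (p , q)))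
                    (≡.trans (cong suc (above x ys ps)) (≡.sym (below-< {x = θ (φ x)} {θ (φ y)} (map θ (map φ ys)) q)))
    ... | no ¬q = ≡.trans (cong length (Listₚ.filter-reject (λ y → inverted? φ (x , y)) (¬q ∘ proj₂)))
                    (≡.trans (above x ys ps) (≡.sym (below-≮ {x = θ (φ x)} {θ (φ y)} (map θ (map φ ys)) ¬q)))

    -- Every row of the product runs over the whole list, so the processed entries `pre` are kept:
    -- they are never above a later entry and contribute no inverted pair.
    go : ∀ pre xs → AllPairs (λ i j → Fin.toℕ i < Fin.toℕ j) xs →
         (∀ x → x ∈ xs → ∀ {y} → y ∈ pre → ¬ Fin.toℕ x < Fin.toℕ y) →
         length (filter (inverted? φ) (cartesianProduct xs (pre ++ xs))) ≡ inversions (map θ (map φ xs))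
    go pre []       _        h = refl
    go pre (x ∷ xs) (a ∷ as) h = begin
      length (filter (inverted? φ) (map (x ,_) ys ++ cartesianProduct xs ys))
        ≡⟨ cong length (Listₚ.filter-++ (inverted? φ) (map (x ,_) ys) _) ⟩
      length (filter (inverted? φ) (map (x ,_) ys) ++ filter (inverted? φ) (cartesianProduct xs ys))
        ≡⟨ Listₚ.length-++ (filter (inverted? φ) (map (x ,_) ys)) ⟩
      length (filter (inverted? φ) (map (x ,_) ys)) ℕ.+ length (filter (inverted? φ) (cartesianProduct xs ys))
        ≡⟨ ≡.cong₂ ℕ._+_ (≡.trans (row x ys) here-row)
             (≡.trans (cong (λ l → length (filter (inverted? φ) (cartesianProduct xs l))) (≡.sym (Listₚ.++-assoc pre (x ∷ []) xs)))
               (go (pre ++ x ∷ []) xs as later)) ⟩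
      below (θ (φ x)) (map θ (map φ xs)) ℕ.+ inversions (map θ (map φ xs)) ∎
      where
      open ≡.≡-Reasoning
      ys = pre ++ x ∷ xs
      here-row : length (filter (λ y → inverted? φ (x , y)) ys) ≡ below (θ (φ x)) (map θ (map φ xs))
      here-row = begin
        length (filter (λ y → inverted? φ (x , y)) (pre ++ x ∷ xs))
          ≡⟨ cong length (Listₚ.filter-++ (λ y → inverted? φ (x , y)) pre (x ∷ xs)) ⟩
        length (filter (λ y → inverted? φ (x , y)) pre ++ filter (λ y → inverted? φ (x , y)) (x ∷ xs))
          ≡⟨ cong (λ l → length (l ++ filter (λ y → inverted? φ (x , y)) (x ∷ xs)))
               (Listₚ.filter-none (λ y → inverted? φ (x , y)) (All.tabulate (λ y∈ → h x (here refl) y∈ ∘ proj₁))) ⟩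
        length (filter (λ y → inverted? φ (x , y)) (x ∷ xs))
          ≡⟨ cong length (Listₚ.filter-reject (λ y → inverted? φ (x , y)) (ℕₚ.<-irrefl refl ∘ proj₁)) ⟩
        length (filter (λ y → inverted? φ (x , y)) xs)
          ≡⟨ above x xs a ⟩
        below (θ (φ x)) (map θ (map φ xs)) ∎
      later : ∀ z → z ∈ xs → ∀ {y} → y ∈ pre ++ x ∷ [] → ¬ Fin.toℕ z < Fin.toℕ y
      later z z∈ y∈ with ∈-++⁻ pre y∈
      ... | inj₁ y∈pre       = h z (there z∈) y∈pre
      ... | inj₂ (here refl) = ℕₚ.<-asym (All.lookup a z∈)

  allθ : Subset n
  allθ = setOf (map θ (allFin n))

  θ-injective : ∀ {i j} → θ i ≡ θ j → i ≡ j
  θ-injective refl = refl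

  -- Reads the sign as the coefficient of the product of all θ in a permuted word, so that its
  -- behaviour under transpositions follows from alternation.
  sgn-wordCoeff : ∀ (σ : Permutation′ n) → sgn σ ≡ wordCoeff (map θ (map (σ ⟨$⟩ʳ_) (allFin n))) allθ
  sgn-wordCoeff σ = ≡.trans (cong signℕ (count-inversions (σ ⟨$⟩ʳ_) (allFin n) (tabulate⁺-< id)))
    (≡.sym (wordCoeff-good (Uniqueₚ.map⁺ θ-injective (Uniqueₚ.map⁺ (σ-injective σ) (Uniqueₚ.allFin⁺ n)) ,
      λ v → memb-↭ v (↭ₚ.map⁺ θ (↭-sym (permute-allFin σ))))))

  sgn-ext : ∀ {σ τ : Permutation′ n} → (∀ i → σ ⟨$⟩ʳ i ≡ τ ⟨$⟩ʳ i) → sgn σ ≡ sgn τ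
  sgn-ext {σ} {τ} e = ≡.trans (sgn-wordCoeff σ) (≡.trans
    (cong (λ l → wordCoeff (map θ l) allθ) (Listₚ.map-cong e (allFin n))) (≡.sym (sgn-wordCoeff τ)))

  sgn-transpose-∘ : ∀ {i j} → i ≢ j → ∀ (ρ : Permutation′ n) → sgn (transpose i j ∘ₚ ρ) ≡ ℚ.- sgn ρ
  sgn-transpose-∘ {i} {j} d ρ with rest , p , out ← splitFin₂ d = begin
    sgn (transpose i j ∘ₚ ρ)                                                        ≡⟨ sgn-wordCoeff (transpose i j ∘ₚ ρ) ⟩
    wordCoeff (map θ (map (λ k → ρ ⟨$⟩ʳ tr i j k) (allFin n))) allθ                 ≡⟨ cong (λ l → wordCoeff (map θ l) allθ) (Listₚ.map-∘ (allFin n)) ⟩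
    wordCoeff (map θ (map (ρ ⟨$⟩ʳ_) (map (tr i j) (allFin n)))) allθ
      ≡⟨ transpose-alt {λ l → wordCoeff (map θ (map (ρ ⟨$⟩ʳ_) l)) allθ}
           (map-alt {L = λ l → wordCoeff (map θ l) allθ} (ρ ⟨$⟩ʳ_) (map-alt {L = λ w → wordCoeff w allθ} θ (wordCoeff-alt allθ))) d p
           (λ i∈ → proj₁ (out i i∈) refl) (λ j∈ → proj₂ (out j j∈) refl) ⟩
    ℚ.- wordCoeff (map θ (map (ρ ⟨$⟩ʳ_) (allFin n))) allθ                           ≡⟨ cong ℚ.-_ (sgn-wordCoeff ρ) ⟨
    ℚ.- sgn ρ ∎
    where open ≡.≡-Reasoning

  sgn-id : sgn (Perm.id {n}) ≡ 1ℚ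
  sgn-id = cong (signℕ ∘ length) (Listₚ.filter-none (inverted? id)
    (All.universal (λ p (a , b) → ℕₚ.<-asym a b) (cartesianProduct (allFin n) (allFin n))))

  sgn-transpose : ∀ {i j} → i ≢ j → sgn (transpose {n} i j) ≡ ℚ.- 1ℚ
  sgn-transpose {i} {j} d = ≡.trans (sgn-ext {transpose i j} {transpose i j ∘ₚ Perm.id} (λ _ → refl))
    (≡.trans (sgn-transpose-∘ d Perm.id) (cong ℚ.-_ sgn-id))

  tr-refl : ∀ (i k : Fin n) → tr i i k ≡ k
  tr-refl i k = cases (k Finₚ.≟ i)
    where
    cases : Dec (k ≡ i) → tr i i k ≡ k
    cases (yes refl) = tr-l i i
    cases (no a)     = tr-≢ a a

  act-id : ∀ (f : Λ n) → act Perm.id f ≡ f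
  act-id []            = refl
  act-id ((q , w) ∷ f) = ≡.cong₂ _∷_ (cong (q ,_) (Listₚ.map-id w)) (act-id f)

  -- Induction along a decomposition into transpositions; the decomposition may list a transposition
  -- of an index with itself, which acts as the identity.
  antisymmetric⇒sgn : ∀ (f : Λ n) → (∀ i j → i ≢ j → act (transpose i j) f ≃ ((ℚ.- 1ℚ) · f)) →
                      ∀ σ → act σ f ≃ (sgn σ · f)
  antisymmetric⇒sgn f h σ S = ≡.trans (≡⇒≃ (act-ext {σ = σ} {eval (decompose σ)} (≡.sym ∘ eval-decompose σ) f) S)
    (≡.trans (go (decompose σ) S) (≡⇒≃ (cong (_· f) (sgn-ext {eval (decompose σ)} {σ} (eval-decompose σ))) S))
    where
    go : ∀ xs → act (eval xs) f ≃ (sgn (eval xs) · f)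
    go [] S = ≡⇒≃ (≡.trans (act-id f) (≡.trans (≡.sym (1· f)) (cong (_· f) (≡.sym sgn-id)))) S
    go ((i , j) ∷ xs) S with i Finₚ.≟ j
    ... | yes refl = ≡.trans (≡⇒≃ (act-ext {σ = transpose i i ∘ₚ eval xs} {eval xs} same f) S)
                       (≡.trans (go xs S) (≡⇒≃ (cong (_· f) (≡.sym (sgn-ext {transpose i i ∘ₚ eval xs} {eval xs} same))) S))
      where
      same : ∀ k → eval xs ⟨$⟩ʳ tr i i k ≡ eval xs ⟨$⟩ʳ k
      same k = cong (eval xs ⟨$⟩ʳ_) (tr-refl i k)
    ... | no d = begin
      coeff (act (transpose i j ∘ₚ eval xs) f) S       ≡⟨ ≡⇒≃ (act-∘ (eval xs) (transpose i j) f) S ⟨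
      coeff (act (eval xs) (act (transpose i j) f)) S  ≡⟨ act-cong (eval xs) {act (transpose i j) f} {(ℚ.- 1ℚ) · f} (h i j d) S ⟩
      coeff (act (eval xs) ((ℚ.- 1ℚ) · f)) S           ≡⟨ ≡⇒≃ (act-· (eval xs) (ℚ.- 1ℚ) f) S ⟩
      coeff ((ℚ.- 1ℚ) · act (eval xs) f) S             ≡⟨ ·-cong (ℚ.- 1ℚ) {act (eval xs) f} {sgn (eval xs) · f} (go xs) S ⟩
      coeff ((ℚ.- 1ℚ) · (sgn (eval xs) · f)) S         ≡⟨ ≡⇒≃ (·-· (ℚ.- 1ℚ) (sgn (eval xs)) f) S ⟩
      coeff (((ℚ.- 1ℚ) ℚ.* sgn (eval xs)) · f) S
        ≡⟨ ≡⇒≃ (cong (_· f) (≡.trans (≡.sym (±-sgnℚ true (sgn (eval xs)))) (≡.sym (sgn-transpose-∘ d (eval xs))))) S ⟩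
      coeff (sgn (transpose i j ∘ₚ eval xs) · f) S     ∎
      where open ≡.≡-Reasoning

-- Contraction of alternating functions

open Sums ℚ⁺ using () renaming (Σl to Σℚ; Σ-cong to Σℚ-cong; Σ-ε to Σℚ-0; Σ-∙ to Σℚ-+; Σ-⁻¹ to Σℚ-neg; Σ-↭ to Σℚ-↭; Σ-map to Σℚ-map)

⟦_⟧ : ∀ {P : Set} → Dec P → ℚ
⟦ d ⟧ = if does d then 1ℚ else 0ℚ

⟦⟧-yes : ∀ {P : Set} (d : Dec P) → P → ⟦ d ⟧ ≡ 1ℚ
⟦⟧-yes d p rewrite dec-true d p = refl

⟦⟧-no : ∀ {P : Set} (d : Dec P) → ¬ P → ⟦ d ⟧ ≡ 0ℚ
⟦⟧-no d p rewrite dec-false d p = refl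

⟦⟧-⇔ : ∀ {P Q : Set} (d : Dec P) (e : Dec Q) → (P → Q) → (Q → P) → ⟦ d ⟧ ≡ ⟦ e ⟧
⟦⟧-⇔ (yes p) e f g = ≡.sym (⟦⟧-yes e (f p))
⟦⟧-⇔ (no ¬p) e f g = ≡.sym (⟦⟧-no e (¬p ∘ g))

Σℚ-* : ∀ {A : Set} (l : List A) q f → Σℚ l (λ i → q ℚ.* f i) ≡ q ℚ.* Σℚ l f
Σℚ-* []      q f = ≡.sym (ℚₚ.*-zeroʳ q)
Σℚ-* (x ∷ l) q f = ≡.trans (cong (q ℚ.* f x ℚ.+_) (Σℚ-* l q f)) (≡.sym (ℚₚ.*-distribˡ-+ q (f x) (Σℚ l f)))

Σℚ-swap : ∀ {A B : Set} (l : List A) (m : List B) (f : A → B → ℚ) →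
          Σℚ l (λ i → Σℚ m (f i)) ≡ Σℚ m (λ j → Σℚ l (λ i → f i j))
Σℚ-swap []      m f = ≡.sym (Σℚ-0 m (λ _ _ → refl))
Σℚ-swap (x ∷ l) m f = ≡.trans (cong (Σℚ m (f x) ℚ.+_) (Σℚ-swap l m f)) (≡.sym (Σℚ-+ m (f x) _))

kronecker : ∀ {n} (l : Fin n) (f : Fin n → ℚ) → Σℚ (allFin n) (λ i → ⟦ l Finₚ.≟ i ⟧ ℚ.* f i) ≡ f l
kronecker {n} l f with rest , ρ ← complementFin {l = l ∷ []} ([] ∷ []) = ≡.trans (Σℚ-↭ _ ρ)
  (≡.trans (≡.cong₂ ℚ._+_ (≡.trans (cong (ℚ._* f l) (⟦⟧-yes (l Finₚ.≟ l) refl)) (ℚₚ.*-identityˡ (f l)))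
    (Σℚ-0 rest (λ i i∈ → ≡.trans (cong (ℚ._* f i) (⟦⟧-no (l Finₚ.≟ i) (avoid i i∈))) (ℚₚ.*-zeroˡ (f i)))))
    (ℚₚ.+-identityʳ (f l)))
  where
  avoid : ∀ i → i ∈ rest → l ≢ i
  avoid i i∈ refl with a ∷ _ ← Unique-resp-↭ ρ (Uniqueₚ.allFin⁺ n) = All≢⇒∉ a i∈

toℚ : ℕ → ℚ
toℚ zero    = 0ℚ
toℚ (suc k) = 1ℚ ℚ.+ toℚ k

Σ-alt : ∀ {A B : Set} (l : List A) {M : A → List B → ℚ} → (∀ i → Alt ℚ⁺ (M i)) → Alt ℚ⁺ (λ w → Σℚ l (λ i → M i w))
Σ-alt l {M} alt u x y w = ≡.trans (Σℚ-cong l (λ i _ → alt i u x y w)) (Σℚ-neg l _)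

*-alt : ∀ {B : Set} q {M : List B → ℚ} → Alt ℚ⁺ M → Alt ℚ⁺ (λ w → q ℚ.* M w)
*-alt q {M} alt u x y w = ≡.trans (cong (q ℚ.*_) (alt u x y w)) (≡.sym (ℚₚ.neg-distribʳ-* q (M (u ++ y ∷ x ∷ w))))

prefix-alt : ∀ {B : Set} (p : List B) {M : List B → ℚ} → Alt ℚ⁺ M → Alt ℚ⁺ (λ w → M (p ++ w))
prefix-alt p {M} alt u x y w = ≡.subst₂ (λ a b → M a ≡ ℚ.- M b) (Listₚ.++-assoc p u _) (Listₚ.++-assoc p u _) (alt (p ++ u) x y w)

indices-relabel : ∀ {n} (f : Fin n → Fin n) w → map proj₂ (relabel f w) ≡ map f (map proj₂ w)
indices-relabel f []      = refl
indices-relabel f (x ∷ w) = cong (_ ∷_) (indices-relabel f w)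

module _ {n : ℕ} where

  open import Data.List.Membership.DecPropositional (Finₚ._≟_ {n}) using () renaming (_∈?_ to _∈?ᶠ_)

  -- M composed with the odd derivation by v: each occurrence of v is deleted, with the sign of
  -- first moving it to the front.
  δ : Var n → (Word n → ℚ) → Word n → ℚ
  δ v M []      = 0ℚ
  δ v M (x ∷ w) = ⟦ x ≟ᵥ v ⟧ ℚ.* M w ℚ.+ ℚ.- δ v (λ u → M (x ∷ u)) w

  δ-cong : ∀ v {M M′ : Word n → ℚ} → (∀ u → M u ≡ M′ u) → ∀ w → δ v M w ≡ δ v M′ w
  δ-cong v e []      = refl
  δ-cong v e (x ∷ w) = ≡.cong₂ (λ a b → ⟦ x ≟ᵥ v ⟧ ℚ.* a ℚ.+ ℚ.- b) (e w) (δ-cong v (λ u → e (x ∷ u)) w)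

  δ-* : ∀ v q (M : Word n → ℚ) w → δ v (λ u → q ℚ.* M u) w ≡ q ℚ.* δ v M w
  δ-* v q M []      = ≡.sym (ℚₚ.*-zeroʳ q)
  δ-* v q M (x ∷ w) = ≡.trans (cong (λ y → ⟦ x ≟ᵥ v ⟧ ℚ.* (q ℚ.* M w) ℚ.+ ℚ.- y) (δ-* v q (λ u → M (x ∷ u)) w))
    (solve 4 (λ b q m d → b :* (q :* m) :+ :- (q :* d) := q :* (b :* m :+ :- d)) refl
      ⟦ x ≟ᵥ v ⟧ q (M w) (δ v (λ u → M (x ∷ u)) w))
    where open +-*-Solver using (solve; _:*_; _:+_; :-_; _:=_)

  δ-+ : ∀ v (M N : Word n → ℚ) w → δ v (λ u → M u ℚ.+ N u) w ≡ δ v M w ℚ.+ δ v N w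
  δ-+ v M N []      = refl
  δ-+ v M N (x ∷ w) = ≡.trans (cong (λ y → ⟦ x ≟ᵥ v ⟧ ℚ.* (M w ℚ.+ N w) ℚ.+ ℚ.- y) (δ-+ v (λ u → M (x ∷ u)) (λ u → N (x ∷ u)) w))
    (solve 5 (λ b m k d e → b :* (m :+ k) :+ :- (d :+ e) := (b :* m :+ :- d) :+ (b :* k :+ :- e)) refl
      ⟦ x ≟ᵥ v ⟧ (M w) (N w) (δ v (λ u → M (x ∷ u)) w) (δ v (λ u → N (x ∷ u)) w))
    where open +-*-Solver using (solve; _:*_; _:+_; :-_; _:=_)

  δ-neg : ∀ v (M : Word n → ℚ) w → δ v (λ u → ℚ.- M u) w ≡ ℚ.- δ v M w
  δ-neg v M []      = refl
  δ-neg v M (x ∷ w) = ≡.trans (cong (λ y → ⟦ x ≟ᵥ v ⟧ ℚ.* (ℚ.- M w) ℚ.+ ℚ.- y) (δ-neg v (λ u → M (x ∷ u)) w))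
    (solve 3 (λ b m d → b :* (:- m) :+ :- (:- d) := :- (b :* m :+ :- d)) refl ⟦ x ≟ᵥ v ⟧ (M w) (δ v (λ u → M (x ∷ u)) w))
    where open +-*-Solver using (solve; _:*_; _:+_; :-_; _:=_)

  δ-0 : ∀ v {M : Word n → ℚ} → (∀ u → M u ≡ 0ℚ) → ∀ w → δ v M w ≡ 0ℚ
  δ-0 v e []      = refl
  δ-0 v e (x ∷ w) = ≡.trans (≡.cong₂ (λ a b → ⟦ x ≟ᵥ v ⟧ ℚ.* a ℚ.+ ℚ.- b) (e w) (δ-0 v (λ u → e (x ∷ u)) w))
    (cong (ℚ._+ 0ℚ) (ℚₚ.*-zeroʳ ⟦ x ≟ᵥ v ⟧))

  δ-Σ : ∀ {A : Set} v (l : List A) (M : A → Word n → ℚ) w → δ v (λ u → Σℚ l (λ j → M j u)) w ≡ Σℚ l (λ j → δ v (M j) w)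
  δ-Σ v []      M w = δ-0 v (λ _ → refl) w
  δ-Σ v (j ∷ l) M w = ≡.trans (δ-+ v (M j) _ w) (cong (δ v (M j) w ℚ.+_) (δ-Σ v l M w))

  δ-alt : ∀ v {M : Word n → ℚ} → Alt ℚ⁺ M → Alt ℚ⁺ (δ v M)
  δ-alt v {M} alt [] x y w = ≡.trans
    (cong (λ d → a ℚ.* M (y ∷ w) ℚ.+ ℚ.- (b ℚ.* M (x ∷ w) ℚ.+ ℚ.- d))
      (≡.trans (δ-cong v (λ u → alt [] x y u) w) (δ-neg v (λ u → M (y ∷ x ∷ u)) w)))
    (solve 5 (λ a b m k d → a :* m :+ :- (b :* k :+ :- (:- d)) := :- (b :* k :+ :- (a :* m :+ :- d))) refl
      a b (M (y ∷ w)) (M (x ∷ w)) (δ v (λ u → M (y ∷ x ∷ u)) w))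
    where
    open +-*-Solver using (solve; _:*_; _:+_; :-_; _:=_)
    a = ⟦ x ≟ᵥ v ⟧
    b = ⟦ y ≟ᵥ v ⟧
  δ-alt v {M} alt (z ∷ u) x y w = ≡.trans
    (≡.cong₂ (λ a b → ⟦ z ≟ᵥ v ⟧ ℚ.* a ℚ.+ ℚ.- b) (alt u x y w) (δ-alt v {λ t → M (z ∷ t)} (λ u → alt (z ∷ u)) u x y w))
    (solve 3 (λ b m d → b :* (:- m) :+ :- (:- d) := :- (b :* m :+ :- d)) refl
      ⟦ z ≟ᵥ v ⟧ (M (u ++ y ∷ x ∷ w)) (δ v (λ t → M (z ∷ t)) (u ++ y ∷ x ∷ w)))
    where open +-*-Solver using (solve; _:*_; _:+_; :-_; _:=_)

  δ-relabel : ∀ i j k l M w → δ (k , l) M (relabel (tr i j) w) ≡ δ (k , tr i j l) (M ∘ relabel (tr i j)) w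
  δ-relabel i j k l M []            = refl
  δ-relabel i j k l M ((h , x) ∷ w) = ≡.cong₂ (λ a b → a ℚ.* M (relabel (tr i j) w) ℚ.+ ℚ.- b)
    (⟦⟧-⇔ ((h , tr i j x) ≟ᵥ (k , l)) ((h , x) ≟ᵥ (k , tr i j l))
      (λ { refl → cong (h ,_) (≡.sym (tr-involutive i j x)) }) (λ { refl → cong (h ,_) (tr-involutive i j l) }))
    (δ-relabel i j k l (λ u → M ((h , tr i j x) ∷ u)) w)

  δ-vanish : ∀ v v′ {M : Word n → ℚ} → (∀ u → v′ ∉ u → M u ≡ 0ℚ) → ∀ w → v′ ∉ w → δ v M w ≡ 0ℚ
  δ-vanish v v′ h []      _  = refl
  δ-vanish v v′ h (x ∷ w) v∉ = ≡.trans
    (≡.cong₂ (λ a b → ⟦ x ≟ᵥ v ⟧ ℚ.* a ℚ.+ ℚ.- b) (h w (v∉ ∘ there))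
      (δ-vanish v v′ (λ u u∉ → h (x ∷ u) (λ { (here e) → v∉ (here e) ; (there p) → u∉ p })) w (v∉ ∘ there)))
    (cong (ℚ._+ 0ℚ) (ℚₚ.*-zeroʳ ⟦ x ≟ᵥ v ⟧))

  δ-absent : ∀ v {M : Word n → ℚ} w → v ∉ w → δ v M w ≡ 0ℚ
  δ-absent v []      _  = refl
  δ-absent v {M} (x ∷ w) v∉ = ≡.trans
    (≡.cong₂ (λ a b → a ℚ.* M w ℚ.+ ℚ.- b) (⟦⟧-no (x ≟ᵥ v) (λ e → v∉ (here (≡.sym e)))) (δ-absent v w (v∉ ∘ there)))
    (cong (ℚ._+ 0ℚ) (ℚₚ.*-zeroˡ (M w)))

  δ-head : ∀ v {M : Word n → ℚ} w → v ∉ w → δ v M (v ∷ w) ≡ M w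
  δ-head v {M} w v∉ = ≡.trans
    (≡.cong₂ (λ a b → a ℚ.* M w ℚ.+ ℚ.- b) (⟦⟧-yes (v ≟ᵥ v) refl) (δ-absent v w v∉))
    (≡.trans (cong (ℚ._+ 0ℚ) (ℚₚ.*-identityˡ (M w))) (ℚₚ.+-identityʳ (M w)))

  -- The determinant of the indices: the sign of l if it arranges all indices, and 0 otherwise.
  top : List (Fin n) → ℚ
  top l = wordCoeff (map θ l) allθ

  top-alt : Alt ℚ⁺ top
  top-alt = map-alt {L = λ w → wordCoeff w allθ} θ (wordCoeff-alt allθ)

  top-missing : ∀ {i l} → i ∉ l → top l ≡ 0ℚ
  top-missing {i} {l} i∉ = wordCoeff-bad {w = map θ l} {allθ} λ (_ , h) →
    i∉ (back (memb⇒∈ {v = θ i} (map θ l) (≡.trans (≡.sym (h (θ i))) (∈⇒memb {v = θ i} (∈-map⁺ θ (∈-allFin i))))))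
    where
    back : θ i ∈ map θ l → i ∈ l
    back p with _ , q , refl ← ∈-map⁻ θ p = q

  top-repeated : ∀ {l} → ¬ Unique l → top l ≡ 0ℚ
  top-repeated {l} ¬u = wordCoeff-bad {w = map θ l} {allθ} λ (u , _) → ¬u (Uniqueₚ.map⁻ u)

  map-∉ : ∀ {i j k : Fin n} {l} → k ∉ l → tr i j k ∉ map (tr i j) l
  map-∉ {i} {j} {l = l} k∉ p with x , q , e ← ∈-map⁻ (tr i j) p = k∉ (subst (_∈ l) (≡.sym (tr-injective i j e)) q)

  -- This relabels values and not positions. If the list misses i or j or has a repetition, both
  -- sides are zero; otherwise `transpose-alt` applies.
  top-anti : ∀ {i j} → i ≢ j → ∀ l → top (map (tr i j) l) ≡ ℚ.- top l
  top-anti {i} {j} d l with unique? Finₚ._≟_ l | i ∈?ᶠ l | j ∈?ᶠ l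
  ... | no ¬u | _ | _ = ≡.trans (top-repeated (¬u ∘ Uniqueₚ.map⁻)) (cong ℚ.-_ (≡.sym (top-repeated ¬u)))
  ... | yes u | no i∉ | _ = ≡.trans (top-missing {j} (subst (_∉ map (tr i j) l) (tr-l i j) (map-∉ i∉))) (cong ℚ.-_ (≡.sym (top-missing i∉)))
  ... | yes u | yes _ | no j∉ = ≡.trans (top-missing {i} (subst (_∉ map (tr i j) l) (tr-r i j) (map-∉ j∉))) (cong ℚ.-_ (≡.sym (top-missing j∉)))
  ... | yes u | yes i∈ | yes j∈ with l₁ , π₁ ← extract i∈ with rest , π₂ ← extract (∈-tail (d ∘ ≡.sym) (↭ₚ.∈-resp-↭ π₁ j∈))
    with (_ ∷ a) ∷ b ∷ _ ← Unique-resp-↭ (↭-trans π₁ (prep i π₂)) u =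
    transpose-alt top-alt d (↭-trans π₁ (prep i π₂)) (All≢⇒∉ a) (All≢⇒∉ b)

  top-allFin : top (allFin n) ≡ 1ℚ
  top-allFin = ≡.trans (cong top (≡.sym (Listₚ.map-id (allFin n)))) (≡.trans (≡.sym (sgn-wordCoeff {n} Perm.id)) (sgn-id {n}))

  reindex : ∀ i j (f : Fin n → ℚ) → Σℚ (allFin n) (f ∘ tr i j) ≡ Σℚ (allFin n) f
  reindex i j f = ≡.trans (≡.sym (Σℚ-map (allFin n) (tr i j) f)) (Σℚ-↭ f (permute-allFin (transpose i j)))

  ψ : List (Fin n) → ℚ
  ψ l = Σℚ (allFin n) (λ j → top (j ∷ l))

  ψ-alt : Alt ℚ⁺ ψ
  ψ-alt = Σ-alt (allFin n) {λ j l → top (j ∷ l)} (λ j → prefix-alt (j ∷ []) {top} top-alt)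

  ψ-anti : ∀ {i j} → i ≢ j → ∀ l → ψ (map (tr i j) l) ≡ ℚ.- ψ l
  ψ-anti {i} {j} d l = begin
    Σℚ (allFin n) (λ k → top (k ∷ map (tr i j) l))             ≡⟨ reindex i j _ ⟨
    Σℚ (allFin n) (λ k → top (map (tr i j) (k ∷ l)))           ≡⟨ Σℚ-cong (allFin n) (λ k _ → top-anti d (k ∷ l)) ⟩
    Σℚ (allFin n) (λ k → ℚ.- top (k ∷ l))                      ≡⟨ Σℚ-neg (allFin n) _ ⟩
    ℚ.- ψ l                                                    ∎
    where open ≡.≡-Reasoning

  -- Written out, a double sum over j and the index supplied by `ψ`; `top` changes sign when the two
  -- are exchanged.
  Σψ : ∀ i l → Σℚ (allFin n) (λ j → ψ (i ∷ j ∷ l)) ≡ 0ℚ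
  Σψ i l = self-neg⇒0 (begin
    Σℚ (allFin n) (λ j → Σℚ (allFin n) (λ m → top (m ∷ i ∷ j ∷ l)))
      ≡⟨ Σℚ-cong (allFin n) (λ j _ → ≡.trans (Σℚ-cong (allFin n) (λ m _ → swaps-alt (0 ∷ 1 ∷ 0 ∷ []) (m ∷ i ∷ j ∷ l))) (Σℚ-neg (allFin n) _)) ⟩
    Σℚ (allFin n) (λ j → ℚ.- Σℚ (allFin n) (λ m → top (j ∷ i ∷ m ∷ l)))       ≡⟨ Σℚ-neg (allFin n) _ ⟩
    ℚ.- Σℚ (allFin n) (λ j → Σℚ (allFin n) (λ m → top (j ∷ i ∷ m ∷ l)))       ≡⟨ cong ℚ.-_ (Σℚ-swap (allFin n) (allFin n) (λ j m → top (j ∷ i ∷ m ∷ l))) ⟩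
    ℚ.- Σℚ (allFin n) (λ m → Σℚ (allFin n) (λ j → top (j ∷ i ∷ m ∷ l)))       ∎)
    where
    open ≡.≡-Reasoning
    open Alternating ℚ⁺ top top-alt

  ψₐ : Fin n → Word n → ℚ
  ψₐ i w = ψ (i ∷ map proj₂ w)

  ψₐ-alt : ∀ i → Alt ℚ⁺ (ψₐ i)
  ψₐ-alt i = map-alt {L = λ l → ψ (i ∷ l)} proj₂ (prefix-alt (i ∷ []) {ψ} ψ-alt)

  ψₐ-anti : ∀ {i j} → i ≢ j → ∀ k w → ψₐ k (relabel (tr i j) w) ≡ ℚ.- ψₐ (tr i j k) w
  ψₐ-anti {i} {j} d k w = ≡.trans (cong ψ (≡.cong₂ _∷_ (≡.sym (tr-involutive i j k)) (indices-relabel (tr i j) w))) (ψ-anti d (tr i j k ∷ map proj₂ w))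

  ⟦⟧-pair : ∀ k l b (i : Fin n) → ⟦ (k , l) ≟ᵥ (b , i) ⟧ ≡ ⟦ k Finₚ.≟ b ⟧ ℚ.* ⟦ l Finₚ.≟ i ⟧
  ⟦⟧-pair k l b i with k Finₚ.≟ b | l Finₚ.≟ i
  ... | yes refl | yes refl = refl
  ... | yes refl | no _     = refl
  ... | no _     | yes _    = refl
  ... | no _     | no _     = refl

  Σ-match : ∀ k l b (f : Fin n → ℚ) → Σℚ (allFin n) (λ i → ⟦ (k , l) ≟ᵥ (b , i) ⟧ ℚ.* f i) ≡ ⟦ k Finₚ.≟ b ⟧ ℚ.* f l
  Σ-match k l b f = ≡.trans (Σℚ-cong (allFin n) (λ i _ → ≡.trans (cong (ℚ._* f i) (⟦⟧-pair k l b i)) (ℚₚ.*-assoc ⟦ k Finₚ.≟ b ⟧ ⟦ l Finₚ.≟ i ⟧ (f i))))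
    (≡.trans (Σℚ-* (allFin n) ⟦ k Finₚ.≟ b ⟧ _) (cong (⟦ k Finₚ.≟ b ⟧ ℚ.*_) (kronecker l f)))

  -- An Euler identity. The sign of deleting a letter cancels the sign of having its index
  -- reinserted in front, so every letter of kind b yields the undisturbed value once.
  euler : ∀ b {M : List (Fin n) → ℚ} → Alt ℚ⁺ M → ∀ w →
    Σℚ (allFin n) (λ i → δ (b , i) (λ u → M (i ∷ map proj₂ u)) w) ≡ toℚ (count b w) ℚ.* M (map proj₂ w)
  euler b {M} alt []            = ≡.trans (Σℚ-0 (allFin n) (λ _ _ → refl)) (≡.sym (ℚₚ.*-zeroˡ (M [])))
  euler b {M} alt ((k , l) ∷ w) = begin
    Σℚ (allFin n) (λ i → ⟦ (k , l) ≟ᵥ (b , i) ⟧ ℚ.* M (i ∷ map proj₂ w) ℚ.+ ℚ.- δ (b , i) (λ u → M (i ∷ l ∷ map proj₂ u)) w)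
      ≡⟨ Σℚ-+ (allFin n) _ _ ⟩
    Σℚ (allFin n) (λ i → ⟦ (k , l) ≟ᵥ (b , i) ⟧ ℚ.* M (i ∷ map proj₂ w)) ℚ.+ Σℚ (allFin n) (λ i → ℚ.- δ (b , i) (λ u → M (i ∷ l ∷ map proj₂ u)) w)
      ≡⟨ ≡.cong₂ ℚ._+_ (Σ-match k l b (λ i → M (i ∷ map proj₂ w))) (Σℚ-cong (allFin n) (λ i _ → flipped i)) ⟩
    ⟦ k Finₚ.≟ b ⟧ ℚ.* x ℚ.+ Σℚ (allFin n) (λ i → δ (b , i) (λ u → M (l ∷ i ∷ map proj₂ u)) w)
      ≡⟨ cong (⟦ k Finₚ.≟ b ⟧ ℚ.* x ℚ.+_) (euler b {λ t → M (l ∷ t)} (λ u → alt (l ∷ u)) w) ⟩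
    ⟦ k Finₚ.≟ b ⟧ ℚ.* x ℚ.+ toℚ (count b w) ℚ.* x  ≡⟨ ℚₚ.*-distribʳ-+ x ⟦ k Finₚ.≟ b ⟧ (toℚ (count b w)) ⟨
    (⟦ k Finₚ.≟ b ⟧ ℚ.+ toℚ (count b w)) ℚ.* x      ≡⟨ cong (ℚ._* x) counted ⟩
    toℚ (count b ((k , l) ∷ w)) ℚ.* x               ∎
    where
    open ≡.≡-Reasoning
    x = M (l ∷ map proj₂ w)
    flipped : ∀ i → ℚ.- δ (b , i) (λ u → M (i ∷ l ∷ map proj₂ u)) w ≡ δ (b , i) (λ u → M (l ∷ i ∷ map proj₂ u)) w
    flipped i = ≡.trans (≡.sym (δ-neg (b , i) _ w)) (δ-cong (b , i) (λ u → ≡.trans (cong ℚ.-_ (alt [] i l (map proj₂ u))) (ℚ⁺ₚ.⁻¹-involutive (M (l ∷ i ∷ map proj₂ u)))) w)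
    counted : ⟦ k Finₚ.≟ b ⟧ ℚ.+ toℚ (count b w) ≡ toℚ (count b ((k , l) ∷ w))
    counted with k Finₚ.≟ b
    ... | yes _ = refl
    ... | no _  = ℚₚ.+-identityˡ _

  -- Replaces a pair of letters of kinds a, b with a common index by that index.
  D : Fin 3 → Fin 3 → Word n → ℚ
  D a b w = Σℚ (allFin n) (λ i → δ (a , i) (δ (b , i) (ψₐ i)) w)

  D-alt : ∀ a b → Alt ℚ⁺ (D a b)
  D-alt a b = Σ-alt (allFin n) {λ i w → δ (a , i) (δ (b , i) (ψₐ i)) w} (λ i → δ-alt (a , i) (δ-alt (b , i) (ψₐ-alt i)))

  D-anti : ∀ a b {i j} → i ≢ j → ∀ w → D a b (relabel (tr i j) w) ≡ ℚ.- D a b w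
  D-anti a b {i} {j} d w = begin
    Σℚ (allFin n) (λ k → δ (a , k) (δ (b , k) (ψₐ k)) (relabel (tr i j) w))
      ≡⟨ Σℚ-cong (allFin n) (λ k _ → ≡.trans (δ-relabel i j a k (δ (b , k) (ψₐ k)) w) (≡.trans
           (δ-cong (a , tr i j k) (λ u → ≡.trans (δ-relabel i j b k (ψₐ k) u) (≡.trans
              (δ-cong (b , tr i j k) (ψₐ-anti d k) u) (δ-neg (b , tr i j k) (ψₐ (tr i j k)) u))) w)
           (δ-neg (a , tr i j k) (δ (b , tr i j k) (ψₐ (tr i j k))) w))) ⟩
    Σℚ (allFin n) (λ k → ℚ.- δ (a , tr i j k) (δ (b , tr i j k) (ψₐ (tr i j k))) w)  ≡⟨ Σℚ-neg (allFin n) _ ⟩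
    ℚ.- Σℚ (allFin n) (λ k → δ (a , tr i j k) (δ (b , tr i j k) (ψₐ (tr i j k))) w)  ≡⟨ cong ℚ.-_ (reindex i j (λ k → δ (a , k) (δ (b , k) (ψₐ k)) w)) ⟩
    ℚ.- D a b w ∎
    where open ≡.≡-Reasoning

  -- The summed letter is consumed as the a or as the b of a contracted pair, with opposite signs,
  -- and `euler` counts its possible partners. If it is not consumed, `Σψ` annihilates the term.
  D-sum : ∀ a b k w → Σℚ (allFin n) (λ j → D a b ((k , j) ∷ w)) ≡
    ⟦ k Finₚ.≟ a ⟧ ℚ.* (toℚ (count b w) ℚ.* ψ (map proj₂ w)) ℚ.+ ℚ.- (⟦ k Finₚ.≟ b ⟧ ℚ.* (toℚ (count a w) ℚ.* ψ (map proj₂ w)))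
  D-sum a b k w = begin
    Σℚ (allFin n) (λ j → Σℚ (allFin n) (λ i → δ (a , i) (δ (b , i) (ψₐ i)) ((k , j) ∷ w)))
      ≡⟨ Σℚ-swap (allFin n) (allFin n) (λ j i → δ (a , i) (δ (b , i) (ψₐ i)) ((k , j) ∷ w)) ⟩
    Σℚ (allFin n) (λ i → Σℚ (allFin n) (λ j → δ (a , i) (δ (b , i) (ψₐ i)) ((k , j) ∷ w)))
      ≡⟨ Σℚ-cong (allFin n) (λ i _ → inner i) ⟩
    Σℚ (allFin n) (λ i → ⟦ k Finₚ.≟ a ⟧ ℚ.* δ (b , i) (ψₐ i) w ℚ.+ ℚ.- (⟦ k Finₚ.≟ b ⟧ ℚ.* δ (a , i) (ψₐ i) w))
      ≡⟨ ≡.trans (Σℚ-+ (allFin n) _ _) (≡.cong₂ ℚ._+_ (Σℚ-* (allFin n) ⟦ k Finₚ.≟ a ⟧ _)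
           (≡.trans (Σℚ-neg (allFin n) _) (cong ℚ.-_ (Σℚ-* (allFin n) ⟦ k Finₚ.≟ b ⟧ _)))) ⟩
    ⟦ k Finₚ.≟ a ⟧ ℚ.* Σℚ (allFin n) (λ i → δ (b , i) (ψₐ i) w) ℚ.+ ℚ.- (⟦ k Finₚ.≟ b ⟧ ℚ.* Σℚ (allFin n) (λ i → δ (a , i) (ψₐ i) w))
      ≡⟨ ≡.cong₂ (λ x y → ⟦ k Finₚ.≟ a ⟧ ℚ.* x ℚ.+ ℚ.- (⟦ k Finₚ.≟ b ⟧ ℚ.* y)) (euler b {ψ} ψ-alt w) (euler a {ψ} ψ-alt w) ⟩
    _ ∎
    where
    open ≡.≡-Reasoning
    matched : ∀ c i x → Σℚ (allFin n) (λ j → ⟦ (k , j) ≟ᵥ (c , i) ⟧ ℚ.* x) ≡ ⟦ k Finₚ.≟ c ⟧ ℚ.* x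
    matched c i x = ≡.trans (Σℚ-cong (allFin n) (λ j _ → cong (ℚ._* x)
      (⟦⟧-⇔ ((k , j) ≟ᵥ (c , i)) ((k , i) ≟ᵥ (c , j)) (λ { refl → refl }) (λ { refl → refl })))) (Σ-match k i c (λ _ → x))
    inner : ∀ i → Σℚ (allFin n) (λ j → δ (a , i) (δ (b , i) (ψₐ i)) ((k , j) ∷ w)) ≡
                  ⟦ k Finₚ.≟ a ⟧ ℚ.* δ (b , i) (ψₐ i) w ℚ.+ ℚ.- (⟦ k Finₚ.≟ b ⟧ ℚ.* δ (a , i) (ψₐ i) w)
    inner i = begin
      Σℚ (allFin n) (λ j → ⟦ (k , j) ≟ᵥ (a , i) ⟧ ℚ.* y ℚ.+ ℚ.- δ (a , i) (λ u → δ (b , i) (ψₐ i) ((k , j) ∷ u)) w)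
        ≡⟨ ≡.trans (Σℚ-+ (allFin n) _ _) (≡.cong₂ ℚ._+_ (matched a i y) (Σℚ-neg (allFin n) _)) ⟩
      ⟦ k Finₚ.≟ a ⟧ ℚ.* y ℚ.+ ℚ.- Σℚ (allFin n) (λ j → δ (a , i) (λ u → δ (b , i) (ψₐ i) ((k , j) ∷ u)) w)
        ≡⟨ cong (λ s → ⟦ k Finₚ.≟ a ⟧ ℚ.* y ℚ.+ ℚ.- s) (≡.trans (≡.sym (δ-Σ (a , i) (allFin n) (λ j u → δ (b , i) (ψₐ i) ((k , j) ∷ u)) w))
             (≡.trans (δ-cong (a , i) summed w) (δ-* (a , i) ⟦ k Finₚ.≟ b ⟧ (ψₐ i) w))) ⟩
      _ ∎
      where
      y = δ (b , i) (ψₐ i) w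
      summed : ∀ u → Σℚ (allFin n) (λ j → δ (b , i) (ψₐ i) ((k , j) ∷ u)) ≡ ⟦ k Finₚ.≟ b ⟧ ℚ.* ψₐ i u
      summed u = ≡.trans (Σℚ-+ (allFin n) _ _) (≡.trans (≡.cong₂ ℚ._+_ (matched b i (ψₐ i u))
        (≡.trans (Σℚ-neg (allFin n) _) (cong ℚ.-_ (≡.trans (≡.sym (δ-Σ (b , i) (allFin n) (λ j t → ψₐ i ((k , j) ∷ t)) u))
          (δ-0 (b , i) (λ t → Σψ i (map proj₂ t)) u))))) (ℚₚ.+-identityʳ _))

  D-zero : ∀ a b w → (∀ i → (a , i) ∉ w ⊎ (b , i) ∉ w) → D a b w ≡ 0ℚ
  D-zero a b w h = Σℚ-0 (allFin n) λ i _ → vanish i (h i)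
    where
    vanish : ∀ i → (a , i) ∉ w ⊎ (b , i) ∉ w → δ (a , i) (δ (b , i) (ψₐ i)) w ≡ 0ℚ
    vanish i (inj₁ a∉) = δ-absent (a , i) w a∉
    vanish i (inj₂ b∉) = δ-vanish (a , i) (b , i) (λ u u∉ → δ-absent (b , i) u u∉) w b∉

  -- Only m carries both kinds, so a single term survives; its sign is + because the two letters
  -- lead the word in the order of contraction.
  D-pair : ∀ a b m w → a ≢ b → Free m w → (∀ i → (a , i) ∉ w ⊎ (b , i) ∉ w) → D a b ((a , m) ∷ (b , m) ∷ w) ≡ ψ (m ∷ map proj₂ w)
  D-pair a b m w a≢b fm h with rest , ρ ← complementFin {l = m ∷ []} ([] ∷ []) = ≡.trans (Σℚ-↭ (λ i → δ (a , i) (δ (b , i) (ψₐ i)) ((a , m) ∷ (b , m) ∷ w)) ρ) (≡.trans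
    (≡.cong₂ ℚ._+_
      (≡.trans (δ-head (a , m) {δ (b , m) (ψₐ m)} ((b , m) ∷ w) (λ { (here refl) → a≢b refl ; (there p) → Free⇒∉ᵥ fm p }))
               (δ-head (b , m) {ψₐ m} w (Free⇒∉ᵥ fm)))
      (Σℚ-0 rest others)) (ℚₚ.+-identityʳ (ψ (m ∷ map proj₂ w))))
    where
    w′ = (a , m) ∷ (b , m) ∷ w
    absent : ∀ {c i} → i ≢ m → (c , i) ∉ w → (c , i) ∉ w′
    absent i≢m c∉ (here refl) = i≢m refl
    absent i≢m c∉ (there (here refl)) = i≢m refl
    absent i≢m c∉ (there (there p)) = c∉ p
    others : ∀ i → i ∈ rest → δ (a , i) (δ (b , i) (ψₐ i)) w′ ≡ 0ℚ
    others i i∈ with x ∷ _ ← Unique-resp-↭ ρ (Uniqueₚ.allFin⁺ n) with h i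
    ... | inj₁ a∉ = δ-absent (a , i) {δ (b , i) (ψₐ i)} w′ (absent (λ { refl → All≢⇒∉ x i∈ }) a∉)
    ... | inj₂ b∉ = δ-vanish (a , i) (b , i) {δ (b , i) (ψₐ i)} (λ u u∉ → δ-absent (b , i) {ψₐ i} u u∉) w′ (absent (λ { refl → All≢⇒∉ x i∈ }) b∉)

-- Kinds of the letters of a word

kindList : ℕ → ℕ → ℕ → List (Fin 3)
kindList a b c = replicate a 0F ++ replicate b 1F ++ replicate c 2F

HasKinds : ∀ {n} → ℕ → ℕ → ℕ → Word n → Set
HasKinds a b c w = count 0F w ≡ a × count 1F w ≡ b × count 2F w ≡ c

hasKinds? : ∀ {n} a b c (w : Word n) → Dec (HasKinds a b c w)
hasKinds? a b c w = (count 0F w ℕ.≟ a) ×-dec (count 1F w ℕ.≟ b) ×-dec (count 2F w ℕ.≟ c)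

count-↭ : ∀ {n} k {w w′ : Word n} → w ↭ w′ → count k w ≡ count k w′
count-↭ k _↭_.refl = refl
count-↭ k (prep (l , _) p) = cong (_ ℕ.+_) (count-↭ k p)
count-↭ k (swap (l , _) (h , _) p) = ≡.trans (x∙yz≈y∙xz (if does (l Finₚ.≟ k) then 1 else 0) (if does (h Finₚ.≟ k) then 1 else 0) _)
    (cong (λ x → (if does (h Finₚ.≟ k) then 1 else 0) ℕ.+ ((if does (l Finₚ.≟ k) then 1 else 0) ℕ.+ x)) (count-↭ k p))
  where open import Algebra.Properties.CommutativeSemigroup ℕₚ.+-commutativeSemigroup
count-↭ k (trans p q) = ≡.trans (count-↭ k p) (count-↭ k q)

count-relabel : ∀ {n} k (f : Fin n → Fin n) w → count k (relabel f w) ≡ count k w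
count-relabel k f []            = refl
count-relabel k f ((l , i) ∷ w) = cong (_ ℕ.+_) (count-relabel k f w)

hasKinds-cong : ∀ {n a b c} {w w′ : Word n} → (∀ k → count k w ≡ count k w′) → HasKinds a b c w → HasKinds a b c w′
hasKinds-cong e (x , y , z) = ≡.trans (≡.sym (e 0F)) x , ≡.trans (≡.sym (e 1F)) y , ≡.trans (≡.sym (e 2F)) z

length-count : ∀ {n} (w : Word n) → length w ≡ count 0F w ℕ.+ count 1F w ℕ.+ count 2F w
length-count []             = refl
length-count ((0F , _) ∷ w) = cong suc (length-count w)
length-count ((1F , _) ∷ w) = ≡.trans (cong suc (length-count w)) (cong (ℕ._+ count 2F w) (≡.sym (ℕₚ.+-suc (count 0F w) (count 1F w))))
length-count ((2F , _) ∷ w) = ≡.trans (cong suc (length-count w)) (≡.sym (ℕₚ.+-suc (count 0F w ℕ.+ count 1F w) (count 2F w)))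

hasKinds⇒length : ∀ {n a b c} {w : Word n} → HasKinds a b c w → length w ≡ a ℕ.+ b ℕ.+ c
hasKinds⇒length {w = w} (refl , refl , refl) = length-count w

hasKinds⇒↭ : ∀ {n a b c} {w : Word n} → HasKinds a b c w → map proj₁ w ↭ kindList a b c
hasKinds⇒↭ {w = w} (refl , refl , refl) = go w
  where
  go : ∀ w → map proj₁ w ↭ kindList (count 0F w) (count 1F w) (count 2F w)
  go []             = ↭-refl
  go ((0F , _) ∷ w) = prep 0F (go w)
  go ((1F , _) ∷ w) = ↭-trans (prep 1F (go w)) (↭-sym (↭ₚ.shift 1F (replicate (count 0F w) 0F) _))
  go ((2F , _) ∷ w) = ↭-trans (prep 2F (go w)) (↭-trans (↭-sym (↭ₚ.shift 2F (replicate (count 0F w) 0F) _))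
    (↭ₚ.++⁺ˡ (replicate (count 0F w) 0F) (↭-sym (↭ₚ.shift 2F (replicate (count 1F w) 1F) _))))

kinds↭⇒hasKinds : ∀ {n a b c} {w : Word n} → map proj₁ w ↭ kindList a b c → HasKinds a b c w
kinds↭⇒hasKinds {n} {a} {b} {c} {w} p with w′ , e , π ← ↭ₚ.↭-map-inv proj₁ p =
  hasKinds-cong {w = w′} {w} (λ k → ≡.sym (count-↭ k π)) (canonical a b c w′ e)
  where
  canonical : ∀ a b c (w : Word n) → kindList a b c ≡ map proj₁ w → HasKinds a b c w
  canonical zero zero zero [] e = refl , refl , refl
  canonical zero zero (suc c) ((_ , _) ∷ w) e with refl , e′ ← Listₚ.∷-injective e with x , y , z ← canonical zero zero c w e′ = x , y , cong suc z
  canonical zero (suc b) c ((_ , _) ∷ w) e with refl , e′ ← Listₚ.∷-injective e with x , y , z ← canonical zero b c w e′ = x , cong suc y , z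
  canonical (suc a) b c ((_ , _) ∷ w) e with refl , e′ ← Listₚ.∷-injective e with x , y , z ← canonical a b c w e′ = cong suc x , y , z

χ : ∀ {n} → ℕ → ℕ → ℕ → Word n → ℚ
χ a b c w = ⟦ hasKinds? a b c w ⟧

χ-cong : ∀ {n} a b c {w w′ : Word n} → (∀ k → count k w ≡ count k w′) → χ a b c w ≡ χ a b c w′
χ-cong a b c {w} {w′} e = ⟦⟧-⇔ (hasKinds? a b c w) (hasKinds? a b c w′)
  (hasKinds-cong {w = w} {w′} e) (hasKinds-cong {w = w′} {w} (≡.sym ∘ e))

-- Functionals vanishing on the ideal

extend-ext : ∀ {n} {L M : Word n → ℚ} → (∀ w → L w ≡ M w) → ∀ f → extend L f ≡ extend M f
extend-ext e []            = refl
extend-ext e ((q , w) ∷ f) = ≡.cong₂ (λ x y → q ℚ.* x ℚ.+ y) (e w) (extend-ext e f)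

extend-neg : ∀ {n} (L : Word n → ℚ) f → extend (λ w → ℚ.- L w) f ≡ ℚ.- extend L f
extend-neg L []            = refl
extend-neg L ((q , w) ∷ f) = ≡.trans (cong (q ℚ.* (ℚ.- L w) ℚ.+_) (extend-neg L f))
  (solve 3 (λ q l e → q :* (:- l) :+ (:- e) := :- (q :* l :+ e)) refl q (L w) (extend L f))
  where open +-*-Solver using (solve; _:*_; _:+_; :-_; _:=_)

extend-* : ∀ {n} r (L : Word n → ℚ) f → extend (λ w → r ℚ.* L w) f ≡ r ℚ.* extend L f
extend-* r L []            = ≡.sym (ℚₚ.*-zeroʳ r)
extend-* r L ((q , w) ∷ f) = ≡.trans (cong (q ℚ.* (r ℚ.* L w) ℚ.+_) (extend-* r L f))
  (solve 4 (λ q r l e → q :* (r :* l) :+ r :* e := r :* (q :* l :+ e)) refl q r (L w) (extend L f))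
  where open +-*-Solver using (solve; _:*_; _:+_; :-_; _:=_)

extend-+ : ∀ {n} (L M : Word n → ℚ) f → extend (λ w → L w ℚ.+ M w) f ≡ extend L f ℚ.+ extend M f
extend-+ L M []            = refl
extend-+ L M ((q , w) ∷ f) = ≡.trans (cong (q ℚ.* (L w ℚ.+ M w) ℚ.+_) (extend-+ L M f))
  (solve 5 (λ q l m e g → q :* (l :+ m) :+ (e :+ g) := (q :* l :+ e) :+ (q :* m :+ g)) refl q (L w) (M w) (extend L f) (extend M f))
  where open +-*-Solver using (solve; _:*_; _:+_; :-_; _:=_)

extend-0 : ∀ {n} {L : Word n → ℚ} → (∀ w → L w ≡ 0ℚ) → ∀ f → extend L f ≡ 0ℚ
extend-0 e []            = refl
extend-0 e ((q , w) ∷ f) = ≡.trans (≡.cong₂ (λ x y → q ℚ.* x ℚ.+ y) (e w) (extend-0 e f)) (≡.trans (cong (ℚ._+ 0ℚ) (ℚₚ.*-zeroʳ q)) refl)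

extend-Σ : ∀ {n} {A : Set} (l : List A) (M : A → Word n → ℚ) f → extend (λ w → Σℚ l (λ i → M i w)) f ≡ Σℚ l (λ i → extend (M i) f)
extend-Σ []      M f = extend-0 (λ _ → refl) f
extend-Σ (i ∷ l) M f = ≡.trans (extend-+ (M i) _ f) (cong (extend (M i) f ℚ.+_) (extend-Σ l M f))

extend-⊗ : ∀ {n} (L : Word n → ℚ) g h → (∀ w → extend (λ u → L (w ++ u)) h ≡ 0ℚ) → extend L (g ⊗ h) ≡ 0ℚ
extend-⊗ L []            h z = refl
extend-⊗ L ((q , w) ∷ g) h z = ≡.trans (extend-++ L (map _ h) (g ⊗ h)) (≡.trans (≡.cong₂ ℚ._+_ (≡.trans (row h) (≡.trans (cong (q ℚ.*_) (z w)) (ℚₚ.*-zeroʳ q))) (extend-⊗ L g h z)) refl)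
  where
  row : ∀ h → extend L (map (λ t → q ℚ.* proj₁ t , w ++ proj₂ t) h) ≡ q ℚ.* extend (λ u → L (w ++ u)) h
  row []            = ≡.sym (ℚₚ.*-zeroʳ q)
  row ((p , v) ∷ h) = ≡.trans (≡.cong₂ ℚ._+_ (ℚₚ.*-assoc q p (L (w ++ v))) (row h)) (≡.sym (ℚₚ.*-distribˡ-+ q (p ℚ.* L (w ++ v)) _))

module Vanishing {n : ℕ} (Φ : Word n → ℚ) (alt : Alt ℚ⁺ Φ)
  (anti : ∀ {i j} → i ≢ j → ∀ w → Φ (relabel (tr i j) w) ≡ ℚ.- Φ w)
  (d : ℕ) (support : ∀ w → length w ≢ d → Φ w ≡ 0ℚ) where

  Φ′ : Word n → Word n → ℚ
  Φ′ w u = Φ (w ++ u)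

  relabel-free : ∀ {i j} {w : Word n} → Free i w → Free j w → relabel (tr i j) w ≡ w
  relabel-free f g = interchange⇒relabel (free⇒interchange f g)

  -- The transposition of i and j fixes both w and h, but negates Φ.
  two-missing : ∀ {i j w h} → i ≢ j → Free i w → Free j w → Invariant h → extend (Φ′ w) h ≡ 0ℚ
  two-missing {i} {j} {w} {h} d fi fj inv = self-neg⇒0 (begin
    extend (Φ′ w) h                            ≡⟨ extend-cong {L = Φ′ w} (prefix-alt w {Φ} alt) {act (transpose i j) h} {h} (inv (transpose i j)) ⟨
    extend (Φ′ w) (act (transpose i j) h)      ≡⟨ extend-act (Φ′ w) (transpose i j) h ⟩
    extend (Φ′ w ∘ relabel (tr i j)) h         ≡⟨ extend-ext (λ u → ≡.trans (cong Φ (≡.trans (cong (_++ relabel (tr i j) u) (≡.sym (relabel-free fi fj)))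
                                                    (≡.sym (Listₚ.map-++ _ w u)))) (anti d (w ++ u))) h ⟩
    extend (λ u → ℚ.- Φ′ w u) h                ≡⟨ extend-neg (Φ′ w) h ⟩
    ℚ.- extend (Φ′ w) h                        ∎)
    where open ≡.≡-Reasoning

  -- Appending any letter to w leaves the support of Φ, so only the constant term of h is seen.
  long : ∀ {w h} → d ≤ length w → coeff h emptySet ≡ 0ℚ → extend (Φ′ w) h ≡ 0ℚ
  long {w} {h} d≤ c = ≡.trans (extend-ext pointwise h) (≡.trans (extend-* (Φ w) (λ u → wordCoeff u emptySet) h)
    (≡.trans (cong (Φ w ℚ.*_) c) (ℚₚ.*-zeroʳ (Φ w))))
    where
    pointwise : ∀ u → Φ′ w u ≡ Φ w ℚ.* wordCoeff u emptySet
    pointwise [] = ≡.trans (cong Φ (Listₚ.++-identityʳ w)) (≡.sym (≡.trans (cong (Φ w ℚ.*_)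
      (wordCoeff-good {n} {w = []} {emptySet} ([] , λ _ → refl))) (ℚₚ.*-identityʳ (Φ w))))
    pointwise (v ∷ u) = ≡.trans (support _ (λ e → ℕₚ.1+n≰n (ℕₚ.≤-trans (s≤s d≤)
        (ℕₚ.≤-trans (ℕₚ.m≤m+n (suc (length w)) (length u)) (ℕₚ.≤-reflexive (≡.trans (≡.sym (ℕₚ.+-suc (length w) (length u)))
          (≡.trans (≡.sym (Listₚ.length-++ w)) e)))))))
      (≡.sym (≡.trans (cong (Φ w ℚ.*_) (wordCoeff-bad {w = v ∷ u} {emptySet} λ (_ , h) →
        case ≡.trans (h v) (∈⇒memb {v = v} {v ∷ u} (here refl)) of λ ())) (ℚₚ.*-zeroʳ (Φ w))))

  linear : Var n → Word n → ℚ
  linear x (v ∷ []) = ⟦ x ≟ᵥ v ⟧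
  linear x _        = 0ℚ

  linear-alt : ∀ x → Alt ℚ⁺ (linear x)
  linear-alt x u y z w = ≡.trans (vanish u y z w) (cong ℚ.-_ (≡.sym (vanish u z y w)))
    where
    vanish : ∀ u y z w → linear x (u ++ y ∷ z ∷ w) ≡ 0ℚ
    vanish []          y z w = refl
    vanish (_ ∷ [])    y z w = refl
    vanish (_ ∷ _ ∷ _) y z w = refl

  linear-invariant : ∀ {h} → Invariant h → ∀ k i j → extend (linear (k , i)) h ≡ extend (linear (k , j)) h
  linear-invariant {h} inv k i j = begin
    extend (linear (k , i)) h                           ≡⟨ extend-cong (linear-alt (k , i)) {act (transpose i j) h} {h} (inv (transpose i j)) ⟨
    extend (linear (k , i)) (act (transpose i j) h)     ≡⟨ extend-act (linear (k , i)) (transpose i j) h ⟩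
    extend (linear (k , i) ∘ relabel (tr i j)) h        ≡⟨ extend-ext pointwise h ⟩
    extend (linear (k , j)) h                           ∎
    where
    open ≡.≡-Reasoning
    pointwise : ∀ u → linear (k , i) (relabel (tr i j) u) ≡ linear (k , j) u
    pointwise []              = refl
    pointwise ((l , x) ∷ [])  = ⟦⟧-⇔ ((k , i) ≟ᵥ (l , tr i j x)) ((k , j) ≟ᵥ (l , x))
      (λ e → ≡.cong₂ _,_ (cong proj₁ e) (≡.trans (≡.sym (tr-l i j)) (≡.trans (cong (tr i j ∘ proj₂) e) (tr-involutive i j x))))
      (λ e → ≡.cong₂ _,_ (cong proj₁ e) (≡.trans (≡.sym (tr-r i j)) (cong (tr i j ∘ proj₂) e)))
    pointwise (_ ∷ _ ∷ _) = refl

  -- By degree only the linear part of h is seen. Invariance makes its coefficients constant within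
  -- each kind, so it is a combination of the three power sums of single letters.
  linear-part : Fin n → ∀ {w h} → suc (length w) ≡ d → (∀ k → Σℚ (allFin n) (λ i → Φ (w ++ (k , i) ∷ [])) ≡ 0ℚ) →
                Invariant h → extend (Φ′ w) h ≡ 0ℚ
  linear-part i₀ {w} {h} e z inv = begin
    extend (Φ′ w) h
      ≡⟨ extend-ext pointwise h ⟩
    extend (λ u → Σℚ (allFin 3) (λ k → Σℚ (allFin n) (λ i → Φ (w ++ (k , i) ∷ []) ℚ.* linear (k , i) u))) h
      ≡⟨ ≡.trans (extend-Σ (allFin 3) (λ k u → Σℚ (allFin n) (λ i → part k i u)) h) (Σℚ-cong (allFin 3) (λ k _ → extend-Σ (allFin n) (part k) h)) ⟩
    Σℚ (allFin 3) (λ k → Σℚ (allFin n) (λ i → extend (λ u → Φ (w ++ (k , i) ∷ []) ℚ.* linear (k , i) u) h))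
      ≡⟨ Σℚ-0 (allFin 3) (λ k _ → ≡.trans (Σℚ-cong (allFin n) (λ i _ → ≡.trans (extend-* (Φ (w ++ (k , i) ∷ [])) (linear (k , i)) h)
           (≡.trans (cong (Φ (w ++ (k , i) ∷ []) ℚ.*_) (linear-invariant {h} inv k i i₀)) (ℚₚ.*-comm (Φ (w ++ (k , i) ∷ [])) (extend (linear (k , i₀)) h)))))
           (≡.trans (Σℚ-* (allFin n) (extend (linear (k , i₀)) h) _) (≡.trans (cong (extend (linear (k , i₀)) h ℚ.*_) (z k)) (ℚₚ.*-zeroʳ (extend (linear (k , i₀)) h))))) ⟩
    0ℚ ∎
    where
    open ≡.≡-Reasoning
    part : Fin 3 → Fin n → Word n → ℚ
    part k i u = Φ (w ++ (k , i) ∷ []) ℚ.* linear (k , i) u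
    too-short : length (w ++ []) ≢ d
    too-short e′ = ℕₚ.1+n≢n (≡.trans e (≡.trans (≡.sym e′) (cong length (Listₚ.++-identityʳ w))))
    pointwise : ∀ u → Φ′ w u ≡ Σℚ (allFin 3) (λ k → Σℚ (allFin n) (λ i → Φ (w ++ (k , i) ∷ []) ℚ.* linear (k , i) u))
    pointwise [] = ≡.trans (support (w ++ []) too-short)
      (≡.sym (Σℚ-0 (allFin 3) (λ k _ → Σℚ-0 (allFin n) (λ i _ → ℚₚ.*-zeroʳ (Φ (w ++ (k , i) ∷ []))))))
    pointwise ((l , j) ∷ []) = ≡.sym (≡.trans (Σℚ-cong (allFin 3) (λ k _ → ≡.trans
        (Σℚ-cong (allFin n) (λ i _ → ≡.trans (ℚₚ.*-comm (Φ (w ++ (k , i) ∷ [])) (linear (k , i) ((l , j) ∷ []))) (cong (ℚ._* Φ (w ++ (k , i) ∷ []))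
          (⟦⟧-⇔ ((k , i) ≟ᵥ (l , j)) ((l , j) ≟ᵥ (k , i)) ≡.sym ≡.sym)))) (Σ-match l j k (λ i → Φ (w ++ (k , i) ∷ [])))))
      (kronecker l (λ k → Φ (w ++ (k , j) ∷ []))))
    pointwise (x ∷ y ∷ u) = ≡.trans (support _ (λ e′ → ℕₚ.1+n≢n (ℕₚ.≤-antisym (ℕₚ.≤-trans
        (ℕₚ.≤-trans (ℕₚ.m≤m+n (2 ℕ.+ length w) (length u)) (ℕₚ.≤-reflexive (≡.trans (≡.sym (≡.trans (ℕₚ.+-suc (length w) _) (cong suc (ℕₚ.+-suc (length w) (length u)))))
          (≡.trans (≡.sym (Listₚ.length-++ w)) e′)))) (ℕₚ.≤-reflexive (≡.sym e))) (ℕₚ.n≤1+n _))))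
      (≡.sym (Σℚ-0 (allFin 3) (λ k _ → Σℚ-0 (allFin n) (λ i _ → ℚₚ.*-zeroʳ (Φ (w ++ (k , i) ∷ []))))))

  -- The length of the left factor w is compared with n - 1. A shorter w misses two indices, and a
  -- longer one exhausts the degree d. At n - 1 the constant term of h decides if d < n and the
  -- linear part if d = n.
  vanishes : Fin n → d ≤ n → (d ≡ n → ∀ w → suc (length w) ≡ n → ∀ k → Σℚ (allFin n) (λ i → Φ (w ++ (k , i) ∷ [])) ≡ 0ℚ) →
             ∀ {f} → InI f → extend Φ f ≡ 0ℚ
  vanishes i₀ d≤n z {f} (gh , inv , e) = ≡.trans (extend-cong alt {f} {combination gh} e) (go gh inv)
    where
    each : ∀ h → InvariantNoConst h → ∀ w → extend (Φ′ w) h ≡ 0ℚ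
    each h (inv , c) w with ℕₚ.<-cmp (suc (length w)) n
    ... | tri< a _ _ with i , j , ij , i∉ , j∉ ← missing₂ (map proj₂ w) (subst (λ x → suc x < n) (≡.sym (Listₚ.length-map proj₂ w)) a) =
      two-missing {h = h} ij (∉⇒Free i∉) (∉⇒Free j∉) inv
    ... | tri> _ _ b = long {h = h} (ℕₚ.≤-trans d≤n (ℕₚ.≤-pred b)) c
    ... | tri≈ _ eq _ with ℕₚ.m≤n⇒m<n∨m≡n d≤n
    ...   | inj₁ d<n = long {h = h} (ℕₚ.≤-pred (ℕₚ.≤-trans d<n (ℕₚ.≤-reflexive (≡.sym eq)))) c
    ...   | inj₂ refl = linear-part i₀ {h = h} eq (z refl w eq) inv
    go : ∀ gh → All (λ p → InvariantNoConst (proj₂ p)) gh → extend Φ (combination gh) ≡ 0ℚ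
    go []             []         = refl
    go ((g , h) ∷ gh) (i ∷ is) = ≡.trans (extend-++ Φ (g ⊗ h) _)
      (≡.cong₂ ℚ._+_ (extend-⊗ Φ g h (each h i)) (go gh is))

-- Functionals supported in one tridegree

module _ {n : ℕ} (a b c : ℕ) where

  Φ-alt : ∀ {M : Word n → ℚ} → Alt ℚ⁺ M → Alt ℚ⁺ (λ w → χ a b c w ℚ.* M w)
  Φ-alt {M} alt u x y w = ≡.trans
    (≡.cong₂ ℚ._*_ (χ-cong a b c {u ++ x ∷ y ∷ w} {u ++ y ∷ x ∷ w} (λ k → count-↭ k (↭ₚ.++⁺ˡ u (swap x y ↭-refl)))) (alt u x y w))
    (≡.sym (ℚₚ.neg-distribʳ-* (χ a b c (u ++ y ∷ x ∷ w)) _))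

  Φ-anti : ∀ {M : Word n → ℚ} → (∀ {i j} → i ≢ j → ∀ w → M (relabel (tr i j) w) ≡ ℚ.- M w) →
           ∀ {i j} → i ≢ j → ∀ w → χ a b c (relabel (tr i j) w) ℚ.* M (relabel (tr i j) w) ≡ ℚ.- (χ a b c w ℚ.* M w)
  Φ-anti anti {i} {j} d w = ≡.trans
    (≡.cong₂ ℚ._*_ (χ-cong a b c {relabel (tr i j) w} {w} (λ k → count-relabel k (tr i j) w)) (anti d w))
    (≡.sym (ℚₚ.neg-distribʳ-* (χ a b c w) _))

  Φ-support : ∀ (M : Word n → ℚ) w → length w ≢ a ℕ.+ b ℕ.+ c → χ a b c w ℚ.* M w ≡ 0ℚ
  Φ-support M w l≢ = ≡.trans (cong (ℚ._* M w) (⟦⟧-no (hasKinds? a b c w) (λ h → l≢ (hasKinds⇒length {w = w} h)))) (ℚₚ.*-zeroˡ (M w))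

  -- With these weights the two terms of D-sum cancel for each of the three kinds.
  φ : Word n → ℚ
  φ w = toℚ c ℚ.* D 0F 1F w ℚ.+ (toℚ a ℚ.* D 1F 2F w ℚ.+ toℚ b ℚ.* D 2F 0F w)

  φ-alt : Alt ℚ⁺ φ
  φ-alt u x y w = ≡.trans (≡.cong₂ ℚ._+_ (term 0F 1F c) (≡.cong₂ ℚ._+_ (term 1F 2F a) (term 2F 0F b)))
    (≡.trans (cong (ℚ.- (toℚ c ℚ.* D 0F 1F w′) ℚ.+_) (ℚ⁺ₚ.⁻¹-∙-comm (toℚ a ℚ.* D 1F 2F w′) (toℚ b ℚ.* D 2F 0F w′)))
      (ℚ⁺ₚ.⁻¹-∙-comm (toℚ c ℚ.* D 0F 1F w′) _))
    where
    w′ = u ++ y ∷ x ∷ w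
    term : ∀ k l q → toℚ q ℚ.* D k l (u ++ x ∷ y ∷ w) ≡ ℚ.- (toℚ q ℚ.* D k l w′)
    term k l q = *-alt (toℚ q) {D k l} (D-alt k l) u x y w

  φ-anti : ∀ {i j} → i ≢ j → ∀ w → φ (relabel (tr i j) w) ≡ ℚ.- φ w
  φ-anti {i} {j} d w = ≡.trans (≡.cong₂ ℚ._+_ (term 0F 1F c) (≡.cong₂ ℚ._+_ (term 1F 2F a) (term 2F 0F b)))
    (≡.trans (cong (ℚ.- (toℚ c ℚ.* D 0F 1F w) ℚ.+_) (ℚ⁺ₚ.⁻¹-∙-comm (toℚ a ℚ.* D 1F 2F w) (toℚ b ℚ.* D 2F 0F w)))
      (ℚ⁺ₚ.⁻¹-∙-comm (toℚ c ℚ.* D 0F 1F w) _))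
    where
    term : ∀ k l q → toℚ q ℚ.* D k l (relabel (tr i j) w) ≡ ℚ.- (toℚ q ℚ.* D k l w)
    term k l q = ≡.trans (cong (toℚ q ℚ.*_) (D-anti k l d w)) (≡.sym (ℚₚ.neg-distribʳ-* (toℚ q) (D k l w)))

  -- For k = θ the rest contains b letters ξ and c letters ρ, so the surviving terms are c b p and -
  -- b c p; the other two kinds rotate this.
  φ-sum : ∀ k w {i₀} → HasKinds a b c ((k , i₀) ∷ w) → Σℚ (allFin n) (λ i → φ ((k , i) ∷ w)) ≡ 0ℚ
  φ-sum k w {i₀} h = begin
    Σℚ (allFin n) (λ i → φ ((k , i) ∷ w))
      ≡⟨ ≡.trans (Σℚ-+ (allFin n) (λ i → toℚ c ℚ.* D 0F 1F ((k , i) ∷ w)) _)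
           (cong (Σℚ (allFin n) (λ i → toℚ c ℚ.* D 0F 1F ((k , i) ∷ w)) ℚ.+_) (Σℚ-+ (allFin n) (λ i → toℚ a ℚ.* D 1F 2F ((k , i) ∷ w)) _)) ⟩
    Σℚ (allFin n) (λ i → toℚ c ℚ.* D 0F 1F ((k , i) ∷ w)) ℚ.+
      (Σℚ (allFin n) (λ i → toℚ a ℚ.* D 1F 2F ((k , i) ∷ w)) ℚ.+ Σℚ (allFin n) (λ i → toℚ b ℚ.* D 2F 0F ((k , i) ∷ w)))
      ≡⟨ ≡.cong₂ ℚ._+_ (term 0F 1F c) (≡.cong₂ ℚ._+_ (term 1F 2F a) (term 2F 0F b)) ⟩
    toℚ c ℚ.* contracted 0F 1F ℚ.+ (toℚ a ℚ.* contracted 1F 2F ℚ.+ toℚ b ℚ.* contracted 2F 0F)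
      ≡⟨ cancelled k {i₀} h ⟩
    0ℚ ∎
    where
    open ≡.≡-Reasoning
    p = ψ (map proj₂ w)
    contracted : Fin 3 → Fin 3 → ℚ
    contracted x y = ⟦ k Finₚ.≟ x ⟧ ℚ.* (toℚ (count y w) ℚ.* p) ℚ.+ ℚ.- (⟦ k Finₚ.≟ y ⟧ ℚ.* (toℚ (count x w) ℚ.* p))
    term : ∀ x y q → Σℚ (allFin n) (λ i → toℚ q ℚ.* D x y ((k , i) ∷ w)) ≡ toℚ q ℚ.* contracted x y
    term x y q = ≡.trans (Σℚ-* (allFin n) (toℚ q) _) (cong (toℚ q ℚ.*_) (D-sum x y k w))
    cancelled : ∀ k {i₀} → HasKinds a b c ((k , i₀) ∷ w) →
      let contracted x y = ⟦ k Finₚ.≟ x ⟧ ℚ.* (toℚ (count y w) ℚ.* p) ℚ.+ ℚ.- (⟦ k Finₚ.≟ y ⟧ ℚ.* (toℚ (count x w) ℚ.* p)) in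
      toℚ c ℚ.* contracted 0F 1F ℚ.+ (toℚ a ℚ.* contracted 1F 2F ℚ.+ toℚ b ℚ.* contracted 2F 0F) ≡ 0ℚ
    cancelled 0F (_ , refl , refl) = solve 5 (λ a x b c p →
        c :* (con 1ℚ :* (b :* p) :+ :- (con 0ℚ :* (x :* p))) :+ (a :* (con 0ℚ :* (c :* p) :+ :- (con 0ℚ :* (b :* p)))
          :+ b :* (con 0ℚ :* (x :* p) :+ :- (con 1ℚ :* (c :* p)))) := con 0ℚ) refl
        (toℚ a) (toℚ (count 0F w)) (toℚ (count 1F w)) (toℚ (count 2F w)) p
      where open +-*-Solver using (solve; _:*_; _:+_; :-_; _:=_; con)
    cancelled 1F (refl , _ , refl) = solve 5 (λ b x a c p →
        c :* (con 0ℚ :* (x :* p) :+ :- (con 1ℚ :* (a :* p))) :+ (a :* (con 1ℚ :* (c :* p) :+ :- (con 0ℚ :* (x :* p)))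
          :+ b :* (con 0ℚ :* (a :* p) :+ :- (con 0ℚ :* (c :* p)))) := con 0ℚ) refl
        (toℚ b) (toℚ (count 1F w)) (toℚ (count 0F w)) (toℚ (count 2F w)) p
      where open +-*-Solver using (solve; _:*_; _:+_; :-_; _:=_; con)
    cancelled 2F (refl , refl , _) = solve 5 (λ c x a b p →
        c :* (con 0ℚ :* (b :* p) :+ :- (con 0ℚ :* (a :* p))) :+ (a :* (con 0ℚ :* (x :* p) :+ :- (con 1ℚ :* (b :* p)))
          :+ b :* (con 1ℚ :* (a :* p) :+ :- (con 0ℚ :* (x :* p)))) := con 0ℚ) refl
        (toℚ c) (toℚ (count 2F w)) (toℚ (count 0F w)) (toℚ (count 1F w)) p
      where open +-*-Solver using (solve; _:*_; _:+_; :-_; _:=_; con)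

  Φ₁ Φ₂ : Word n → ℚ
  Φ₁ w = χ a b c w ℚ.* ψ (map proj₂ w)
  Φ₂ w = χ a b c w ℚ.* φ w

  -- `Vanishing` has the summed letter at the end and `φ-sum` at the front; the sign between the two
  -- depends on w alone.
  Φ₂-sum : Fin n → ∀ w k → Σℚ (allFin n) (λ i → Φ₂ (w ++ (k , i) ∷ [])) ≡ 0ℚ
  Φ₂-sum i₀ w k = ≡.trans (Σℚ-cong (allFin n) (λ i _ → to-front w Φ₂ (Φ-alt {φ} φ-alt) (k , i)))
    (≡.trans (Σℚ-* (allFin n) (sign w) (λ i → Φ₂ ((k , i) ∷ w))) (≡.trans (cong (sign w ℚ.*_)
      (≡.trans (Σℚ-* (allFin n) (χ a b c ((k , i₀) ∷ w)) (λ i → φ ((k , i) ∷ w))) (weighted (hasKinds? a b c ((k , i₀) ∷ w))))) (ℚₚ.*-zeroʳ (sign w))))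
    where
    sign : Word n → ℚ
    sign []      = 1ℚ
    sign (_ ∷ w) = ℚ.- sign w
    to-front : ∀ w (M : Word n → ℚ) → Alt ℚ⁺ M → ∀ v → M (w ++ v ∷ []) ≡ sign w ℚ.* M (v ∷ w)
    to-front []      M alt v = ≡.sym (ℚₚ.*-identityˡ (M (v ∷ [])))
    to-front (x ∷ w) M alt v = ≡.trans (to-front w (λ u → M (x ∷ u)) (λ u → alt (x ∷ u)) v)
      (≡.trans (cong (sign w ℚ.*_) (alt [] x v w)) (solve 2 (λ s m → s :* (:- m) := (:- s) :* m) refl (sign w) (M (v ∷ x ∷ w))))
      where open +-*-Solver using (solve; _:*_; _:+_; :-_; _:=_)
    weighted : Dec (HasKinds a b c ((k , i₀) ∷ w)) → χ a b c ((k , i₀) ∷ w) ℚ.* Σℚ (allFin n) (λ i → φ ((k , i) ∷ w)) ≡ 0ℚ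
    weighted (yes h) = ≡.trans (cong (χ a b c ((k , i₀) ∷ w) ℚ.*_) (φ-sum k w {i₀} h)) (ℚₚ.*-zeroʳ (χ a b c ((k , i₀) ∷ w)))
    weighted (no ¬h) = ≡.trans (cong (ℚ._* Σℚ (allFin n) (λ i → φ ((k , i) ∷ w))) (⟦⟧-no (hasKinds? a b c ((k , i₀) ∷ w)) ¬h))
      (ℚₚ.*-zeroˡ (Σℚ (allFin n) (λ i → φ ((k , i) ∷ w))))

-- The list omits the index 0 alone: j = 0 completes it to the sorted list of all indices, and any
-- other j repeats an entry.
ψ-tail : ∀ N → ψ {suc N} (Data.List.tabulate Fin.suc) ≡ 1ℚ
ψ-tail N = ≡.trans (≡.cong₂ ℚ._+_ (top-allFin {suc N})
    (Σℚ-0 (Data.List.tabulate {n = N} Fin.suc) {λ j → top (j ∷ Data.List.tabulate Fin.suc)} (λ i i∈ → top-repeated {l = i ∷ Data.List.tabulate Fin.suc} λ { (a ∷ _) → All≢⇒∉ a i∈ })))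
  (ℚₚ.+-identityʳ 1ℚ)

toℚ-nonneg : ∀ k → 0ℚ ℚ.≤ toℚ k
toℚ-nonneg zero    = ℚₚ.≤-refl
toℚ-nonneg (suc k) = ℚₚ.+-mono-≤ {0ℚ} {1ℚ} {0ℚ} {toℚ k} (ℚₚ.nonNegative⁻¹ 1ℚ) (toℚ-nonneg k)

toℚ-suc≢0 : ∀ k → toℚ (suc k) ≢ 0ℚ
toℚ-suc≢0 k e = ℚₚ.<⇒≢ (ℚₚ.+-mono-<-≤ {0ℚ} {1ℚ} {0ℚ} {toℚ k} (ℚₚ.positive⁻¹ 1ℚ) (toℚ-nonneg k)) (≡.sym e)

-- Functionals that detect the nonzero classes

record Detector {n} (x₀ : Word n) : Set where
  field
    detect      : Word n → ℚ
    alternating : Alt ℚ⁺ detect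
    antisymm    : ∀ {i j} → i ≢ j → ∀ w → detect (relabel (tr i j) w) ≡ ℚ.- detect w
    ideal-zero  : ∀ {f} → InI f → extend detect f ≡ 0ℚ
    nonzero-x₀  : detect x₀ ≢ 0ℚ

tailIndices : ∀ N → List (Fin (suc N))
tailIndices N = Data.List.tabulate Fin.suc

place-kinds : ∀ {n} ks (l : List (Fin n)) → length ks ≡ length l → map proj₁ (place (singletons ks) l) ≡ ks × map proj₂ (place (singletons ks) l) ≡ l
place-kinds []       []      e = refl , refl
place-kinds (k ∷ ks) (i ∷ l) e with x , y ← place-kinds ks l (ℕₚ.suc-injective e) = cong (k ∷_) x , cong (i ∷_) y

detector₁ : ∀ {N} a b c → a ℕ.+ b ℕ.+ c ≡ N → length (kindList a b c) ≡ N → Detector (place (singletons (kindList a b c)) (tailIndices N))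
detector₁ {N} a b c e len = record
  { detect = Φ₁ a b c
  ; alternating = ψ-alt′
  ; antisymm = anti
  ; ideal-zero = λ {f} → Vanishing.vanishes (Φ₁ a b c) ψ-alt′ anti (a ℕ.+ b ℕ.+ c) (Φ-support a b c (ψ ∘ map proj₂)) Fin.zero
      (ℕₚ.≤-trans (ℕₚ.≤-reflexive e) (ℕₚ.n≤1+n N)) (λ e′ → ⊥-elim (ℕₚ.1+n≢n (≡.trans (≡.sym e′) e))) {f}
  ; nonzero-x₀ = λ z → case ≡.trans (≡.sym value) z of λ ()
  }
  where
  ψ-alt′ = Φ-alt a b c {ψ ∘ map proj₂} (map-alt {L = ψ {suc N}} proj₂ ψ-alt)
  anti : ∀ {i j} → i ≢ j → ∀ w → Φ₁ a b c (relabel (tr i j) w) ≡ ℚ.- Φ₁ {suc N} a b c w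
  anti = Φ-anti a b c {ψ ∘ map proj₂} (λ {i} {j} d w → ≡.trans (cong ψ (indices-relabel (tr i j) w)) (ψ-anti d (map proj₂ w)))
  x₀ = place (singletons (kindList a b c)) (tailIndices N)
  shape = place-kinds (kindList a b c) (tailIndices N) (≡.trans len (≡.sym (Listₚ.length-tabulate {n = N} Fin.suc)))
  value : Φ₁ a b c x₀ ≡ 1ℚ
  value = ≡.cong₂ ℚ._*_ (⟦⟧-yes (hasKinds? a b c x₀) (kinds↭⇒hasKinds {w = x₀} (↭-reflexive (proj₁ shape))))
    (≡.trans (cong ψ (proj₂ shape)) (ψ-tail N))

secondBlocks : ℕ → ℕ → ℕ → List (List (Fin 3))
secondBlocks a b c = (0F ∷ 1F ∷ []) ∷ (2F ∷ []) ∷ singletons (kindList a b c)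

detector₂ : ∀ {N} a b c → 3 ℕ.+ (a ℕ.+ b ℕ.+ c) ≡ suc N → 2 ℕ.+ length (kindList a b c) ≡ N →
            Detector (place (secondBlocks a b c) (tailIndices N))
detector₂ {N} a b c e len = record
  { detect = Φ₂ (suc a) (suc b) (suc c)
  ; alternating = alt
  ; antisymm = anti
  ; ideal-zero = λ {f} → Vanishing.vanishes (Φ₂ (suc a) (suc b) (suc c)) alt anti d (Φ-support (suc a) (suc b) (suc c) (φ (suc a) (suc b) (suc c))) Fin.zero
      (ℕₚ.≤-reflexive d≡) (λ _ w _ k → Φ₂-sum (suc a) (suc b) (suc c) Fin.zero w k) {f}
  ; nonzero-x₀ = nonzero (tailIndices N) (≡.trans (Listₚ.length-tabulate {n = N} Fin.suc) (≡.sym len)) (Uniqueₚ.tabulate⁺ Finₚ.suc-injective) (ψ-tail N)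
  }
  where
  d = suc a ℕ.+ suc b ℕ.+ suc c
  d≡ : d ≡ suc N
  d≡ = ≡.trans (cong suc (≡.trans (ℕₚ.+-suc (a ℕ.+ suc b) c) (cong (λ x → suc (x ℕ.+ c)) (ℕₚ.+-suc a b)))) e
  alt = Φ-alt (suc a) (suc b) (suc c) {φ (suc a) (suc b) (suc c)} (φ-alt (suc a) (suc b) (suc c))
  anti : ∀ {i j} → i ≢ j → ∀ w → Φ₂ (suc a) (suc b) (suc c) (relabel (tr i j) w) ≡ ℚ.- Φ₂ {suc N} (suc a) (suc b) (suc c) w
  anti = Φ-anti (suc a) (suc b) (suc c) {φ (suc a) (suc b) (suc c)} (φ-anti (suc a) (suc b) (suc c))
  one-kind : ∀ {k l i} {w : Word (suc N)} → Unique (map proj₂ w) → (k , i) ∈ w → (l , i) ∈ w → k ≡ l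
  one-kind (a ∷ u) (here refl) (here refl) = refl
  one-kind (a ∷ u) (here refl) (there q)   = ⊥-elim (All≢⇒∉ a (occurs⁻ q))
  one-kind (a ∷ u) (there p)   (here refl) = ⊥-elim (All≢⇒∉ a (occurs⁻ p))
  one-kind (a ∷ u) (there p)   (there q)   = one-kind u p q
  separate : ∀ {k l} (w : Word (suc N)) → k ≢ l → (∀ i → (k , i) ∈ w → (l , i) ∉ w) → ∀ i → (k , i) ∉ w ⊎ (l , i) ∉ w
  separate {k} w d h i with (k , i) ∈? w
    where open import Data.List.Membership.DecPropositional (_≟ᵥ_ {suc N}) using (_∈?_)
  ... | yes p = inj₂ (h i p)
  ... | no ¬p = inj₁ ¬p
  nonzero : ∀ l → length l ≡ 2 ℕ.+ length (kindList a b c) → Unique l → ψ l ≡ 1ℚ →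
            Φ₂ (suc a) (suc b) (suc c) (place (secondBlocks a b c) l) ≢ 0ℚ
  nonzero (m ∷ i ∷ l) len u ψ≡1 z = toℚ-suc≢0 c (≡.trans (≡.sym value) z)
    where
    open ≡.≡-Reasoning
    G = place (singletons (kindList a b c)) l
    shape = place-kinds (kindList a b c) l (≡.sym (ℕₚ.suc-injective (ℕₚ.suc-injective len)))
    w = (2F , i) ∷ G
    x₀ = (0F , m) ∷ (1F , m) ∷ w
    u′ : Unique (m ∷ map proj₂ w)
    u′ = subst (λ t → Unique (m ∷ i ∷ t)) (≡.sym (proj₂ shape)) u
    fm : Free m w
    fm with x ∷ _ ← u′ = ∉⇒Free (All≢⇒∉ x)
    uw : Unique (map proj₂ w)
    uw with _ ∷ y ← u′ = y
    kinds-x₀ : HasKinds (suc a) (suc b) (suc c) x₀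
    kinds-x₀ with x , y , t ← kinds↭⇒hasKinds {w = G} (↭-reflexive (proj₁ shape)) = cong suc x , cong suc y , cong suc t
    d₀₁ : D 0F 1F x₀ ≡ 1ℚ
    d₀₁ = ≡.trans (D-pair 0F 1F m w (λ ()) fm (separate w (λ ()) (λ j p q → case one-kind uw p q of λ ())))
      (≡.trans (cong (λ t → ψ (m ∷ i ∷ t)) (proj₂ shape)) ψ≡1)
    d₁₂ : D 1F 2F x₀ ≡ 0ℚ
    d₁₂ = D-zero 1F 2F x₀ (separate x₀ (λ ()) λ { j (there (here refl)) (there (there q)) → Free⇒∉ᵥ fm q
                                                ; j (there (there p)) (there (there q)) → case one-kind uw p q of λ () })
    d₂₀ : D 2F 0F x₀ ≡ 0ℚ
    d₂₀ = D-zero 2F 0F x₀ (separate x₀ (λ ()) λ { j (there (there p)) (here refl) → Free⇒∉ᵥ fm p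
                                                ; j (there (there p)) (there (there q)) → case one-kind uw p q of λ () })
    -- The only pair of the reference word has the kinds θ and ξ, so one contraction survives; its
    -- weight is the number of letters ρ.
    value : Φ₂ (suc a) (suc b) (suc c) x₀ ≡ toℚ (suc c)
    value = begin
      χ (suc a) (suc b) (suc c) x₀ ℚ.* φ (suc a) (suc b) (suc c) x₀
        ≡⟨ ≡.cong₂ ℚ._*_ (⟦⟧-yes (hasKinds? (suc a) (suc b) (suc c) x₀) kinds-x₀)
             (≡.cong₂ (λ x y → toℚ (suc c) ℚ.* x ℚ.+ y) d₀₁ (≡.cong₂ (λ x y → toℚ (suc a) ℚ.* x ℚ.+ toℚ (suc b) ℚ.* y) d₁₂ d₂₀)) ⟩
      1ℚ ℚ.* (toℚ (suc c) ℚ.* 1ℚ ℚ.+ (toℚ (suc a) ℚ.* 0ℚ ℚ.+ toℚ (suc b) ℚ.* 0ℚ))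
        ≡⟨ solve 3 (λ a b c → con 1ℚ :* (c :* con 1ℚ :+ (a :* con 0ℚ :+ b :* con 0ℚ)) := c) refl (toℚ (suc a)) (toℚ (suc b)) (toℚ (suc c)) ⟩
      toℚ (suc c) ∎
      where open +-*-Solver using (solve; _:*_; _:+_; :-_; _:=_; con)

-- Counting tableaux

#_ : ∀ {A : Set} → (A → Bool) → List A → ℕ
(# p) l = length (filter (λ x → p x Bool.≟ true) l)

#-∷ : ∀ {A : Set} (p : A → Bool) x l → (# p) (x ∷ l) ≡ (if p x then 1 else 0) ℕ.+ (# p) l
#-∷ p x l with p x
... | true  = refl
... | false = refl

#-++ : ∀ {A : Set} (p : A → Bool) l m → (# p) (l ++ m) ≡ (# p) l ℕ.+ (# p) m
#-++ p l m = ≡.trans (cong length (Listₚ.filter-++ (λ x → p x Bool.≟ true) l m)) (Listₚ.length-++ (filter (λ x → p x Bool.≟ true) l))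

#-map : ∀ {A B : Set} (p : B → Bool) (f : A → B) l → (# p) (map f l) ≡ (# (p ∘ f)) l
#-map p f []      = refl
#-map p f (x ∷ l) = ≡.trans (#-∷ p (f x) (map f l)) (≡.trans (cong (_ ℕ.+_) (#-map p f l)) (≡.sym (#-∷ (p ∘ f) x l)))

#-cong : ∀ {A : Set} {p q : A → Bool} → (∀ x → p x ≡ q x) → ∀ l → (# p) l ≡ (# q) l
#-cong e []      = refl
#-cong {p = p} {q} e (x ∷ l) = ≡.trans (#-∷ p x l) (≡.trans (≡.cong₂ (λ b k → (if b then 1 else 0) ℕ.+ k) (e x) (#-cong e l)) (≡.sym (#-∷ q x l)))

#-none : ∀ {A : Set} {p : A → Bool} → (∀ x → p x ≡ false) → ∀ l → (# p) l ≡ 0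
#-none e []      = refl
#-none {p = p} e (x ∷ l) = ≡.trans (#-∷ p x l) (≡.cong₂ (λ b k → (if b then 1 else 0) ℕ.+ k) (e x) (#-none e l))

#-concatMap : ∀ {A B : Set} (p : B → Bool) (q : A → Bool) (g : A → List B) →
              (∀ x → (# p) (g x) ≡ (if q x then 1 else 0)) → ∀ l → (# p) (concatMap g l) ≡ (# q) l
#-concatMap p q g e []      = refl
#-concatMap p q g e (x ∷ l) = ≡.trans (#-++ p (g x) (concatMap g l)) (≡.trans (≡.cong₂ ℕ._+_ (e x) (#-concatMap p q g e l)) (≡.sym (#-∷ q x l)))

#-words : ∀ (p : List (Fin 3) → Bool) ℓ → (# p) (words3 (suc ℓ)) ≡
  (# (p ∘ (0F ∷_))) (words3 ℓ) ℕ.+ ((# (p ∘ (1F ∷_))) (words3 ℓ) ℕ.+ (# (p ∘ (2F ∷_))) (words3 ℓ))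
#-words p ℓ = ≡.trans (#-++ p (map (0F ∷_) W) _) (≡.cong₂ ℕ._+_ (#-map p (0F ∷_) W)
  (≡.trans (#-++ p (map (1F ∷_) W) _) (≡.cong₂ ℕ._+_ (#-map p (1F ∷_) W)
    (≡.trans (#-++ p (map (2F ∷_) W) []) (≡.trans (ℕₚ.+-identityʳ _) (#-map p (2F ∷_) W))))))
  where W = words3 ℓ

occ : ℕ → List (Fin 3) → ℕ
occ k r = length (filter (λ x → Fin.toℕ x ℕ.≟ k) r)

content : ℕ → ℕ → ℕ → List (Fin 3) → Bool
content a b c r = (occ 0 r ℕ.≡ᵇ a) ∧ (occ 1 r ℕ.≡ᵇ b) ∧ (occ 2 r ℕ.≡ᵇ c)

incr : ℕ → List (Fin 3) → Bool
incr k []      = true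
incr k (x ∷ r) = (k ℕ.≤ᵇ Fin.toℕ x) ∧ incr (Fin.toℕ x) r

weaklyIncr-∷ : ∀ x r → weaklyIncr (x ∷ r) ≡ incr (Fin.toℕ x) r
weaklyIncr-∷ x []      = refl
weaklyIncr-∷ x (y ∷ r) = cong ((Fin.toℕ x ℕ.≤ᵇ Fin.toℕ y) ∧_) (weaklyIncr-∷ y r)

weaklyIncr-incr : ∀ r → weaklyIncr r ≡ incr 0 r
weaklyIncr-incr []      = refl
weaklyIncr-incr (x ∷ r) = weaklyIncr-∷ x r

∧-false : ∀ {b} → (b ∧ false) ≡ false
∧-false {b} = Boolₚ.∧-zeroʳ b

∧∧-zero : ∀ x {y} z → y ≡ false → x ∧ z ∧ y ≡ false
∧∧-zero x z refl = ≡.trans (cong (x ∧_) (Boolₚ.∧-zeroʳ z)) (Boolₚ.∧-zeroʳ x)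

drop₀ : ∀ {x} y → x ≡ 0 → x ℕ.+ y ≡ y
drop₀ y refl = refl

-- A weakly increasing word is determined by its content. After a first letter x the rest is counted
-- with the lower bound x, so the bounds 2, 1, 0 are treated in this order.
count₂ : ∀ ℓ a b c → (# (λ r → incr 2 r ∧ content a b c r)) (words3 ℓ) ≡ (if (a ℕ.≡ᵇ 0) ∧ (b ℕ.≡ᵇ 0) ∧ (c ℕ.≡ᵇ ℓ) then 1 else 0)
count₂ zero    zero    zero    zero    = refl
count₂ zero    zero    zero    (suc c) = refl
count₂ zero    zero    (suc b) c       = refl
count₂ zero    (suc a) b       c       = refl
count₂ (suc ℓ) a b c = ≡.trans (#-words (λ r → incr 2 r ∧ content a b c r) ℓ)
  (≡.trans (drop₀ _ (#-none (λ _ → refl) (words3 ℓ))) (≡.trans (drop₀ _ (#-none (λ _ → refl) (words3 ℓ))) (last c)))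
  where
  last : ∀ c → (# (λ r → incr 2 r ∧ content a b c (2F ∷ r))) (words3 ℓ) ≡ (if (a ℕ.≡ᵇ 0) ∧ (b ℕ.≡ᵇ 0) ∧ (c ℕ.≡ᵇ suc ℓ) then 1 else 0)
  last zero    = ≡.trans (#-none (λ r → ≡.trans (cong (incr 2 r ∧_) (∧∧-zero (occ 0 r ℕ.≡ᵇ a) (occ 1 r ℕ.≡ᵇ b) refl)) ∧-false) (words3 ℓ))
    (≡.sym (cong (if_then 1 else 0) (∧∧-zero (a ℕ.≡ᵇ 0) (b ℕ.≡ᵇ 0) refl)))
  last (suc c) = count₂ ℓ a b c

count₁ : ∀ ℓ a b c → (# (λ r → incr 1 r ∧ content a b c r)) (words3 ℓ) ≡ (if (a ℕ.≡ᵇ 0) ∧ (b ℕ.+ c ℕ.≡ᵇ ℓ) then 1 else 0)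
count₁ zero    zero    zero    zero    = refl
count₁ zero    zero    zero    (suc c) = refl
count₁ zero    zero    (suc b) c       = refl
count₁ zero    (suc a) b       c       = refl
count₁ (suc ℓ) a b c = ≡.trans (#-words (λ r → incr 1 r ∧ content a b c r) ℓ)
  (≡.trans (drop₀ _ (#-none (λ _ → refl) (words3 ℓ))) (rest b c))
  where
  rest : ∀ b c → (# (λ r → incr 1 r ∧ content a b c (1F ∷ r))) (words3 ℓ) ℕ.+ (# (λ r → incr 2 r ∧ content a b c (2F ∷ r))) (words3 ℓ) ≡
         (if (a ℕ.≡ᵇ 0) ∧ (b ℕ.+ c ℕ.≡ᵇ suc ℓ) then 1 else 0)
  rest zero zero = ≡.trans (≡.cong₂ ℕ._+_
      (#-none (λ r → ≡.trans (cong (incr 1 r ∧_) ∧-false) ∧-false) (words3 ℓ))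
      (#-none (λ r → ≡.trans (cong (incr 2 r ∧_) (∧∧-zero (occ 0 r ℕ.≡ᵇ a) (occ 1 r ℕ.≡ᵇ 0) refl)) ∧-false) (words3 ℓ)))
    (≡.sym (cong (if_then 1 else 0) ∧-false))
  rest zero (suc c) = ≡.cong₂ ℕ._+_
      (#-none (λ r → ≡.trans (cong (incr 1 r ∧_) ∧-false) ∧-false) (words3 ℓ)) (count₂ ℓ a 0 c)
  rest (suc b) zero = ≡.trans (≡.cong₂ ℕ._+_ (count₁ ℓ a b 0)
      (#-none (λ r → ≡.trans (cong (incr 2 r ∧_) (∧∧-zero (occ 0 r ℕ.≡ᵇ a) (occ 1 r ℕ.≡ᵇ suc b) refl)) ∧-false) (words3 ℓ))) (ℕₚ.+-identityʳ _)
  rest (suc b) (suc c) = ≡.trans (≡.cong₂ ℕ._+_ (count₁ ℓ a b (suc c))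
      (≡.trans (count₂ ℓ a (suc b) c) (cong (if_then 1 else 0) ∧-false))) (ℕₚ.+-identityʳ _)

count₀ : ∀ ℓ a b c → (# (λ r → incr 0 r ∧ content a b c r)) (words3 ℓ) ≡ hcomp ℓ a b c
count₀ zero    zero    zero    zero    = refl
count₀ zero    zero    zero    (suc c) = refl
count₀ zero    zero    (suc b) c       = refl
count₀ zero    (suc a) b       c       = refl
count₀ (suc ℓ) (suc a) b c = ≡.trans (#-words (λ r → incr 0 r ∧ content (suc a) b c r) ℓ)
  (≡.trans (≡.cong₂ ℕ._+_ (count₀ ℓ a b c) (≡.cong₂ ℕ._+_ (first b) (second c))) (ℕₚ.+-identityʳ _))
  where
  first : ∀ b → (# (λ r → incr 1 r ∧ content (suc a) b c (1F ∷ r))) (words3 ℓ) ≡ 0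
  first zero    = #-none (λ r → ≡.trans (cong (incr 1 r ∧_) ∧-false) ∧-false) (words3 ℓ)
  first (suc b) = count₁ ℓ (suc a) b c
  second : ∀ c → (# (λ r → incr 2 r ∧ content (suc a) b c (2F ∷ r))) (words3 ℓ) ≡ 0
  second zero    = #-none (λ r → ≡.trans (cong (incr 2 r ∧_) (∧∧-zero (occ 0 r ℕ.≡ᵇ suc a) (occ 1 r ℕ.≡ᵇ b) refl)) ∧-false) (words3 ℓ)
  second (suc c) = count₂ ℓ (suc a) b c
count₀ (suc ℓ) zero b c = ≡.trans (#-words (λ r → incr 0 r ∧ content zero b c r) ℓ)
  (≡.trans (drop₀ _ (#-none (λ r → ∧-false) (words3 ℓ))) (≡.trans (≡.sym (≡.trans (#-words (λ r → incr 1 r ∧ content zero b c r) ℓ)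
    (drop₀ _ (#-none (λ _ → refl) (words3 ℓ))))) (count₁ (suc ℓ) 0 b c)))

schur-row : ∀ N a b c → schur (N ∷ []) a b c ≡ hcomp N a b c
schur-row N a b c = ≡.trans (#-concatMap (λ T → isSSYT T ∧ contentIs a b c T) (λ r → incr 0 r ∧ content a b c r) _ one (words3 N)) (count₀ N a b c)
  where
  one : ∀ r → (# (λ T → isSSYT T ∧ contentIs a b c T)) ((r ∷ []) ∷ []) ≡ (if incr 0 r ∧ content a b c r then 1 else 0)
  one r = ≡.trans (#-∷ (λ T → isSSYT T ∧ contentIs a b c T) (r ∷ []) []) (≡.trans (ℕₚ.+-identityʳ _)
    (cong (if_then 1 else 0) (≡.cong₂ _∧_ (weaklyIncr-incr r) (cong (content a b c) (Listₚ.++-identityʳ r)))))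

-- The first column of a hook with three rows must read 0, 1, 2 strictly, so the first row starts
-- with 0 and the two lower rows are forced.
hookRow : ℕ → ℕ → ℕ → List (Fin 3) → Bool
hookRow a b c (0F ∷ r) = weaklyIncr (0F ∷ r) ∧ content a b c ((0F ∷ r) ++ 1F ∷ 2F ∷ [])
hookRow a b c _        = false

schur-hook : ∀ M a b c → schur (suc M ∷ 1 ∷ 1 ∷ []) a b c ≡ uvw* (hcomp M) a b c
schur-hook M a b c = ≡.trans (#-concatMap (λ T → isSSYT T ∧ contentIs a b c T) (hookRow a b c) _ rows (words3 (suc M)))
  (≡.trans (#-words (hookRow a b c) M) (≡.trans (≡.cong₂ ℕ._+_ (start a b c)
    (≡.cong₂ ℕ._+_ (#-none (λ _ → refl) (words3 M)) (#-none (λ _ → refl) (words3 M)))) (ℕₚ.+-identityʳ _)))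
  where
  indicator : List (List (Fin 3)) → ℕ → ℕ
  indicator T k = (if isSSYT T ∧ contentIs a b c T then 1 else 0) ℕ.+ k
  #-sum : ∀ l → (# (λ T → isSSYT T ∧ contentIs a b c T)) l ≡ foldr indicator 0 l
  #-sum []      = refl
  #-sum (T ∷ l) = ≡.trans (#-∷ (λ T → isSSYT T ∧ contentIs a b c T) T l) (cong (_ ℕ.+_) (#-sum l))
  -- For a first row with known first entry the nine choices of the lower entries are evaluated
  -- outright, and at most one passes the column tests.
  evaluated : ∀ r → foldr indicator 0 (map (r ∷_) (fillings (1 ∷ 1 ∷ []))) ≡ (if hookRow a b c r then 1 else 0)
  evaluated [] = refl
  evaluated (0F ∷ r) with weaklyIncr (0F ∷ r)
  ... | false = refl
  ... | true  = ℕₚ.+-identityʳ _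
  evaluated (1F ∷ r) with weaklyIncr (1F ∷ r)
  ... | false = refl
  ... | true  = refl
  evaluated (2F ∷ r) with weaklyIncr (2F ∷ r)
  ... | false = refl
  ... | true  = refl
  rows : ∀ r → (# (λ T → isSSYT T ∧ contentIs a b c T)) (map (r ∷_) (fillings (1 ∷ 1 ∷ []))) ≡ (if hookRow a b c r then 1 else 0)
  rows r = ≡.trans (#-sum (map (r ∷_) (fillings (1 ∷ 1 ∷ [])))) (evaluated r)
  occ-++ : ∀ k r s → occ k (r ++ s) ≡ occ k s ℕ.+ occ k r
  occ-++ k r s = ≡.trans (cong length (Listₚ.filter-++ (λ x → Fin.toℕ x ℕ.≟ k) r s))
    (≡.trans (Listₚ.length-++ (filter (λ x → Fin.toℕ x ℕ.≟ k) r)) (ℕₚ.+-comm (occ k r) (occ k s)))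
  shifted : ∀ a b c r → content a b c ((0F ∷ r) ++ 1F ∷ 2F ∷ []) ≡
            (suc (occ 0 r) ℕ.≡ᵇ a) ∧ (suc (occ 1 r) ℕ.≡ᵇ b) ∧ (suc (occ 2 r) ℕ.≡ᵇ c)
  shifted a b c r = ≡.cong₂ (λ x y → (suc x ℕ.≡ᵇ a) ∧ y) (occ-++ 0 r (1F ∷ 2F ∷ []))
    (≡.cong₂ (λ x y → (x ℕ.≡ᵇ b) ∧ (y ℕ.≡ᵇ c)) (occ-++ 1 r (1F ∷ 2F ∷ [])) (occ-++ 2 r (1F ∷ 2F ∷ [])))
  pointwise : ∀ a b c r → hookRow a b c (0F ∷ r) ≡ incr 0 r ∧ (suc (occ 0 r) ℕ.≡ᵇ a) ∧ (suc (occ 1 r) ℕ.≡ᵇ b) ∧ (suc (occ 2 r) ℕ.≡ᵇ c)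
  pointwise a b c r = ≡.cong₂ _∧_ (weaklyIncr-∷ 0F r) (shifted a b c r)
  start : ∀ a b c → (# (hookRow a b c ∘ (0F ∷_))) (words3 M) ≡ uvw* (hcomp M) a b c
  start zero b c = #-none (λ r → ≡.trans (pointwise zero b c r) ∧-false) (words3 M)
  start (suc a) zero c = #-none (λ r → ≡.trans (pointwise (suc a) zero c r) (≡.trans (cong (incr 0 r ∧_) ∧-false) ∧-false)) (words3 M)
  start (suc a) (suc b) zero = #-none (λ r → ≡.trans (pointwise (suc a) (suc b) zero r)
    (≡.trans (cong (incr 0 r ∧_) (∧∧-zero (occ 0 r ℕ.≡ᵇ a) (occ 1 r ℕ.≡ᵇ b) refl)) ∧-false)) (words3 M)
  start (suc a) (suc b) (suc c) = ≡.trans (#-cong (pointwise (suc a) (suc b) (suc c)) (words3 M)) (count₀ M a b c)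

schur-identity : ∀ N a b c → (schur (N ∷ []) +ₚ s-n-2-1-1 (suc N)) a b c ≡ (qbinom2 (suc (suc N)) +ₚ uvw* (qbinom2 N)) a b c
schur-identity N a b c = ≡.cong₂ ℕ._+_ (schur-row N a b c) (hook N)
  where
  uvw-zero : ∀ a b c → 0 ≡ uvw* zeroₚ a b c
  uvw-zero zero b c = refl
  uvw-zero (suc a) zero c = refl
  uvw-zero (suc a) (suc b) zero = refl
  uvw-zero (suc a) (suc b) (suc c) = refl
  hook : ∀ N → s-n-2-1-1 (suc N) a b c ≡ uvw* (qbinom2 N) a b c
  hook zero          = uvw-zero a b c
  hook (suc zero)    = uvw-zero a b c
  hook (suc (suc M)) = schur-hook M a b c

quotient-Σ : ∀ {V P} (sub : Subgroup V P) {A : Set} (l : List A) f → Sums.Σl (quotient V sub) l f ≡ Sums.Σl V l f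
quotient-Σ     sub []      f = refl
quotient-Σ {V} sub (x ∷ l) f = cong (AbelianGroup._∙_ V (f x)) (quotient-Σ sub l f)

quotient-× : ∀ {V P} (sub : Subgroup V P) k x →
  Mult._×_ (AbelianGroup.monoid (quotient V sub)) k x ≡ Mult._×_ (AbelianGroup.monoid V) k x
quotient-×     sub zero    x = refl
quotient-× {V} sub (suc k) x = cong (AbelianGroup._∙_ V x) (quotient-× sub k x)

-- Homogeneous elements

module _ {n : ℕ} where

  ofKind : Fin 3 → Word n → Word n
  ofKind k = filter (λ v → proj₁ v Finₚ.≟ k)

  count-filter : ∀ k w → count k w ≡ length (ofKind k w)
  count-filter k []            = refl
  count-filter k ((l , i) ∷ w) with l Finₚ.≟ k
  ... | yes _ = cong suc (count-filter k w)
  ... | no _  = count-filter k w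

  kindOf? : ∀ (k : Fin 3) (S : Subset n) (v : Var n) → Dec (Fin.toℕ (proj₁ v) ≡ Fin.toℕ k × S v ≡ true)
  kindOf? k S v = (Fin.toℕ (proj₁ v) ℕ.≟ Fin.toℕ k) ×-dec (S v Bool.≟ true)

  good⇒count : ∀ {w : Word n} {S} → Good w S → ∀ k → countKind k S ≡ count k w
  good⇒count {w} {S} (u , h) k = ≡.trans (↭ₚ.↭-length (unique∧set⇒↭ (Uniqueₚ.filter⁺ (kindOf? k S) allVars-unique) (Uniqueₚ.filter⁺ (λ v → proj₁ v Finₚ.≟ k) u) to from))
    (≡.sym (count-filter k w))
    where
    allVars-unique : Unique (allVars n)
    allVars-unique = Uniqueₚ.cartesianProduct⁺ (Uniqueₚ.allFin⁺ 3) (Uniqueₚ.allFin⁺ n)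
    to : ∀ {v} → v ∈ filter (kindOf? k S) (allVars n) → v ∈ ofKind k w
    to {v} p with _ , a , b ← ∈-filter⁻ (kindOf? k S) {xs = allVars n} p =
      ∈-filter⁺ (λ v → proj₁ v Finₚ.≟ k) (memb⇒∈ w (≡.trans (≡.sym (h v)) b)) (Finₚ.toℕ-injective a)
    from : ∀ {v} → v ∈ ofKind k w → v ∈ filter (kindOf? k S) (allVars n)
    from {v} p with a , b ← ∈-filter⁻ (λ v → proj₁ v Finₚ.≟ k) {xs = w} p =
      ∈-filter⁺ (kindOf? k S) (∈-allVars v) (cong Fin.toℕ b , ≡.trans (h v) (∈⇒memb a))

  SetKinds : ℕ → ℕ → ℕ → Subset n → Set
  SetKinds a b c S = countKind 0F S ≡ a × countKind 1F S ≡ b × countKind 2F S ≡ c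

  setKinds? : ∀ a b c S → Dec (SetKinds a b c S)
  setKinds? a b c S = (countKind 0F S ℕ.≟ a) ×-dec (countKind 1F S ℕ.≟ b) ×-dec (countKind 2F S ℕ.≟ c)

  good-kinds : ∀ {a b c} {w : Word n} {S} → Good w S → SetKinds a b c S → HasKinds a b c w
  good-kinds {w = w} {S} g (x , y , z) = ≡.trans (≡.sym (good⇒count {w} {S} g 0F)) x , ≡.trans (≡.sym (good⇒count {w} {S} g 1F)) y , ≡.trans (≡.sym (good⇒count {w} {S} g 2F)) z

  good-kinds⁻ : ∀ {a b c} {w : Word n} {S} → Good w S → HasKinds a b c w → SetKinds a b c S
  good-kinds⁻ {w = w} {S} g (x , y , z) = ≡.trans (good⇒count {w} {S} g 0F) x , ≡.trans (good⇒count {w} {S} g 1F) y , ≡.trans (good⇒count {w} {S} g 2F) z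

  AllKinds : ℕ → ℕ → ℕ → Λ n → Set
  AllKinds a b c = All (λ t → HasKinds a b c (proj₂ t))

  coeff-zero : ∀ (f : Λ n) {S} → All (λ t → ¬ Good (proj₂ t) S) f → coeff f S ≡ 0ℚ
  coeff-zero []            []       = refl
  coeff-zero ((q , w) ∷ f) (x ∷ xs) = ≡.trans (≡.cong₂ (λ a b → q ℚ.* a ℚ.+ b) (wordCoeff-bad {w = w} x) (coeff-zero f xs))
    (cong (ℚ._+ 0ℚ) (ℚₚ.*-zeroʳ q))

  allKinds⇒Homog : ∀ {a b c} {f : Λ n} → AllKinds a b c f → Homog a b c f
  allKinds⇒Homog {a} {b} {c} {f} ks S with setKinds? a b c S
  ... | yes k = inj₂ k
  ... | no ¬k = inj₁ (coeff-zero f (All.map (λ {t} k g → ¬k (good-kinds⁻ {w = proj₂ t} {S} g k)) ks))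

  homogeneous : ℕ → ℕ → ℕ → Λ n → Λ n
  homogeneous a b c = filter (λ t → hasKinds? a b c (proj₂ t))

  -- `Homog` speaks of coefficients, so f may contain terms of other tridegrees that cancel;
  -- deleting them changes no coefficient.
  homogeneous≃ : ∀ {a b c} {f : Λ n} → Homog a b c f → f ≃ homogeneous a b c f
  homogeneous≃ {a} {b} {c} {f} hom S with setKinds? a b c S
  ... | yes k = keeps f
    where
    keeps : ∀ f → coeff f S ≡ coeff (homogeneous a b c f) S
    keeps []            = refl
    keeps ((q , w) ∷ f) with hasKinds? a b c w
    ... | yes h = ≡.trans (cong (q ℚ.* wordCoeff w S ℚ.+_) (keeps f)) (cong (λ l → coeff l S) (≡.sym (Listₚ.filter-accept (λ t → hasKinds? a b c (proj₂ t)) {x = q , w} {f} h)))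
    ... | no ¬h = ≡.trans (cong (ℚ._+ coeff f S) (≡.trans (cong (q ℚ.*_) (wordCoeff-bad {w = w} {S} λ g → ¬h (good-kinds {w = w} {S} g k))) (ℚₚ.*-zeroʳ q)))
      (≡.trans (ℚₚ.+-identityˡ _) (≡.trans (keeps f) (cong (λ l → coeff l S) (≡.sym (Listₚ.filter-reject (λ t → hasKinds? a b c (proj₂ t)) {x = q , w} {f} ¬h)))))
  ... | no ¬k with hom S
  ...   | inj₂ k = ⊥-elim (¬k k)
  ...   | inj₁ z = ≡.trans z (≡.sym (coeff-zero (homogeneous a b c f)
            (All.map (λ {t} k g → ¬k (good-kinds⁻ {w = proj₂ t} {S} g k)) (Allₚ.all-filter (λ t → hasKinds? a b c (proj₂ t)) f))))

  -- The antisymmetrisers of Λ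

  act-additive : ∀ σ → Additive (ΛGroup n) (ΛGroup n) (act σ)
  act-additive σ = record { H-cong = λ {f} {g} → act-cong σ {f} {g} ; H-∙ = λ f g → ≡⇒≃ (act-⊕ σ f g) }

  t : Fin n → Fin n → Λ n → Λ n
  t i j = act (transpose i j)

  t-sym : ∀ i j f → t i j f ≡ t j i f
  t-sym i j f = act-ext {σ = transpose i j} {transpose j i} (tr-sym i j) f

  t-inv : ∀ i j f → t i j (t i j f) ≡ f
  t-inv i j f = ≡.trans (act-∘ (transpose i j) (transpose i j) f)
    (≡.trans (act-ext {σ = transpose i j ∘ₚ transpose i j} {Perm.id} (tr-involutive i j) f) (act-id f))

  t-conj : ∀ i j k l f → t i j (t k l f) ≡ t (tr i j k) (tr i j l) (t i j f)
  t-conj i j k l f = ≡.trans (act-∘ (transpose i j) (transpose k l) f)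
    (≡.trans (act-ext {σ = transpose k l ∘ₚ transpose i j} {transpose i j ∘ₚ transpose (tr i j k) (tr i j l)} (tr-conj i j k l) f)
      (≡.sym (act-∘ (transpose (tr i j k) (tr i j l)) (transpose i j) f)))

  Λ/I : AbelianGroup 0ℓ 0ℓ
  Λ/I = quotient (ΛGroup n) (ideal-subgroup {n})

  module Λ/I = AbelianGroup Λ/I

  ≃⇒~ : ∀ {f g : Λ n} → f ≃ g → f Λ/I.≈ g
  ≃⇒~ {f} {g} e = InI-resp {f = []} {f ⊖ g} (λ S → ≡.sym (≡.trans (extend-⊖ (λ w → wordCoeff w S) f g)
    (≡.trans (cong (ℚ._+ ℚ.- coeff g S) (e S)) (ℚₚ.+-inverseʳ (coeff g S))))) InI-[]

  ≡⇒~ : ∀ {f g : Λ n} → f ≡ g → f Λ/I.≈ g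
  ≡⇒~ {f} refl = ≃⇒~ {f} {f} (λ S → refl)

  preserves⇒additive : ∀ {H : Λ n → Λ n} → Additive (ΛGroup n) (ΛGroup n) H → (∀ {f} → InI f → InI (H f)) → Additive Λ/I Λ/I H
  preserves⇒additive {H} add pres = record
    { H-cong = λ {f} {g} e → InI-resp {f = H (f ⊖ g)} {H f ⊖ H g}
        (λ S → ≡.trans (H-∙ add f ((ℚ.- 1ℚ) · g) S) (AbelianGroup.∙-cong (ΛGroup n) {H f} {H f} {H ((ℚ.- 1ℚ) · g)} {(ℚ.- 1ℚ) · H g} (λ _ → refl) (H-⁻¹ add g) S)) (pres e)
    ; H-∙ = λ f g → ≃⇒~ {H (f ⊕ g)} {H f ⊕ H g} (H-∙ add f g) }
    where open Additive

  Λ-action : TranspositionAction {n} (ΛGroup n)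
  Λ-action = record
    { t        = t
    ; additive = λ i j → act-additive (transpose i j)
    ; t-sym    = λ i j f → ≡⇒≃ (t-sym i j f)
    ; t-inv    = λ i j f → ≡⇒≃ (t-inv i j f)
    ; t-conj   = λ i j k l f → ≡⇒≃ (t-conj i j k l f) }

  Λ/I-action : TranspositionAction {n} Λ/I
  Λ/I-action = record
    { t        = t
    ; additive = λ i j → preserves⇒additive (act-additive (transpose i j)) (λ {f} → InI-act (transpose i j) {f})
    ; t-sym    = λ i j f → ≡⇒~ (t-sym i j f)
    ; t-inv    = λ i j f → ≡⇒~ (t-inv i j f)
    ; t-conj   = λ i j k l f → ≡⇒~ (t-conj i j k l f) }

  module 𝒮 = Antisymmetriser (ΛGroup n) Λ-action

  module 𝒮/I = Antisymmetriser Λ/I Λ/I-action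

  -- `𝒜` turns a transposition of its argument into a sign, which the spanning argument needs; the
  -- values of `ℬ` are themselves antisymmetric, which gives the basis element.
  𝒜 ℬ : Λ n → Λ n
  𝒜 = 𝒮.A (allFin n)
  ℬ = 𝒮.B (allFin n)

  factorial : ℚ
  factorial = toℚ (factor (allFin n))

  factorial≢0 : factorial ≢ 0ℚ
  factorial≢0 with factor (allFin n) | factor-suc (allFin n)
    where
    factor-suc : ∀ (l : List (Fin n)) → ∃ λ k → factor l ≡ suc k
    factor-suc []      = 0 , refl
    factor-suc (x ∷ l) with k , e ← factor-suc l = k ℕ.+ length l ℕ.* suc k , cong (suc (length l) ℕ.*_) e
  ... | _ | k , refl = toℚ-suc≢0 k

  -- A record around `InI (f ⊖ g)`, so that f and g can be inferred from a congruence.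
  record _∼_ (f g : Λ n) : Set where
    constructor mod-I
    field
      difference : InI (f ⊖ g)

  open _∼_

  infix 4 _∼_

  ≃⇒∼ : ∀ {f g} → f ≃ g → f ∼ g
  ≃⇒∼ {f} {g} e = mod-I (≃⇒~ {f} {g} e)

  ≡⇒∼ : ∀ {f g} → f ≡ g → f ∼ g
  ≡⇒∼ {f} {g} e = ≃⇒∼ {f} {g} (≡⇒≃ e)

  ∼-sym : ∀ {f g} → f ∼ g → g ∼ f
  ∼-sym {f} {g} (mod-I e) = mod-I (Λ/I.sym {f} {g} e)

  ∼-trans : ∀ {f g h} → f ∼ g → g ∼ h → f ∼ h
  ∼-trans {f} {g} {h} (mod-I e) (mod-I e′) = mod-I (Λ/I.trans {f} {g} {h} e e′)

  ∼-⊕ : ∀ {f f′ g g′} → f ∼ f′ → g ∼ g′ → (f ⊕ g) ∼ (f′ ⊕ g′)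
  ∼-⊕ {f} {f′} {g} {g′} (mod-I e) (mod-I e′) = mod-I (Λ/I.∙-cong {f} {f′} {g} {g′} e e′)

  ∼-· : ∀ q {f g} → f ∼ g → (q · f) ∼ (q · g)
  ∼-· q {f} {g} (mod-I e) = mod-I (InI-resp {f = q · (f ⊖ g)} {(q · f) ⊖ (q · g)}
    (≡⇒≃ (≡.trans (·-⊕ q f ((ℚ.- 1ℚ) · g)) (cong ((q · f) ⊕_) (≡.trans (·-· q (ℚ.- 1ℚ) g)
      (≡.trans (cong (_· g) (ℚₚ.*-comm q (ℚ.- 1ℚ))) (≡.sym (·-· (ℚ.- 1ℚ) q g))))))) (InI-· q {f ⊖ g} e))

  InI⇒∼[] : ∀ {f} → InI f → f ∼ []
  InI⇒∼[] {f} e = mod-I (subst InI (≡.sym (Listₚ.++-identityʳ f)) e)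

  unscale : ∀ {q} (q≢0 : q ≢ 0ℚ) (f : Λ n) → f ≡ (ℚ.1/ q) {{ℚ.≢-nonZero q≢0}} · (q · f)
  unscale {q} q≢0 f = ≡.trans (≡.sym (1· f)) (≡.trans (cong (_· f) (≡.sym (ℚₚ.*-inverseˡ q))) (≡.sym (·-· (ℚ.1/ q) q f)))
    where instance _ = ℚ.≢-nonZero q≢0

  ∼-cancel : ∀ {q f g} → q ≢ 0ℚ → (q · f) ∼ g → ∃ λ r → f ∼ (r · g)
  ∼-cancel {q} {f} q≢0 e = ℚ.1/ q , ∼-trans (≡⇒∼ (unscale q≢0 f)) (∼-· (ℚ.1/ q) e)
    where instance _ = ℚ.≢-nonZero q≢0

  ∼-cancel₂ : ∀ {q f g} → q ≢ 0ℚ → (q · f) ∼ (q · g) → f ∼ g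
  ∼-cancel₂ {q} {f} {g} q≢0 e = ∼-trans (≡⇒∼ (unscale q≢0 f)) (∼-trans (∼-· (ℚ.1/ q) e) (≡⇒∼ (≡.sym (unscale q≢0 g))))
    where instance _ = ℚ.≢-nonZero q≢0

  ×≃· : ∀ k f → Mult._×_ (AbelianGroup.monoid (ΛGroup n)) k f ≃ (toℚ k · f)
  ×≃· zero    f S = ≡.sym (0·≃[] f S)
  ×≃· (suc k) f S = ≡.trans (AbelianGroup.∙-cong (ΛGroup n) {f} {1ℚ · f} {Mult._×_ (AbelianGroup.monoid (ΛGroup n)) k f} {toℚ k · f}
    (≡⇒≃ (≡.sym (1· f))) (×≃· k f) S) (≡.sym (+· 1ℚ (toℚ k) f S))

  InI-Σ : ∀ {A : Set} (l : List A) {g : A → Λ n} → (∀ i → InI (g i)) → InI (Sums.Σl (ΛGroup n) l g)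
  InI-Σ []      h = InI-[]
  InI-Σ (x ∷ l) {g} h = InI-⊕ {f = g x} (h x) (InI-Σ l h)

  InI-A : ∀ ks {f} → InI f → InI (𝒮.A ks f)
  InI-A []       e = e
  InI-A (k ∷ ks) {f} e = InI-A ks (InI-⊕ {f = f} e (InI-· (ℚ.- 1ℚ) {Sums.Σl (ΛGroup n) ks (λ i → t i k f)}
    (InI-Σ ks {λ i → t i k f} (λ i → InI-act (transpose i k) {f} e))))

  A-· : ∀ ks q f → 𝒮.A ks (q · f) ≃ (q · 𝒮.A ks f)
  A-· []       q f S = refl
  A-· (k ∷ ks) q f S = ≡.trans (≡⇒≃ (cong (𝒮.A ks) (≡.trans (cong ((q · f) ⊕_) (≡.trans (cong ((ℚ.- 1ℚ) ·_) (pull ks))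
      (≡.trans (·-· (ℚ.- 1ℚ) q _) (≡.trans (cong (_· _) (ℚₚ.*-comm (ℚ.- 1ℚ) q)) (≡.sym (·-· q (ℚ.- 1ℚ) _)))))) (≡.sym (·-⊕ q f _)))) S)
    (A-· ks q (𝒮.X k ks f) S)
    where
    pull : ∀ l → Sums.Σl (ΛGroup n) l (λ i → t i k (q · f)) ≡ q · Sums.Σl (ΛGroup n) l (λ i → t i k f)
    pull []      = refl
    pull (i ∷ l) = ≡.trans (≡.cong₂ _⊕_ (act-· (transpose i k) q f) (pull l)) (≡.sym (·-⊕ q (t i k f) _))

  A/I≡A : ∀ ks f → 𝒮/I.A ks f ≡ 𝒮.A ks f
  A/I≡A []       f = refl
  A/I≡A (k ∷ ks) f = ≡.trans (A/I≡A ks _) (cong (λ s → 𝒮.A ks (f ⊕ ((ℚ.- 1ℚ) · s))) (quotient-Σ (ideal-subgroup {n}) ks (λ i → t i k f)))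

  SignModI : Λ n → Set
  SignModI f = ∀ σ → InI (act σ f ⊖ (sgn σ · f))

  -- Recovers a sign class from its antisymmetrisation. The hypothesis holds only modulo I, so the
  -- antisymmetriser is formed in Λ/I and identified with that of Λ.
  𝒜-scales : ∀ {f} → SignModI f → 𝒜 f ∼ (factorial · f)
  𝒜-scales {f} h = ∼-trans {𝒜 f} {𝒮/I.A (allFin n) f} (≡⇒∼ (≡.sym (A/I≡A (allFin n) f))) (∼-trans {g = multiple}
    (mod-I (𝒮/I.A-scales {f} (λ i j d → subst (λ q → InI (t i j f ⊖ (q · f))) (sgn-transpose d) (h (transpose i j))) (Uniqueₚ.allFin⁺ n)))
    (≃⇒∼ {multiple} (λ S → ≡.trans (≡⇒≃ (quotient-× (ideal-subgroup {n}) (factor (allFin n)) f) S) (×≃· (factor (allFin n)) f S))))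
    where multiple = Mult._×_ Λ/I.monoid (factor (allFin n)) f

  𝒜-anti : ∀ {i j} → i ≢ j → ∀ f → 𝒜 (t i j f) ≃ ((ℚ.- 1ℚ) · 𝒜 f)
  𝒜-anti {i} {j} d f = 𝒮.A-anti (Uniqueₚ.allFin⁺ n) d (∈-allFin i) (∈-allFin j) f

  𝒜-additive : Additive (ΛGroup n) (ΛGroup n) 𝒜
  𝒜-additive = 𝒮.A-additive (allFin n)

  𝒜ℬ : ∀ f → 𝒜 (ℬ f) ≃ (factorial · 𝒜 f)
  𝒜ℬ f S = ≡.trans (𝒮.B-scales (ΛGroup n) {𝒜} 𝒜-additive (λ i j d x → 𝒜-anti d x) (Uniqueₚ.allFin⁺ n) f S) (×≃· (factor (allFin n)) (𝒜 f) S)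

  ℬ-sign : ∀ f σ → act σ (ℬ f) ≃ (sgn σ · ℬ f)
  ℬ-sign f = antisymmetric⇒sgn (ℬ f) (λ i j d → 𝒮.B-anti (Uniqueₚ.allFin⁺ n) d (∈-allFin i) (∈-allFin j) f)

  ℬ-kinds : ∀ {a b c f} → AllKinds a b c f → AllKinds a b c (ℬ f)
  ℬ-kinds {a} {b} {c} {f} h = go (allFin n)
    where
    act-kinds : ∀ σ {g} → AllKinds a b c g → AllKinds a b c (act σ g)
    act-kinds σ {[]}          []       = []
    act-kinds σ {(q , w) ∷ g} (k ∷ ks) =
      hasKinds-cong {w = w} {relabel (σ ⟨$⟩ʳ_) w} (λ k → ≡.sym (count-relabel k (σ ⟨$⟩ʳ_) w)) k ∷ act-kinds σ ks
    sum-kinds : ∀ l k {g} → AllKinds a b c g → AllKinds a b c (Sums.Σl (ΛGroup n) l (λ i → t i k g))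
    sum-kinds []      k h = []
    sum-kinds (i ∷ l) k {g} h = Allₚ.++⁺ (act-kinds (transpose i k) {g} h) (sum-kinds l k {g} h)
    go : ∀ ks → AllKinds a b c (𝒮.B ks f)
    go []       = h
    go (k ∷ ks) = Allₚ.++⁺ (go ks) (Allₚ.map⁺ (sum-kinds ks k {𝒮.B ks f} (go ks)))

  extend-additive : ∀ {L : Word n → ℚ} → Alt ℚ⁺ L → Additive (ΛGroup n) ℚ⁺ (extend L)
  extend-additive {L} alt = record { H-cong = λ {f} {g} → extend-cong alt {f} {g} ; H-∙ = extend-++ L }

  ×ℚ : ∀ k q → Mult._×_ (AbelianGroup.monoid ℚ⁺) k q ≡ toℚ k ℚ.* q
  ×ℚ zero    q = ≡.sym (ℚₚ.*-zeroˡ q)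
  ×ℚ (suc k) q = ≡.trans (≡.cong₂ ℚ._+_ (≡.sym (ℚₚ.*-identityˡ q)) (×ℚ k q)) (≡.sym (ℚₚ.*-distribʳ-+ q 1ℚ (toℚ k)))

  detect-ℬ : ∀ {x₀ : Word n} (Δ : Detector x₀) f → extend (Detector.detect Δ) (ℬ f) ≡ factorial ℚ.* extend (Detector.detect Δ) f
  detect-ℬ Δ f = ≡.trans (𝒮.B-scales ℚ⁺ {extend detect} (extend-additive alternating)
      (λ i j d x → ≡.trans (extend-act detect (transpose i j) x) (≡.trans (extend-ext (antisymm d) x) (extend-neg detect x)))
      (Uniqueₚ.allFin⁺ n) f) (×ℚ (factor (allFin n)) (extend detect f))
    where open Detector Δ

  -- The quotient of Λ by the elements whose antisymmetrisation lies in ℚ·z + I, to which Spanning applies.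

  module Modulo (z : Λ n) where

    record P (f : Λ n) : Set where
      constructor spanned
      field
        scalar : ℚ
        equal  : 𝒜 f ∼ (scalar · z)

    open P public

    open Additive 𝒜-additive

    P-resp : ∀ {f g} → f ≃ g → P f → P g
    P-resp {f} {g} e (spanned q d) = spanned q (∼-trans (∼-sym (≃⇒∼ {𝒜 f} {𝒜 g} (H-cong {f} {g} e))) d)

    P-zero : ∀ {f} → 𝒜 f ≃ [] → P f
    P-zero {f} e = spanned 0ℚ (≃⇒∼ {𝒜 f} {0ℚ · z} (λ S → ≡.trans (e S) (≡.sym (0·≃[] z S))))

    P-⊕ : ∀ {f g} → P f → P g → P (f ⊕ g)
    P-⊕ {f} {g} (spanned q d) (spanned q′ d′) = spanned (q ℚ.+ q′) (∼-trans (≃⇒∼ {𝒜 (f ⊕ g)} {𝒜 f ⊕ 𝒜 g} (H-∙ f g))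
      (∼-trans (∼-⊕ d d′) (∼-sym (≃⇒∼ {(q ℚ.+ q′) · z} {(q · z) ⊕ (q′ · z)} (+· q q′ z)))))

    P-· : ∀ r {f} → P f → P (r · f)
    P-· r {f} (spanned q d) = spanned (r ℚ.* q)
      (∼-trans (≃⇒∼ {𝒜 (r · f)} {r · 𝒜 f} (A-· (allFin n) r f)) (∼-trans (∼-· r d) (≡⇒∼ (·-· r q z))))

    P-I : ∀ {f} → InI f → P f
    P-I {f} e = spanned 0ℚ (∼-trans (InI⇒∼[] (InI-A (allFin n) {f} e)) (∼-sym (≃⇒∼ {0ℚ · z} {[]} (0·≃[] z))))

    P-subgroup : Subgroup (ΛGroup n) P
    P-subgroup = record { resp = λ {f} {g} → P-resp {f} {g} ; P-ε = P-zero {[]} H-ε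
                        ; P-∙ = λ {f} {g} → P-⊕ {f} {g} ; P-⁻¹ = λ {f} → P-· (ℚ.- 1ℚ) {f} }

    V : AbelianGroup 0ℓ 0ℓ
    V = quotient (ΛGroup n) P-subgroup

    module V = AbelianGroup V

    P⇒≈ε : ∀ {f} → P f → f V.≈ []
    P⇒≈ε {f} p = subst P (≡.sym (Listₚ.++-identityʳ f)) p

    ≈ε⇒P : ∀ {f} → f V.≈ [] → P f
    ≈ε⇒P {f} p = subst P (Listₚ.++-identityʳ f) p

    ≃⇒≈ : ∀ {f g} → f ≃ g → f V.≈ g
    ≃⇒≈ {f} {g} e = P-resp {[]} {f ⊖ g} (λ S → ≡.sym (≡.trans (extend-⊖ (λ w → wordCoeff w S) f g)
      (≡.trans (cong (ℚ._+ ℚ.- coeff g S) (e S)) (ℚₚ.+-inverseʳ (coeff g S))))) (P-zero {[]} H-ε)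

    torsion-free : TorsionFree V
    torsion-free k f p = P⇒≈ε (P-resp {(ℚ.1/ K) · multiple} {f} (λ S → ≡.trans (·-cong (ℚ.1/ K) {multiple} {K · f}
        (λ S → ≡.trans (≡⇒≃ (quotient-× P-subgroup (suc k) f) S) (×≃· (suc k) f S)) S)
        (≡⇒≃ (≡.trans (·-· (ℚ.1/ K) K f) (≡.trans (cong (_· f) (ℚₚ.*-inverseˡ K)) (1· f))) S))
      (P-· (ℚ.1/ K) {multiple} (≈ε⇒P {multiple} p)))
      where
      K = toℚ (suc k)
      multiple = Mult._×_ V.monoid (suc k) f
      instance _ = ℚ.≢-nonZero (toℚ-suc≢0 k)

    word-alt : Alt V word
    word-alt u x y w = ≃⇒≈ {word (u ++ x ∷ y ∷ w)} {(ℚ.- 1ℚ) · word (u ++ y ∷ x ∷ w)} λ S →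
      ≡.trans (coeff-word (u ++ x ∷ y ∷ w) S) (≡.trans (wordCoeff-alt S u x y w)
        (≡.trans (cong ℚ.-_ (≡.sym (coeff-word (u ++ y ∷ x ∷ w) S)))
          (≡.trans (±-sgnℚ true _) (≡.sym (extend-· (λ w → wordCoeff w S) (ℚ.- 1ℚ) (word (u ++ y ∷ x ∷ w)))))))
      where
      coeff-word : ∀ w S → coeff (word w) S ≡ wordCoeff w S
      coeff-word w S = ≡.trans (ℚₚ.+-identityʳ _) (ℚₚ.*-identityˡ (wordCoeff w S))

    -- This is what testing `𝒜 f` instead of f in `P` achieves.
    word-anti : Antisymmetric V word
    word-anti {i} {j} d w = P-zero {word (relabel (tr i j) w) ⊖ f} λ S → begin
      coeff (𝒜 (t i j (word w) ⊖ f)) S             ≡⟨ H-∙ (t i j (word w)) ((ℚ.- 1ℚ) · f) S ⟩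
      coeff (𝒜 (t i j (word w)) ⊕ 𝒜 ((ℚ.- 1ℚ) · f)) S  ≡⟨ AbelianGroup.∙-cong (ΛGroup n) {𝒜 (t i j (word w))} {(ℚ.- 1ℚ) · 𝒜 (word w)} {𝒜 ((ℚ.- 1ℚ) · f)} {𝒜 (word w)}
                                                        (𝒜-anti d (word w)) (λ S → cong (λ g → coeff (𝒜 g) S) (≡.trans (·-· (ℚ.- 1ℚ) (ℚ.- 1ℚ) (word w)) (1· (word w)))) S ⟩
      coeff (((ℚ.- 1ℚ) · 𝒜 (word w)) ⊕ 𝒜 (word w)) S  ≡⟨ AbelianGroup.inverseˡ (ΛGroup n) (𝒜 (word w)) S ⟩
      0ℚ ∎
      where
      open ≡.≡-Reasoning
      f = (ℚ.- 1ℚ) · word w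

    open Sums V using (Σl; Σ-cong; Σ-ε; Σ-⁻¹)
    open Signs V
    open Alternating V word word-alt

    odd : ℕ → Bool
    odd zero    = false
    odd (suc k) = not (odd k)

    last-first : ∀ u x w → word (u ++ x ∷ w) V.≈ (± odd (length w)) (word (u ++ w ++ x ∷ []))
    last-first u x []      = V.refl {word (u ++ x ∷ [])}
    last-first u x (y ∷ w) = V.trans {word (u ++ x ∷ y ∷ w)} {(ℚ.- 1ℚ) · word (u ++ y ∷ x ∷ w)} {_} (word-alt u x y w)
      (V.trans {_} {(ℚ.- 1ℚ) · ((± odd (length w)) (word (u ++ y ∷ w ++ x ∷ [])))} {_}
        (V.⁻¹-cong {word (u ++ y ∷ x ∷ w)} {(± odd (length w)) (word (u ++ y ∷ w ++ x ∷ []))}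
          (≡.subst₂ (λ a b → word a V.≈ (± odd (length w)) (word b)) (Listₚ.++-assoc u (y ∷ []) (x ∷ w)) (Listₚ.++-assoc u (y ∷ []) (w ++ x ∷ []))
            (last-first (u ++ y ∷ []) x w)))
        (±-not (odd (length w)) (word (u ++ y ∷ w ++ x ∷ []))))

    -- The sign of moving a word of length k behind one of length m, letter by letter. It depends on
    -- the lengths alone.
    turned : ℕ → ℕ → Bool
    turned zero    m = false
    turned (suc k) m = odd (k ℕ.+ m) xor turned k (suc m)

    turn : ∀ u w → word (u ++ w) V.≈ (± turned (length u) (length w)) (word (w ++ u))
    turn [] w = V.reflexive (cong word (≡.sym (Listₚ.++-identityʳ w)))
    turn (x ∷ u) w = V.trans {word (x ∷ u ++ w)} {(± odd (length (u ++ w))) (word ((u ++ w) ++ x ∷ []))} {_} (last-first [] x (u ++ w))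
      (V.trans {_} {(± odd (length u ℕ.+ length w)) ((± turned (length u) (suc (length w))) (word (w ++ x ∷ u)))} {_}
        (≡.subst₂ (λ k v → (± odd k) (word v) V.≈ (± odd (length u ℕ.+ length w)) ((± turned (length u) (suc (length w))) (word (w ++ x ∷ u)))) (≡.sym (Listₚ.length-++ u)) (≡.sym (Listₚ.++-assoc u w (x ∷ [])))
          (±-cong (odd (length u ℕ.+ length w)) {word (u ++ w ++ x ∷ [])}
            (≡.subst₂ (λ m v → word (u ++ w ++ x ∷ []) V.≈ (± turned (length u) m) (word v)) (≡.trans (Listₚ.length-++ w) (ℕₚ.+-comm (length w) 1))
              (Listₚ.++-assoc w (x ∷ []) u) (turn u (w ++ x ∷ [])))))
        (±-xor (odd (length u ℕ.+ length w)) (turned (length u) (suc (length w))) (word (w ++ x ∷ u))))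

    -- In the ideal the invariant is the right factor, while the spanning part has the block in
    -- front. The sign of the move is the same for every i, so it leaves the sum.
    word-ideal : KillsPowerSums V word
    word-ideal p S w = V.trans {_} {(± s) (Σl (allFin n) (λ i → word (w ++ block (p ∷ S) i)))} {[]}
      (V.trans {_} {Σl (allFin n) (λ i → (± s) (word (w ++ block (p ∷ S) i)))} {_}
        (Σ-cong (allFin n) (λ i _ → subst (λ k → word (block (p ∷ S) i ++ w) V.≈ (± turned k (length w)) (word (w ++ block (p ∷ S) i)))
          (Listₚ.length-map (_, i) (p ∷ S)) (turn (block (p ∷ S) i) w)))
        (pull s))
      (±-ε s {Σl (allFin n) (λ i → word (w ++ block (p ∷ S) i))} (P⇒≈ε (P-I (subst InI (≡.trans (Listₚ.++-identityʳ _) (≡.sym (listed (allFin n)))) (powerSum-ideal p S w)))))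
      where
      s = turned (length (p ∷ S)) (length w)
      pull : ∀ s → Σl (allFin n) (λ i → (± s) (word (w ++ block (p ∷ S) i))) V.≈ (± s) (Σl (allFin n) (λ i → word (w ++ block (p ∷ S) i)))
      pull false = V.refl {Σl (allFin n) (λ i → word (w ++ block (p ∷ S) i))}
      pull true  = Σ-⁻¹ (allFin n) (λ i → word (w ++ block (p ∷ S) i))
      listed : ∀ l → Σl l (λ i → word (w ++ block (p ∷ S) i)) ≡ map (λ t → 1ℚ ℚ.* proj₁ t , w ++ proj₂ t) (map (λ i → 1ℚ , block (p ∷ S) i) l)
      listed []      = refl
      listed (i ∷ l) = cong (_ ∷_) (listed l)

    Spanned : List (Fin 3) → Set
    Spanned ks = ∀ w → map proj₁ w ↭ ks → word w V.≈ []

    low₀ : ∀ ks → suc (length ks) < n → Spanned ks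
    low₀ = Spanning.low₀ V torsion-free word word-alt word-anti word-ideal

    first₀ : ∀ ks → suc (length ks) ≡ n → ∀ l₀ → Unique l₀ → length l₀ ≡ length ks →
             word (place (singletons ks) l₀) V.≈ [] → Spanned ks
    first₀ = Spanning.first₀ V torsion-free word word-alt word-anti word-ideal

    second₀ : ∀ ks → length ks ≡ n →
      (∀ {m m′ i : Fin n} {G} → allFin n ↭ m ∷ m′ ∷ i ∷ map proj₂ G → 0F ∷ 1F ∷ 2F ∷ map proj₁ G ↭ ks →
       word ((0F , m) ∷ (1F , m) ∷ (2F , i) ∷ G) V.≈ []) → Fin n → Spanned ks
    second₀ = Spanning.second₀ V torsion-free word word-alt word-anti word-ideal

    second-base : ∀ ks l₀ → 3 ℕ.+ length ks ≡ n → Unique l₀ → length l₀ ≡ 2 ℕ.+ length ks →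
      word (place ((0F ∷ 1F ∷ []) ∷ (2F ∷ []) ∷ singletons ks) l₀) V.≈ [] →
      ∀ {m m′ i : Fin n} {G} → allFin n ↭ m ∷ m′ ∷ i ∷ map proj₂ G → map proj₁ G ↭ ks →
      word ((0F , m) ∷ (1F , m) ∷ (2F , i) ∷ G) V.≈ []
    second-base = Spanning.second-base V torsion-free word word-alt word-anti word-ideal

    high₀ : Fin n → ∀ ks → n < length ks → Spanned ks
    high₀ = Spanning.high₀ V torsion-free word word-alt word-anti word-ideal

    P-allKinds : ∀ {a b c} → (∀ w → HasKinds a b c w → P (word w)) → ∀ f → AllKinds a b c f → P f
    P-allKinds h []            []       = P-zero {[]} H-ε
    P-allKinds h ((q , w) ∷ f) (k ∷ ks) = P-⊕ {(q , w) ∷ []} (subst (λ r → P ((r , w) ∷ [])) (ℚₚ.*-identityʳ q) (P-· q {word w} (h w k)))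
      (P-allKinds h f ks)

    homogeneous⇒P : ∀ {a b c} → (∀ w → HasKinds a b c w → P (word w)) → ∀ {f} → Homog a b c f → P f
    homogeneous⇒P {a} {b} {c} h {f} hom = P-resp {homogeneous a b c f} {f} (λ S → ≡.sym (homogeneous≃ {f = f} hom S))
      (P-allKinds h (homogeneous a b c f) (Allₚ.all-filter (λ t → hasKinds? a b c (proj₂ t)) f))

  -- With z = 0 the hypothesis puts `𝒜 y` into I, and for a sign class `𝒜 y` is a nonzero multiple
  -- of y modulo I.
  sign-multiplicity₀ : ∀ {a b c} → (∀ w → HasKinds a b c w → Modulo.P [] (word w)) → SignMultiplicity n a b c 0
  sign-multiplicity₀ {a} {b} {c} h = (λ ()) , (λ ()) , (λ _ _ ()) , λ y (hom , sgn-y) →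
    let r , e = ∼-cancel {g = []} factorial≢0 (∼-trans (∼-sym (𝒜-scales sgn-y)) (Modulo.equal (Modulo.homogeneous⇒P [] h {y} hom)))
    in (λ ()) , difference e

  -- One-dimensional sign components

  lincomb-one : ∀ (q : Fin 1 → ℚ) (x : Λ n) → lincomb q (λ _ → x) ≡ q 0F · x
  lincomb-one q x = Listₚ.++-identityʳ (q 0F · x)

  one-dimensional : ∀ {a b c} x → SignIso a b c x → ∀ L → extend L x ≢ 0ℚ → (∀ {f} → InI f → extend L f ≡ 0ℚ) →
    (∀ y → SignIso a b c y → ∃ λ r → y ∼ (r · x)) → SignMultiplicity n a b c 1
  one-dimensional x sgn-x L value kills span =
    (λ _ → x) , (λ _ → sgn-x) ,
    (λ { q e 0F → cancel₀ value (≡.trans (ℚₚ.*-comm (extend L x) (q 0F)) (≡.trans (≡.sym (extend-· L (q 0F) x))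
      (kills {q 0F · x} (subst InI (lincomb-one q x) e)))) }) ,
    λ y sgn-y → let r , e = span y sgn-y in
      (λ _ → r) , subst (λ f → InI (y ⊖ f)) (≡.sym (lincomb-one (λ _ → r) x)) (difference e)

  -- The detector does not vanish on `ℬ` of the reference word, since it scales `ℬ` by a factorial;
  -- as it kills I, the class is nonzero. Spanning is known relative to `𝒜` of that word, and `z∼x`
  -- reconciles the two.
  sign-multiplicity₁ : ∀ {a b c} (x₀ : Word n) → HasKinds a b c x₀ → Detector x₀ →
    (∀ w → HasKinds a b c w → Modulo.P (𝒜 (word x₀)) (word w)) → SignMultiplicity n a b c 1
  sign-multiplicity₁ {a} {b} {c} x₀ k₀ Δ h =
    one-dimensional x (allKinds⇒Homog {f = x} (ℬ-kinds {f = word x₀} (k₀ ∷ [])) , x-modI) detect value (λ {f} → ideal-zero {f}) spanning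
    where
    open Detector Δ
    z = 𝒜 (word x₀)
    x = ℬ (word x₀)
    x-modI : SignModI x
    x-modI σ = difference (≃⇒∼ {act σ x} {sgn σ · x} (ℬ-sign (word x₀) σ))
    value : extend detect x ≢ 0ℚ
    value e = nonzero-x₀ (≡.trans (≡.sym (≡.trans (ℚₚ.+-identityʳ (1ℚ ℚ.* detect x₀)) (ℚₚ.*-identityˡ (detect x₀))))
      (cancel₀ factorial≢0 (≡.trans (≡.sym (detect-ℬ Δ (word x₀))) e)))
    -- Two evaluations of `𝒜 x`: the factorial times z by `𝒜ℬ`, and the factorial times x modulo I
    -- because x is a sign class.
    z∼x : z ∼ x
    z∼x = ∼-cancel₂ factorial≢0 (∼-trans (∼-sym (≃⇒∼ {𝒜 x} {factorial · z} (𝒜ℬ (word x₀)))) (𝒜-scales x-modI))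
    spanning : ∀ y → SignIso a b c y → ∃ λ r → y ∼ (r · x)
    spanning y (hom , sgn-y) =
      let s = Modulo.homogeneous⇒P z h {y} hom
          r , e = ∼-cancel factorial≢0 (∼-trans (∼-sym (𝒜-scales sgn-y)) (∼-trans (Modulo.equal s) (∼-· (Modulo.scalar s) z∼x)))
      in r ℚ.* Modulo.scalar s , ∼-trans e (≡⇒∼ (·-· r (Modulo.scalar s) x))

-- Case distinction by the total degree

length-kindList : ∀ a b c → length (kindList a b c) ≡ a ℕ.+ b ℕ.+ c
length-kindList a b c = ≡.trans (Listₚ.length-++ (replicate a 0F)) (≡.trans (≡.cong₂ ℕ._+_ (Listₚ.length-replicate a)
  (≡.trans (Listₚ.length-++ (replicate b 1F)) (≡.cong₂ ℕ._+_ (Listₚ.length-replicate b) (Listₚ.length-replicate c)))) (≡.sym (ℕₚ.+-assoc a b c)))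

kindList-suc : ∀ a b c → kindList (suc a) (suc b) (suc c) ↭ 0F ∷ 1F ∷ 2F ∷ kindList a b c
kindList-suc a b c = prep 0F (↭-trans (↭ₚ.shift 1F (replicate a 0F) _) (prep 1F
  (↭-trans (↭ₚ.++⁺ˡ (replicate a 0F) (↭ₚ.shift 2F (replicate b 1F) _)) (↭ₚ.shift 2F (replicate a 0F) _))))

≡ᵇ-≢ : ∀ {m k} → m ≢ k → (m ℕ.≡ᵇ k) ≡ false
≡ᵇ-≢ {m} {k} d with m ℕ.≡ᵇ k in e
... | true  = ⊥-elim (d (≡ᵇ⇒≡ {m} e))
... | false = refl

hcomp-≡ : ∀ {N} a b c → a ℕ.+ b ℕ.+ c ≡ N → hcomp N a b c ≡ 1
hcomp-≡ a b c refl = cong (if_then 1 else 0) (≡ᵇ-refl (a ℕ.+ b ℕ.+ c))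

hcomp-≢ : ∀ {N} a b c → a ℕ.+ b ℕ.+ c ≢ N → hcomp N a b c ≡ 0
hcomp-≢ a b c d = cong (if_then 1 else 0) (≡ᵇ-≢ d)

sum-suc : ∀ a b c → suc a ℕ.+ suc b ℕ.+ suc c ≡ 3 ℕ.+ (a ℕ.+ b ℕ.+ c)
sum-suc a b c = cong suc (≡.trans (ℕₚ.+-suc (a ℕ.+ suc b) c) (cong (λ x → suc (x ℕ.+ c)) (ℕₚ.+-suc a b)))

Positive : ℕ → ℕ → ℕ → Set
Positive a b c = (∃ λ a′ → a ≡ suc a′) × (∃ λ b′ → b ≡ suc b′) × (∃ λ c′ → c ≡ suc c′)

positive? : ∀ a b c → Dec (Positive a b c)
positive? zero    b       c       = no λ { ((_ , ()) , _) }
positive? (suc a) zero    c       = no λ { (_ , (_ , ()) , _) }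
positive? (suc a) (suc b) zero    = no λ { (_ , _ , _ , ()) }
positive? (suc a) (suc b) (suc c) = yes ((a , refl) , (b , refl) , (c , refl))

-- With n = N + 1, the second summand lives in degree n, at monomials divisible by uvw.
uvw-zero : ∀ N a b c → (Positive a b c → a ℕ.+ b ℕ.+ c ≢ suc N) → uvw* (qbinom2 N) a b c ≡ 0
uvw-zero N             zero    b       c       h = refl
uvw-zero N             (suc a) zero    c       h = refl
uvw-zero N             (suc a) (suc b) zero    h = refl
uvw-zero zero          (suc a) (suc b) (suc c) h = refl
uvw-zero (suc zero)    (suc a) (suc b) (suc c) h = refl
uvw-zero (suc (suc M)) (suc a) (suc b) (suc c) h =
  hcomp-≢ a b c λ e → h ((a , refl) , (b , refl) , (c , refl)) (≡.trans (sum-suc a b c) (cong (3 ℕ.+_) e))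

uvw-one : ∀ N a b c → 3 ℕ.+ (a ℕ.+ b ℕ.+ c) ≡ suc N → uvw* (qbinom2 N) (suc a) (suc b) (suc c) ≡ 1
uvw-one (suc (suc M)) a b c e = hcomp-≡ a b c (ℕₚ.suc-injective (ℕₚ.suc-injective (ℕₚ.suc-injective e)))

dimension : ℕ → Poly3
dimension N = qbinom2 (suc (suc N)) +ₚ uvw* (qbinom2 N)

module _ (N a b c : ℕ) where

  private
    n = suc N
    ks = kindList a b c
    l₀ = tailIndices N

    length-ks : length ks ≡ a ℕ.+ b ℕ.+ c
    length-ks = length-kindList a b c

    length-l₀ : length l₀ ≡ N
    length-l₀ = Listₚ.length-tabulate {n = N} Fin.suc

    unique-l₀ : Unique l₀
    unique-l₀ = Uniqueₚ.tabulate⁺ Finₚ.suc-injective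

  vanishing : dimension N a b c ≡ 0 → (∀ w → HasKinds a b c w → Modulo.P {n} [] (word w)) → SignMultiplicity n a b c (dimension N a b c)
  vanishing e h = subst (SignMultiplicity n a b c) (≡.sym e) (sign-multiplicity₀ h)

  self : ∀ (x₀ : Word n) → Modulo.P (𝒜 (word x₀)) (word x₀)
  self x₀ = Modulo.spanned 1ℚ (≡⇒∼ (≡.sym (1· (𝒜 (word x₀)))))

  module _ (z : Λ n) where
    open Modulo z

    from-span : (∀ w → map proj₁ w ↭ ks → word w V.≈ []) → ∀ w → HasKinds a b c w → P (word w)
    from-span h w k = ≈ε⇒P {word w} (h w (hasKinds⇒↭ {w = w} k))

  low-case : a ℕ.+ b ℕ.+ c < N → SignMultiplicity n a b c (dimension N a b c)
  low-case lt = vanishing (≡.cong₂ ℕ._+_ (hcomp-≢ a b c (ℕₚ.<⇒≢ lt)) (uvw-zero N a b c λ _ e → ℕₚ.<⇒≢ (ℕₚ.m<n⇒m<1+n lt) e))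
    (from-span [] (Modulo.low₀ [] ks (s≤s (subst (_< N) (≡.sym length-ks) lt))))

  first-case : a ℕ.+ b ℕ.+ c ≡ N → SignMultiplicity n a b c (dimension N a b c)
  first-case e = subst (SignMultiplicity n a b c)
    (≡.sym (≡.cong₂ ℕ._+_ (hcomp-≡ a b c e) (uvw-zero N a b c λ _ e′ → ℕₚ.1+n≢n (≡.trans (≡.sym e′) e))))
    (sign-multiplicity₁ x₀ kinds-x₀ (detector₁ a b c e (≡.trans length-ks e))
      (from-span (𝒜 (word x₀)) (Modulo.first₀ (𝒜 (word x₀)) ks (cong suc (≡.trans length-ks e)) l₀ unique-l₀ length≡
        (Modulo.P⇒≈ε (𝒜 (word x₀)) {word x₀} (self x₀)))))
    where
    x₀ = place (singletons ks) l₀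
    length≡ : length l₀ ≡ length ks
    length≡ = ≡.trans length-l₀ (≡.sym (≡.trans length-ks e))
    kinds-x₀ : HasKinds a b c x₀
    kinds-x₀ = kinds↭⇒hasKinds {w = x₀} (↭-reflexive (proj₁ (place-kinds ks l₀ (≡.sym length≡))))

  -- The reduction in degree n ends at words in which all three kinds occur. If one of a, b, c is 0
  -- there are none, so the base case is vacuous.
  degenerate-case : ¬ Positive a b c → a ℕ.+ b ℕ.+ c ≡ suc N → SignMultiplicity n a b c (dimension N a b c)
  degenerate-case ¬p e = vanishing (≡.cong₂ ℕ._+_ (hcomp-≢ a b c (λ e′ → ℕₚ.1+n≢n (≡.trans (≡.sym e) e′))) (uvw-zero N a b c λ p _ → ¬p p))
    (from-span [] (Modulo.second₀ [] ks (≡.trans length-ks e) (λ {m} {m′} {i} {G} _ τ → ⊥-elim (¬p (positive {m} {i} {G} τ))) Fin.zero))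
    where
    positive : ∀ {m i : Fin n} {G} → 0F ∷ 1F ∷ 2F ∷ map proj₁ G ↭ ks → Positive a b c
    positive {m} {i} {G} τ with x , y , t ← kinds↭⇒hasKinds {w = (0F , m) ∷ (1F , m) ∷ (2F , i) ∷ G} τ =
      (_ , ≡.sym x) , (_ , ≡.sym y) , (_ , ≡.sym t)

  high-case : suc N < a ℕ.+ b ℕ.+ c → SignMultiplicity n a b c (dimension N a b c)
  high-case gt = vanishing (≡.cong₂ ℕ._+_ (hcomp-≢ a b c (λ e → ℕₚ.<⇒≢ (ℕₚ.<-trans (ℕₚ.n<1+n N) gt) (≡.sym e))) (uvw-zero N a b c λ _ e → ℕₚ.<⇒≢ gt (≡.sym e)))
    (from-span [] (Modulo.high₀ [] Fin.zero ks (subst (suc N <_) (≡.sym length-ks) gt)))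

second-case : ∀ N a b c → 3 ℕ.+ (a ℕ.+ b ℕ.+ c) ≡ suc N → SignMultiplicity (suc N) (suc a) (suc b) (suc c) (dimension N (suc a) (suc b) (suc c))
second-case N a b c e = subst (SignMultiplicity (suc N) (suc a) (suc b) (suc c))
  (≡.sym (≡.cong₂ ℕ._+_ (hcomp-≢ (suc a) (suc b) (suc c) (λ e′ → ℕₚ.1+n≢n (≡.trans (≡.sym (≡.trans (sum-suc a b c) e)) e′))) (uvw-one N a b c e)))
  (sign-multiplicity₁ x₀ kinds-x₀ (detector₂ a b c e length-2)
    (from-span N (suc a) (suc b) (suc c) z (Modulo.second₀ z (kindList (suc a) (suc b) (suc c))
      (≡.trans (length-kindList (suc a) (suc b) (suc c)) (≡.trans (sum-suc a b c) e))
      (λ {m} {m′} {i} {G} σ τ → Modulo.second-base z ks l₀ (cong suc length-2) (Uniqueₚ.tabulate⁺ Finₚ.suc-injective)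
        (≡.trans (Listₚ.length-tabulate {n = N} Fin.suc) (≡.sym length-2)) (Modulo.P⇒≈ε z {word x₀} (self N (suc a) (suc b) (suc c) x₀))
        {m} {m′} {i} {G} σ (↭ₚ.drop-∷ (↭ₚ.drop-∷ (↭ₚ.drop-∷ (↭-trans τ (kindList-suc a b c))))))
      Fin.zero)))
  where
  ks = kindList a b c
  l₀ = tailIndices N
  length-2 : 2 ℕ.+ length ks ≡ N
  length-2 = ≡.trans (cong (2 ℕ.+_) (length-kindList a b c)) (ℕₚ.suc-injective e)
  x₀ = place (secondBlocks a b c) l₀
  z = 𝒜 (word x₀)
  kinds-x₀ : HasKinds (suc a) (suc b) (suc c) x₀
  kinds-x₀ = kinds↭⇒hasKinds {w = x₀} (↭-trans (↭-reflexive (kinds-place l₀ (≡.trans length-2 (≡.sym (Listₚ.length-tabulate {n = N} Fin.suc)))))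
    (↭-sym (kindList-suc a b c)))
    where
    kinds-place : ∀ (l : List (Fin (suc N))) → 2 ℕ.+ length ks ≡ length l → map proj₁ (place (secondBlocks a b c) l) ≡ 0F ∷ 1F ∷ 2F ∷ ks
    kinds-place (m ∷ i ∷ l) e = cong (λ k → 0F ∷ 1F ∷ 2F ∷ k) (proj₁ (place-kinds ks l (ℕₚ.suc-injective (ℕₚ.suc-injective e))))

sign-multiplicity : ∀ N a b c → SignMultiplicity (suc N) a b c (dimension N a b c)
sign-multiplicity N a b c with ℕₚ.<-cmp (a ℕ.+ b ℕ.+ c) N
... | tri< lt _ _ = low-case N a b c lt
... | tri≈ _ e _  = first-case N a b c e
... | tri> _ _ gt with ℕₚ.m≤n⇒m<n∨m≡n gt
...   | inj₁ gt′ = high-case N a b c gt′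
...   | inj₂ e with positive? a b c
...     | no ¬p = degenerate-case N a b c ¬p (≡.sym e)
...     | yes ((a′ , refl) , (b′ , refl) , (c′ , refl)) = second-case N a′ b′ c′ (≡.trans (≡.sym (sum-suc a′ b′ c′)) (≡.sym e))

theorem1p1 : ∀ (n : ℕ) → 1 ≤ n →
    (∀ a b c → SignMultiplicity n a b c ((schur (n ∸ 1 ∷ []) +ₚ s-n-2-1-1 n) a b c)) ×
    (∀ a b c → (schur (n ∸ 1 ∷ []) +ₚ s-n-2-1-1 n) a b c ≡ (qbinom2 (suc n) +ₚ uvw* (qbinom2 (n ∸ 1))) a b c)
theorem1p1 (suc N) _ =
  (λ a b c → subst (SignMultiplicity (suc N) a b c) (≡.sym (schur-identity N a b c)) (sign-multiplicity N a b c)) ,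
  schur-identity N
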